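{- Let $M(n)$ and $T^\ast(n)$ be defined by $$\sum_{n\ge 0} M(n)q^n=\frac{f_2^5f_5^5}{f_1f_{10}},\qquad \sum_{n\ge 0} T^\ast(n)q^n=\frac{f_1^5f_{10}^5}{f_2f_5}.$$ Then for all integers $k\geq 1$ and $n\geq -1$, $$M(2^kn+2^{k+1}-1)\equiv 0\pmod{2^{k-1}},\qquad T^\ast(2^kn+2^{k+1}-2)\equiv 0\pmod{2^{k-1}}.$$
   Context: For a positive integer $m$, $f_m:=\prod_{n=1}^\infty(1-q^{mn})$, regarded as a formal power series in $q$ (or for $|q|<1$). -}

module Defs where

open import Data.Nat as ℕ using (ℕ; zero; suc)
open import Data.Integer as ℤ using (ℤ; +_; _+_; _*_; -_)
open import Data.List using (List; map; upTo; foldr)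
open import Relation.Nullary using (yes; no)

PowerSeries : Set
PowerSeries = ℕ → ℤ

sumℤ : List ℤ → ℤ
sumℤ = foldr _+_ (+ 0)

_⋆_ : PowerSeries → PowerSeries → PowerSeries
(a ⋆ b) n = sumℤ (map (λ i → a i * b (n ℕ.∸ i)) (upTo (suc n)))
infixl 7 _⋆_

one : PowerSeries
one zero = + 1
one (suc _) = + 0

_^⋆_ : PowerSeries → ℕ → PowerSeries
a ^⋆ zero = one
a ^⋆ suc k = a ⋆ (a ^⋆ k)
infixr 8 _^⋆_

qPow : ℕ → PowerSeries
qPow d n with n ℕ.≟ d
... | yes _ = + 1
... | no _ = + 0

oneMinusQ^ : ℕ → PowerSeries
oneMinusQ^ d n = one n + - qPow d n

partialProd : ℕ → ℕ → PowerSeries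
partialProd m zero = one
partialProd m (suc N) = partialProd m N ⋆ oneMinusQ^ (m ℕ.* suc N)

-- f_m = ∏_{n≥1} (1 - q^{m n}) as a formal power series (m ≥ 1):
-- its q^n coefficient equals that of the partial product up to N = n,
-- since the remaining factors are ≡ 1 mod q^{n+1}.
f : ℕ → PowerSeries
f m n = partialProd m n n

{-# OPTIONS --safe #-}

-- Put a = q f₅⁵/f₁ and b = f₁⁵/f₅. Then F = Σ M(n) qⁿ⁺¹ = a(q) b(q²) and G = Σ T*(n) qⁿ⁺² = a(q²) b(q).
-- Let U extract the coefficients of even index. From
--   U a = a + 2 a(q²),   U b = - b + 2 b(q²),   U H = - 4 H - 8 H(q²)   for H = a b
-- it follows that U F = H + 2 G and U G = - H + 2 F, that 2ᵏ divides Uᵏ H, and hence that 2ᵏ⁻¹ divides Uᵏ F and Uᵏ G.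
-- The identities for U come from the 2-dissection of φ(q) and φ(q)² together with
--   φ(q⁵) ψ(q²) - q φ(q) ψ(q¹⁰) = f₁ f₅,
--   ψ(q)² - q ψ(q⁵)² = f(q,q⁴) f(q²,q³),
--   φ(-q⁵)² - φ(-q)² = 4 q f(-q,-q⁹) f(-q³,-q⁷).
-- As lattice sums these are changes of variables in u² + 5v² and, modulo 2 + i, in x² + y²;
-- the Jacobi triple product, obtained as a limit of the q-binomial theorem, turns the theta series into eta quotients.

module Submission where

open import Defs
open import Data.Nat as ℕ using (ℕ; zero; suc; _≤_; z≤n; s≤s)
import Data.Nat.Divisibility as ℕD
import Data.Nat.Properties as ℕP
import Data.Nat.Solver as ℕSolver
open import Data.Integer as ℤ using (ℤ; +_; -[1+_]; _+_; _*_; _-_; -_; _⊖_; -1ℤ)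
open import Data.Integer.Divisibility using (_∣_)
import Data.Integer.DivMod as ℤD
import Data.Integer.Properties as ℤP
import Data.Integer.Solver as ℤSolver
open import Relation.Binary.PropositionalEquality
  using (_≡_; _≢_; refl; sym; trans; cong; cong₂; subst; module ≡-Reasoning)
open import Data.Product using (_×_; _,_; proj₁; proj₂; ∃; uncurry)
open import Algebra.Bundles using (CommutativeRing; RawRing)
open import Algebra.Properties.AbelianGroup ℤP.+-0-abelianGroup using ()
  renaming (∙-cancelʳ to +-cancelʳ-≡; ∙-cancelˡ to +-cancelˡ-≡)
import Algebra.Solver.Ring
open import Algebra.Solver.Ring.AlmostCommutativeRing using (fromCommutativeRing; _-Raw-AlmostCommutative⟶_)
open import Data.Bool using (Bool; true; false; if_then_else_)
open import Data.Fin as Fin using (Fin; zero; suc; toℕ)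
import Data.Fin.Properties as FinP
open import Data.List using (List; []; _∷_; map; upTo; applyUpTo; _++_; filter; cartesianProduct)
open import Data.List.Membership.Propositional using (_∈_)
open import Data.List.Membership.Propositional.Properties
  using (∈-map⁺; ∈-map⁻; ∈-filter⁺; ∈-filter⁻; ∈-cartesianProduct⁺; ∈-++⁺ˡ; ∈-++⁺ʳ; ∈-upTo⁺; ∈-upTo⁻)
open import Data.List.Membership.Propositional.Properties.WithK using (unique∧set⇒bag)
open import Data.List.Properties using (filter-accept; filter-reject; map-applyUpTo)
open import Data.List.Relation.Binary.BagAndSetEquality using (∼bag⇒↭)
open import Data.List.Relation.Binary.Permutation.Propositional as Perm using (_↭_)
import Data.List.Relation.Unary.AllPairs as AllPairs
open import Data.List.Relation.Unary.Any using (here; there)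
open import Data.List.Relation.Unary.Unique.Propositional using (Unique)
import Data.List.Relation.Unary.Unique.Propositional.Properties as Unique
open import Data.Maybe as Maybe using (Maybe)
open import Function using (_∘_; id; _↔_; Inverse; mk↔ₛ′; mk⇔)
open import Function.Construct.Composition using (_↔-∘_)
open import Function.Construct.Identity using (↔-id)
open import Level using (0ℓ)
open import Relation.Binary using (Setoid)
import Relation.Binary.Reasoning.Setoid
open import Relation.Nullary using (yes; no; contradiction)
open import Relation.Nullary.Decidable using (dec⇒maybe)

-- The ring of power series

-- The relations for U say that a, b and H are eigenforms of the Hecke operator at 2: a and b have
-- weight 2 and the quadratic character modulo 5, whose value at 2 is -1, with eigenvalues 1 and -1;
-- H is the newform of weight 4 and level 5, with eigenvalue -4. Here they are derived from product
-- identities alone. For a the Hecke polynomial is x² - x - 2 = (x - 2)(x + 1), and a + a(q²),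
-- killed by U - 2, is the eta quotient q `Z₁`. For b it is x² + x - 2 = (x + 2)(x - 1), and b(q²) -
-- b, killed by U + 2, is 5 q `Z₂`. Both `Z₁` and `Z₂` are a series in q² times φ(q) φ(-q⁵) or φ(-q)
-- φ(q⁵), whose odd part is a single product. For H the polynomial x² + 4x + 8 has no integer root,
-- so f₁⁴ f₅⁴ is dissected directly. The obstacle is the rearrangement of infinite sums. A theta
-- series is therefore treated as a series indexed by a set, determined modulo each power of q by a
-- finite list, and a change of variables is a bijection of index sets.

tail : PowerSeries → PowerSeries
tail x n = x (suc n)

⋆-zero : ∀ x y → (x ⋆ y) 0 ≡ x 0 * y 0
⋆-zero x y = ℤP.+-identityʳ _

-- Convolution is defined by a list sum; with this recursion on the first factor the ring laws
-- become inductions on the index.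
⋆-suc : ∀ x y n → (x ⋆ y) (suc n) ≡ x 0 * y (suc n) + (tail x ⋆ y) n
⋆-suc x y n = cong (λ l → x 0 * y (suc n) + sumℤ l)
  (trans (map-applyUpTo suc (λ i → x i * y (suc n ℕ.∸ i)) (suc n)) (sym (map-applyUpTo id (λ i → tail x i * y (n ℕ.∸ i)) (suc n))))

⋆-cong-≤ : ∀ n {x x′ y y′} → (∀ i → i ≤ n → x i ≡ x′ i) → (∀ i → i ≤ n → y i ≡ y′ i) →
  (x ⋆ y) n ≡ (x′ ⋆ y′) n
⋆-cong-≤ zero {x} {x′} {y} {y′} p q = begin
  (x ⋆ y) 0    ≡⟨ ⋆-zero x y ⟩
  x 0 * y 0    ≡⟨ cong₂ _*_ (p 0 z≤n) (q 0 z≤n) ⟩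
  x′ 0 * y′ 0  ≡⟨ ⋆-zero x′ y′ ⟨
  (x′ ⋆ y′) 0  ∎
  where open ≡-Reasoning
⋆-cong-≤ (suc n) {x} {x′} {y} {y′} p q = begin
  (x ⋆ y) (suc n)                        ≡⟨ ⋆-suc x y n ⟩
  x 0 * y (suc n) + (tail x ⋆ y) n       ≡⟨ cong₂ _+_ (cong₂ _*_ (p 0 z≤n) (q _ ℕP.≤-refl))
                                              (⋆-cong-≤ n (λ i i≤n → p (suc i) (s≤s i≤n)) (λ i i≤n → q i (ℕP.m≤n⇒m≤1+n i≤n))) ⟩
  x′ 0 * y′ (suc n) + (tail x′ ⋆ y′) n   ≡⟨ ⋆-suc x′ y′ n ⟨
  (x′ ⋆ y′) (suc n)                      ∎
  where open ≡-Reasoning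

module _ where
  open ℤSolver.+-*-Solver
  open ≡-Reasoning

  -- Mirror image of `⋆-suc`, peeling off the second factor; commutativity is the comparison of the
  -- two recursions.
  ⋆-suc′ : ∀ x y n → (x ⋆ y) (suc n) ≡ x (suc n) * y 0 + (x ⋆ tail y) n
  ⋆-suc′ x y zero = begin
    (x ⋆ y) 1                      ≡⟨ ⋆-suc x y 0 ⟩
    x 0 * y 1 + (tail x ⋆ y) 0     ≡⟨ cong (_+_ (x 0 * y 1)) (⋆-zero (tail x) y) ⟩
    x 0 * y 1 + x 1 * y 0          ≡⟨ ℤP.+-comm (x 0 * y 1) _ ⟩
    x 1 * y 0 + x 0 * y 1          ≡⟨ cong (_+_ (x 1 * y 0)) (⋆-zero x (tail y)) ⟨
    x 1 * y 0 + (x ⋆ tail y) 0     ∎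
  ⋆-suc′ x y (suc n) = begin
    (x ⋆ y) (2 ℕ.+ n)
      ≡⟨ ⋆-suc x y (suc n) ⟩
    x 0 * y (2 ℕ.+ n) + (tail x ⋆ y) (suc n)
      ≡⟨ cong (_+_ (x 0 * y (2 ℕ.+ n))) (⋆-suc′ (tail x) y n) ⟩
    x 0 * y (2 ℕ.+ n) + (x (2 ℕ.+ n) * y 0 + (tail x ⋆ tail y) n)
      ≡⟨ solve 3 (λ a b c → a :+ (b :+ c) := b :+ (a :+ c)) refl (x 0 * y (2 ℕ.+ n)) (x (2 ℕ.+ n) * y 0) _ ⟩
    x (2 ℕ.+ n) * y 0 + (x 0 * y (2 ℕ.+ n) + (tail x ⋆ tail y) n)
      ≡⟨ cong (_+_ (x (2 ℕ.+ n) * y 0)) (⋆-suc x (tail y) n) ⟨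
    x (2 ℕ.+ n) * y 0 + (x ⋆ tail y) (suc n) ∎

  ⋆-comm : ∀ x y n → (x ⋆ y) n ≡ (y ⋆ x) n
  ⋆-comm x y zero = trans (⋆-zero x y) (trans (ℤP.*-comm (x 0) _) (sym (⋆-zero y x)))
  ⋆-comm x y (suc n) = begin
    (x ⋆ y) (suc n)                      ≡⟨ ⋆-suc x y n ⟩
    x 0 * y (suc n) + (tail x ⋆ y) n     ≡⟨ cong₂ _+_ (ℤP.*-comm (x 0) _) (⋆-comm (tail x) y n) ⟩
    y (suc n) * x 0 + (y ⋆ tail x) n     ≡⟨ ⋆-suc′ y x n ⟨
    (y ⋆ x) (suc n)                      ∎

  ⋆-distribʳ : ∀ x y z n → ((λ i → y i + z i) ⋆ x) n ≡ (y ⋆ x) n + (z ⋆ x) n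
  ⋆-distribʳ x y z zero = begin
    ((λ i → y i + z i) ⋆ x) 0    ≡⟨ ⋆-zero (λ i → y i + z i) x ⟩
    (y 0 + z 0) * x 0            ≡⟨ ℤP.*-distribʳ-+ (x 0) (y 0) (z 0) ⟩
    y 0 * x 0 + z 0 * x 0        ≡⟨ cong₂ _+_ (⋆-zero y x) (⋆-zero z x) ⟨
    (y ⋆ x) 0 + (z ⋆ x) 0        ∎
  ⋆-distribʳ x y z (suc n) = begin
    ((λ i → y i + z i) ⋆ x) (suc n)
      ≡⟨ ⋆-suc (λ i → y i + z i) x n ⟩
    (y 0 + z 0) * x (suc n) + ((λ i → tail y i + tail z i) ⋆ x) n
      ≡⟨ cong (_+_ ((y 0 + z 0) * x (suc n))) (⋆-distribʳ x (tail y) (tail z) n) ⟩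
    (y 0 + z 0) * x (suc n) + ((tail y ⋆ x) n + (tail z ⋆ x) n)
      ≡⟨ solve 5 (λ a b c d e → (a :+ b) :* c :+ (d :+ e) := (a :* c :+ d) :+ (b :* c :+ e)) refl
           (y 0) (z 0) (x (suc n)) _ _ ⟩
    (y 0 * x (suc n) + (tail y ⋆ x) n) + (z 0 * x (suc n) + (tail z ⋆ x) n)
      ≡⟨ cong₂ _+_ (⋆-suc y x n) (⋆-suc z x n) ⟨
    (y ⋆ x) (suc n) + (z ⋆ x) (suc n) ∎

  ⋆-scaleˡ : ∀ c x y n → ((λ i → c * x i) ⋆ y) n ≡ c * (x ⋆ y) n
  ⋆-scaleˡ c x y zero = begin
    ((λ i → c * x i) ⋆ y) 0   ≡⟨ ⋆-zero (λ i → c * x i) y ⟩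
    c * x 0 * y 0             ≡⟨ ℤP.*-assoc c (x 0) (y 0) ⟩
    c * (x 0 * y 0)           ≡⟨ cong (c *_) (⋆-zero x y) ⟨
    c * (x ⋆ y) 0             ∎
  ⋆-scaleˡ c x y (suc n) = begin
    ((λ i → c * x i) ⋆ y) (suc n)
      ≡⟨ ⋆-suc (λ i → c * x i) y n ⟩
    c * x 0 * y (suc n) + ((λ i → c * tail x i) ⋆ y) n
      ≡⟨ cong (_+_ (c * x 0 * y (suc n))) (⋆-scaleˡ c (tail x) y n) ⟩
    c * x 0 * y (suc n) + c * (tail x ⋆ y) n
      ≡⟨ solve 4 (λ c a b d → c :* a :* b :+ c :* d := c :* (a :* b :+ d)) refl c (x 0) (y (suc n)) _ ⟩
    c * (x 0 * y (suc n) + (tail x ⋆ y) n)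
      ≡⟨ cong (c *_) (⋆-suc x y n) ⟨
    c * (x ⋆ y) (suc n) ∎

  ⋆-assoc : ∀ x y z n → ((x ⋆ y) ⋆ z) n ≡ (x ⋆ (y ⋆ z)) n
  ⋆-assoc x y z zero = begin
    ((x ⋆ y) ⋆ z) 0         ≡⟨ ⋆-zero (x ⋆ y) z ⟩
    (x ⋆ y) 0 * z 0         ≡⟨ cong (_* z 0) (⋆-zero x y) ⟩
    x 0 * y 0 * z 0         ≡⟨ ℤP.*-assoc (x 0) _ _ ⟩
    x 0 * (y 0 * z 0)       ≡⟨ cong (x 0 *_) (⋆-zero y z) ⟨
    x 0 * (y ⋆ z) 0         ≡⟨ ⋆-zero x (y ⋆ z) ⟨
    (x ⋆ (y ⋆ z)) 0         ∎
  ⋆-assoc x y z (suc n) = begin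
    ((x ⋆ y) ⋆ z) (suc n)
      ≡⟨ ⋆-suc (x ⋆ y) z n ⟩
    (x ⋆ y) 0 * z (suc n) + (tail (x ⋆ y) ⋆ z) n
      ≡⟨ cong₂ (λ a b → a * z (suc n) + b) (⋆-zero x y)
           (⋆-cong-≤ n {y = z} {z} (λ i _ → ⋆-suc x y i) (λ _ _ → refl)) ⟩
    x 0 * y 0 * z (suc n) + ((λ i → x 0 * tail y i + (tail x ⋆ y) i) ⋆ z) n
      ≡⟨ cong (_+_ (x 0 * y 0 * z (suc n))) (⋆-distribʳ z (λ i → x 0 * tail y i) (tail x ⋆ y) n) ⟩
    x 0 * y 0 * z (suc n) + (((λ i → x 0 * tail y i) ⋆ z) n + ((tail x ⋆ y) ⋆ z) n)
      ≡⟨ cong₂ (λ a b → x 0 * y 0 * z (suc n) + (a + b)) (⋆-scaleˡ (x 0) (tail y) z n) (⋆-assoc (tail x) y z n) ⟩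
    x 0 * y 0 * z (suc n) + (x 0 * (tail y ⋆ z) n + (tail x ⋆ (y ⋆ z)) n)
      ≡⟨ solve 5 (λ a b c d e → a :* b :* c :+ (a :* d :+ e) := a :* (b :* c :+ d) :+ e) refl
           (x 0) (y 0) (z (suc n)) _ _ ⟩
    x 0 * (y 0 * z (suc n) + (tail y ⋆ z) n) + (tail x ⋆ (y ⋆ z)) n
      ≡⟨ cong (λ a → x 0 * a + (tail x ⋆ (y ⋆ z)) n) (⋆-suc y z n) ⟨
    x 0 * (y ⋆ z) (suc n) + (tail x ⋆ (y ⋆ z)) n
      ≡⟨ ⋆-suc x (y ⋆ z) n ⟨
    (x ⋆ (y ⋆ z)) (suc n) ∎

  ⋆-zeroˡ : ∀ x n → ((λ _ → + 0) ⋆ x) n ≡ + 0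
  ⋆-zeroˡ x zero = refl
  ⋆-zeroˡ x (suc n) = trans (⋆-suc (λ _ → + 0) x n) (trans (ℤP.+-identityˡ _) (⋆-zeroˡ x n))

  ⋆-identityˡ : ∀ x n → (one ⋆ x) n ≡ x n
  ⋆-identityˡ x zero = trans (⋆-zero one x) (ℤP.*-identityˡ (x 0))
  ⋆-identityˡ x (suc n) = trans (⋆-suc one x n)
    (trans (cong₂ _+_ (ℤP.*-identityˡ (x (suc n))) (⋆-zeroˡ x n)) (ℤP.+-identityʳ _))

infix 4 _≈_
-- A record instead of a bare pointwise equality, so that both series can be inferred from a proof.
record _≈_ (x y : PowerSeries) : Set where
  constructor mk≈
  field coeff : ∀ n → x n ≡ y n
open _≈_ public

infixl 6 _⊕_
infixl 7 _∙_
infix 8 ⊝_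

-- Opaque, so that sums and products of series do not unfold into convolutions during unification
-- and ring solving.
opaque
  _⊕_ _∙_ : PowerSeries → PowerSeries → PowerSeries
  (x ⊕ y) n = x n + y n
  _∙_ = _⋆_

  ⊝_ : PowerSeries → PowerSeries
  (⊝ x) n = - x n

  const : ℤ → PowerSeries
  const c zero = c
  const c (suc n) = + 0

𝟎 𝟏 : PowerSeries
𝟎 = const (+ 0)
𝟏 = const (+ 1)

opaque
  unfolding _⊕_

  ∙-⋆ : ∀ x y n → (x ∙ y) n ≡ (x ⋆ y) n
  ∙-⋆ x y n = refl

  ⊕-coeff : ∀ x y n → (x ⊕ y) n ≡ x n + y n
  ⊕-coeff x y n = refl

  ⊝-coeff : ∀ x n → (⊝ x) n ≡ - x n
  ⊝-coeff x n = refl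

  one≈𝟏 : one ≈ 𝟏
  one≈𝟏 = mk≈ λ { zero → refl ; (suc n) → refl }

  const-coeff : ∀ c n → const c n ≡ c * one n
  const-coeff c zero = sym (ℤP.*-identityʳ c)
  const-coeff c (suc n) = sym (ℤP.*-zeroʳ c)

  𝟎-coeff : ∀ n → 𝟎 n ≡ + 0
  𝟎-coeff zero = refl
  𝟎-coeff (suc n) = refl

  const-∙ : ∀ c x n → (const c ∙ x) n ≡ c * x n
  const-∙ c x n = begin
    (const c ⋆ x) n              ≡⟨ ⋆-cong-≤ n {y = x} {x} (λ i _ → const-coeff c i) (λ _ _ → refl) ⟩
    ((λ i → c * one i) ⋆ x) n    ≡⟨ ⋆-scaleˡ c one x n ⟩
    c * (one ⋆ x) n              ≡⟨ cong (c *_) (⋆-identityˡ x n) ⟩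
    c * x n                      ∎
    where open ≡-Reasoning

seriesRing : CommutativeRing 0ℓ 0ℓ
seriesRing = record
  { Carrier = PowerSeries
  ; _≈_ = _≈_
  ; _+_ = _⊕_
  ; _*_ = _∙_
  ; -_ = ⊝_
  ; 0# = 𝟎
  ; 1# = 𝟏
  ; isCommutativeRing = isCR
  }
  where
  opaque
    unfolding _⊕_
    open import Algebra.Structures _≈_ using (IsCommutativeRing)
    𝟏-idˡ : ∀ x → 𝟏 ∙ x ≈ x
    𝟏-idˡ x = mk≈ λ n → trans (const-∙ (+ 1) x n) (ℤP.*-identityˡ (x n))
    comm : ∀ x y → x ∙ y ≈ y ∙ x
    comm x y = mk≈ (⋆-comm x y)
    distʳ : ∀ x y z → (y ⊕ z) ∙ x ≈ y ∙ x ⊕ z ∙ x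
    distʳ x y z = mk≈ (⋆-distribʳ x y z)
    ≈t : ∀ {x y z} → x ≈ y → y ≈ z → x ≈ z
    ≈t p q = mk≈ λ n → trans (coeff p n) (coeff q n)
    isCR : IsCommutativeRing _⊕_ _∙_ ⊝_ 𝟎 𝟏
    isCR = record
      { isRing = record
        { +-isAbelianGroup = record
          { isGroup = record
            { isMonoid = record
              { isSemigroup = record
                { isMagma = record
                  { isEquivalence = record
                    { refl = mk≈ λ _ → refl
                    ; sym = λ p → mk≈ λ n → sym (coeff p n)
                    ; trans = ≈t
                    }
                  ; ∙-cong = λ p q → mk≈ λ n → cong₂ _+_ (coeff p n) (coeff q n)
                  }
                ; assoc = λ x y z → mk≈ λ n → ℤP.+-assoc (x n) (y n) (z n)
                }
              ; identity = (λ x → mk≈ λ n → trans (cong (_+ x n) (𝟎-coeff n)) (ℤP.+-identityˡ (x n)))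
                         , (λ x → mk≈ λ n → trans (cong (_+_ (x n)) (𝟎-coeff n)) (ℤP.+-identityʳ (x n)))
              }
            ; inverse = (λ x → mk≈ λ n → trans (ℤP.+-inverseˡ (x n)) (sym (𝟎-coeff n)))
                      , (λ x → mk≈ λ n → trans (ℤP.+-inverseʳ (x n)) (sym (𝟎-coeff n)))
            ; ⁻¹-cong = λ p → mk≈ λ n → cong -_ (coeff p n)
            }
          ; comm = λ x y → mk≈ λ n → ℤP.+-comm (x n) (y n)
          }
        ; *-cong = λ p q → mk≈ λ n → ⋆-cong-≤ n (λ i _ → coeff p i) (λ i _ → coeff q i)
        ; *-assoc = λ x y z → mk≈ (⋆-assoc x y z)
        ; *-identity = 𝟏-idˡ , (λ x → ≈t (comm x 𝟏) (𝟏-idˡ x))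
        ; distrib = (λ x y z → ≈t (comm x (y ⊕ z))
                       (≈t (distʳ x y z) (mk≈ λ n → cong₂ _+_ (⋆-comm y x n) (⋆-comm z x n))))
                  , distʳ
        }
      ; *-comm = comm
      }

module R = CommutativeRing seriesRing

ℤ-rawRing : RawRing 0ℓ 0ℓ
ℤ-rawRing = record { Carrier = ℤ ; _≈_ = _≡_ ; _+_ = _+_ ; _*_ = _*_ ; -_ = -_ ; 0# = + 0 ; 1# = + 1 }

const-morphism : ℤ-rawRing -Raw-AlmostCommutative⟶ fromCommutativeRing seriesRing
const-morphism = record
  { ⟦_⟧ = const
  ; +-homo = +h
  ; *-homo = λ a b → mk≈ λ n → sym (trans (const-∙ a (const b) n)
      (trans (cong (a *_) (const-coeff b n)) (trans (sym (ℤP.*-assoc a b (one n))) (sym (const-coeff (a * b) n)))))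
  ; -‿homo = -h
  ; 0-homo = R.refl
  ; 1-homo = R.refl
  }
  where
  opaque
    unfolding _⊕_
    +h : ∀ a b → const (a + b) ≈ const a ⊕ const b
    +h a b = mk≈ λ { zero → refl ; (suc n) → refl }
    -h : ∀ a → const (- a) ≈ ⊝ const a
    -h a = mk≈ λ { zero → refl ; (suc n) → refl }

const≟ : ∀ a b → Maybe (const a ≈ const b)
const≟ a b = Maybe.map (λ { refl → R.refl }) (dec⇒maybe (a ℤP.≟ b))

module Solver = Algebra.Solver.Ring ℤ-rawRing (fromCommutativeRing seriesRing) const-morphism const≟

module ≈-Reasoning = Relation.Binary.Reasoning.Setoid R.setoid

-- Truncation, powers of q and inverses

-- x ≈[ N ] y is congruence modulo q^(N+1)
infix 4 _≈[_]_
record _≈[_]_ (x : PowerSeries) (N : ℕ) (y : PowerSeries) : Set where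
  constructor mk≈[]
  field upTo≤ : ∀ n → n ≤ N → x n ≡ y n
open _≈[_]_ public

≈⇒≈[] : ∀ {N x y} → x ≈ y → x ≈[ N ] y
≈⇒≈[] p = mk≈[] λ n _ → coeff p n

≈[]⇒≈ : ∀ {x y} → (∀ N → x ≈[ N ] y) → x ≈ y
≈[]⇒≈ p = mk≈ λ n → upTo≤ (p n) n ℕP.≤-refl

≈[]-mono : ∀ {M N x y} → M ≤ N → x ≈[ N ] y → x ≈[ M ] y
≈[]-mono M≤N p = mk≈[] λ n n≤M → upTo≤ p n (ℕP.≤-trans n≤M M≤N)

≈[]-refl : ∀ {N x} → x ≈[ N ] x
≈[]-refl = mk≈[] λ _ _ → refl

≈[]-sym : ∀ {N x y} → x ≈[ N ] y → y ≈[ N ] x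
≈[]-sym p = mk≈[] λ n n≤N → sym (upTo≤ p n n≤N)

≈[]-trans : ∀ {N x y z} → x ≈[ N ] y → y ≈[ N ] z → x ≈[ N ] z
≈[]-trans p q = mk≈[] λ n n≤N → trans (upTo≤ p n n≤N) (upTo≤ q n n≤N)

≈[]-setoid : ℕ → Setoid _ _
≈[]-setoid N = record
  { Carrier = PowerSeries ; _≈_ = λ x y → x ≈[ N ] y
  ; isEquivalence = record { refl = ≈[]-refl ; sym = ≈[]-sym ; trans = ≈[]-trans } }

module ≈[]-Reasoning {N} = Relation.Binary.Reasoning.Setoid (≈[]-setoid N)

opaque
  unfolding _⊕_

  ⊕-cong[] : ∀ {N x x′ y y′} → x ≈[ N ] x′ → y ≈[ N ] y′ → x ⊕ y ≈[ N ] x′ ⊕ y′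
  ⊕-cong[] p q = mk≈[] λ n n≤N → cong₂ _+_ (upTo≤ p n n≤N) (upTo≤ q n n≤N)

  ⊝-cong[] : ∀ {N x x′} → x ≈[ N ] x′ → ⊝ x ≈[ N ] ⊝ x′
  ⊝-cong[] p = mk≈[] λ n n≤N → cong -_ (upTo≤ p n n≤N)

  ∙-cong[] : ∀ {N x x′ y y′} → x ≈[ N ] x′ → y ≈[ N ] y′ → x ∙ y ≈[ N ] x′ ∙ y′
  ∙-cong[] p q = mk≈[] λ n n≤N → ⋆-cong-≤ n
    (λ i i≤n → upTo≤ p i (ℕP.≤-trans i≤n n≤N)) (λ i i≤n → upTo≤ q i (ℕP.≤-trans i≤n n≤N))

  ∙-zero : ∀ x y → (x ∙ y) 0 ≡ x 0 * y 0
  ∙-zero = ⋆-zero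

  ∙-suc : ∀ x y n → (x ∙ y) (suc n) ≡ x 0 * y (suc n) + (tail x ∙ y) n
  ∙-suc = ⋆-suc

  𝟏-zero : 𝟏 0 ≡ + 1
  𝟏-zero = refl

∙-congˡ[] : ∀ {N} x {y y′} → y ≈[ N ] y′ → x ∙ y ≈[ N ] x ∙ y′
∙-congˡ[] x = ∙-cong[] (≈[]-refl {x = x})

∙-congʳ[] : ∀ {N} y {x x′} → x ≈[ N ] x′ → x ∙ y ≈[ N ] x′ ∙ y
∙-congʳ[] y p = ∙-cong[] p (≈[]-refl {x = y})

qPow-≡ : ∀ d → qPow d d ≡ + 1
qPow-≡ d with d ℕ.≟ d
... | yes _ = refl
... | no d≢d = contradiction refl d≢d

qPow-≢ : ∀ {d n} → n ≢ d → qPow d n ≡ + 0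
qPow-≢ {d} {n} n≢d with n ℕ.≟ d
... | yes n≡d = contradiction n≡d n≢d
... | no _ = refl

qPow-suc : ∀ d n → qPow (suc d) (suc n) ≡ qPow d n
qPow-suc d n with n ℕ.≟ d
... | yes refl = qPow-≡ (suc d)
... | no n≢d = qPow-≢ (n≢d ∘ ℕP.suc-injective)

qPow-0 : qPow 0 ≈ 𝟏
qPow-0 = R.trans (mk≈ λ { zero → refl ; (suc n) → qPow-≢ {0} {suc n} λ () }) one≈𝟏

qPow-∙-zero : ∀ d x → (qPow (suc d) ∙ x) 0 ≡ + 0
qPow-∙-zero d x = ∙-zero (qPow (suc d)) x

qPow-∙-suc : ∀ d x n → (qPow (suc d) ∙ x) (suc n) ≡ (qPow d ∙ x) n
qPow-∙-suc d x n = begin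
  (qPow (suc d) ∙ x) (suc n)            ≡⟨ ∙-suc (qPow (suc d)) x n ⟩
  + 0 + (tail (qPow (suc d)) ∙ x) n     ≡⟨ ℤP.+-identityˡ _ ⟩
  (tail (qPow (suc d)) ∙ x) n           ≡⟨ coeff (R.*-congʳ {x = x} (mk≈ (qPow-suc d))) n ⟩
  (qPow d ∙ x) n                        ∎
  where open ≡-Reasoning

qPow-∙-+ : ∀ d x n → (qPow d ∙ x) (d ℕ.+ n) ≡ x n
qPow-∙-+ zero x n = coeff (R.trans (R.*-congʳ qPow-0) (R.*-identityˡ x)) n
qPow-∙-+ (suc d) x n = trans (qPow-∙-suc d x (d ℕ.+ n)) (qPow-∙-+ d x n)

qPow-+ : ∀ d e → qPow d ∙ qPow e ≈ qPow (d ℕ.+ e)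
qPow-+ zero e = R.trans (R.*-congʳ qPow-0) (R.*-identityˡ _)
qPow-+ (suc d) e = mk≈ λ
  { zero → qPow-∙-zero d (qPow e)
  ; (suc n) → trans (qPow-∙-suc d (qPow e) n) (trans (coeff (qPow-+ d e) n) (sym (qPow-suc (d ℕ.+ e) n))) }

qPow-cong : ∀ {d e} → d ≡ e → qPow d ≈ qPow e
qPow-cong refl = R.refl

-- Multiplication by a power of q gains precision. In the limit of the triple product this gain
-- compensates for Gaussian binomials that are still far from their limit.
qPow-cong[] : ∀ d {N x y} → x ≈[ N ] y → qPow d ∙ x ≈[ d ℕ.+ N ] qPow d ∙ y
qPow-cong[] zero p = ∙-congˡ[] (qPow 0) p
qPow-cong[] (suc d) {x = x} {y} p = mk≈[] λ
  { zero _ → trans (qPow-∙-zero d x) (sym (qPow-∙-zero d y))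
  ; (suc n) (s≤s n≤) → trans (qPow-∙-suc d x n)
      (trans (upTo≤ (qPow-cong[] d p) n n≤) (sym (qPow-∙-suc d y n))) }

qPow-cancel : ∀ d {x y} → qPow d ∙ x ≈ qPow d ∙ y → x ≈ y
qPow-cancel d {x} {y} p = mk≈ λ n →
  trans (sym (qPow-∙-+ d x n)) (trans (coeff p (d ℕ.+ n)) (qPow-∙-+ d y n))

qPow-small : ∀ {d N} → N ℕ.< d → qPow d ≈[ N ] 𝟎
qPow-small N<d = mk≈[] λ n n≤N →
  trans (qPow-≢ (λ n≡d → ℕP.<⇒≢ (ℕP.≤-<-trans n≤N N<d) n≡d)) (sym (𝟎-coeff n))

-- The inverse is the fixed point of y ↦ 1 - (x - 1) y. If x has constant term 1, then x - 1 has
-- none, each iteration settles one more coefficient, and `approx (suc n)` is correct up to index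
-- `n`.
module SeriesInverse (x : PowerSeries) where
  private
    u = x ⊕ ⊝ 𝟏

  approx : ℕ → PowerSeries
  approx zero = 𝟎
  approx (suc n) = 𝟏 ⊕ ⊝ (u ∙ approx n)

  inverse : PowerSeries
  inverse n = approx (suc n) n

  module _ (x0≡1 : x 0 ≡ + 1) where
    private
      u0≡0 : u 0 ≡ + 0
      u0≡0 = trans (⊕-coeff x (⊝ 𝟏) 0) (cong₂ _+_ x0≡1 (trans (⊝-coeff 𝟏 0) (cong -_ 𝟏-zero)))

      contract : ∀ {n y z} → y ≈[ n ] z → u ∙ y ≈[ suc n ] u ∙ z
      contract {n} {y} {z} p = mk≈[] go
        where
        go : ∀ i → i ≤ suc n → (u ∙ y) i ≡ (u ∙ z) i
        go zero _ = trans (∙-zero u y) (trans (cong (_* y 0) u0≡0)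
          (sym (trans (∙-zero u z) (cong (_* z 0) u0≡0))))
        go (suc i) (s≤s i≤n) = begin
          (u ∙ y) (suc i)                     ≡⟨ ∙-suc u y i ⟩
          u 0 * y (suc i) + (tail u ∙ y) i    ≡⟨ cong₂ _+_ (cong (_* y (suc i)) u0≡0)
                                                  (upTo≤ (∙-congˡ[] (tail u) p) i i≤n) ⟩
          + 0 + (tail u ∙ z) i                ≡⟨ cong (_+ (tail u ∙ z) i) (cong (_* z (suc i)) u0≡0) ⟨
          u 0 * z (suc i) + (tail u ∙ z) i    ≡⟨ ∙-suc u z i ⟨
          (u ∙ z) (suc i)                     ∎
          where open ≡-Reasoning

      approx-step : ∀ n → approx (suc n) ≈[ n ] approx (suc (suc n))
      approx-step zero = ⊕-cong[] ≈[]-refl (⊝-cong[] (mk≈[] λ { zero z≤n →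
        trans (∙-zero u (approx 0)) (trans (cong (_* approx 0 0) u0≡0)
          (sym (trans (∙-zero u (approx 1)) (cong (_* approx 1 0) u0≡0)))) }))
      approx-step (suc n) = ⊕-cong[] ≈[]-refl (⊝-cong[] (contract (approx-step n)))

      approx-stable : ∀ n k → approx (suc n) ≈[ n ] approx (k ℕ.+ suc n)
      approx-stable n zero = ≈[]-refl
      approx-stable n (suc k) = ≈[]-trans (approx-stable n k)
        (subst (λ m → approx m ≈[ n ] approx (suc m)) (sym (ℕP.+-suc k n))
          (≈[]-mono (ℕP.m≤n+m n k) (approx-step (k ℕ.+ n))))

      inverse-approx : ∀ n → inverse ≈[ n ] approx (suc n)
      inverse-approx n = mk≈[] λ i i≤n → upTo≤
        (subst (λ m → approx (suc i) ≈[ i ] approx m)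
          (trans (ℕP.+-suc (n ℕ.∸ i) i) (cong suc (ℕP.m∸n+n≡m i≤n)))
          (approx-stable i (n ℕ.∸ i))) i ℕP.≤-refl

      inverse-fix : inverse ≈ 𝟏 ⊕ ⊝ (u ∙ inverse)
      inverse-fix = ≈[]⇒≈ λ n → ≈[]-trans
        (≈[]-mono (ℕP.n≤1+n n) (inverse-approx (suc n)))
        (⊕-cong[] ≈[]-refl (⊝-cong[] (∙-congˡ[] u (≈[]-sym (inverse-approx n)))))

    inverse-correct : x ∙ inverse ≈ 𝟏
    inverse-correct = begin
      x ∙ inverse                                ≈⟨ solve 2 (λ x y → x :* y := (x :- con (+ 1)) :* y :+ y) R.refl x inverse ⟩
      u ∙ inverse ⊕ inverse                      ≈⟨ R.+-congˡ inverse-fix ⟩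
      u ∙ inverse ⊕ (𝟏 ⊕ ⊝ (u ∙ inverse))        ≈⟨ solve 1 (λ x → x :+ (con (+ 1) :- x) := con (+ 1)) R.refl (u ∙ inverse) ⟩
      𝟏                                          ∎
      where
      open ≈-Reasoning
      open Solver

open SeriesInverse public using (inverse; inverse-correct)

-- Finite products

∏ : ℕ → (ℕ → PowerSeries) → PowerSeries
∏ zero g = 𝟏
∏ (suc N) g = ∏ N g ∙ g N

∏-cong< : ∀ N {g h} → (∀ i → i ℕ.< N → g i ≈ h i) → ∏ N g ≈ ∏ N h
∏-cong< zero p = R.refl
∏-cong< (suc N) p = R.*-cong (∏-cong< N (λ i i<N → p i (ℕP.m≤n⇒m≤1+n i<N))) (p N ℕP.≤-refl)

∏-cong : ∀ N {g h} → (∀ i → g i ≈ h i) → ∏ N g ≈ ∏ N h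
∏-cong N p = ∏-cong< N (λ i _ → p i)

∏-∙ : ∀ N g h → ∏ N (λ i → g i ∙ h i) ≈ ∏ N g ∙ ∏ N h
∏-∙ zero g h = R.sym (R.*-identityˡ 𝟏)
∏-∙ (suc N) g h = R.trans (R.*-congʳ (∏-∙ N g h))
  (solve 4 (λ a b c d → (a :* b) :* (c :* d) := (a :* c) :* (b :* d)) R.refl (∏ N g) (∏ N h) (g N) (h N))
  where open Solver

∏-+ : ∀ M N g → ∏ (M ℕ.+ N) g ≈ ∏ M g ∙ ∏ N (λ i → g (M ℕ.+ i))
∏-+ M zero g rewrite ℕP.+-identityʳ M = R.sym (R.*-identityʳ _)
∏-+ M (suc N) g rewrite ℕP.+-suc M N = R.trans (R.*-congʳ (∏-+ M N g)) (R.*-assoc _ _ _)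

∏-front : ∀ N g → ∏ (suc N) g ≈ g 0 ∙ ∏ N (g ∘ suc)
∏-front N g = R.trans (∏-+ 1 N g) (R.*-congʳ (R.*-identityˡ (g 0)))

-- Sorts the factors by residue modulo `d`; all later splittings of a product into residue classes
-- are instances.
∏-* : ∀ N d g → ∏ (N ℕ.* d) g ≈ ∏ N (λ i → ∏ d (λ r → g (i ℕ.* d ℕ.+ r)))
∏-* zero d g = R.refl
∏-* (suc N) d g = begin
  ∏ (d ℕ.+ N ℕ.* d) g                                      ≡⟨ cong (λ m → ∏ m g) (ℕP.+-comm d (N ℕ.* d)) ⟩
  ∏ (N ℕ.* d ℕ.+ d) g                                      ≈⟨ ∏-+ (N ℕ.* d) d g ⟩
  ∏ (N ℕ.* d) g ∙ ∏ d (λ r → g (N ℕ.* d ℕ.+ r))            ≈⟨ R.*-congʳ (∏-* N d g) ⟩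
  ∏ N (λ i → ∏ d (λ r → g (i ℕ.* d ℕ.+ r))) ∙ ∏ d (λ r → g (N ℕ.* d ℕ.+ r)) ∎
  where open ≈-Reasoning

∏-reverse : ∀ N g → ∏ N (λ r → g (N ℕ.∸ suc r)) ≈ ∏ N g
∏-reverse zero g = R.refl
∏-reverse (suc N) g = begin
  ∏ N (λ r → g (N ℕ.∸ r)) ∙ g (N ℕ.∸ N)
    ≈⟨ R.*-cong (∏-cong< N (λ r r<N → R.reflexive (cong g (suc-∸ N r r<N)))) (R.reflexive (cong g (ℕP.n∸n≡0 N))) ⟩
  ∏ N (λ r → g (suc (N ℕ.∸ suc r))) ∙ g 0   ≈⟨ R.*-congʳ (∏-reverse N (g ∘ suc)) ⟩
  ∏ N (g ∘ suc) ∙ g 0                       ≈⟨ R.*-comm _ _ ⟩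
  g 0 ∙ ∏ N (g ∘ suc)                       ≈⟨ ∏-front N g ⟨
  ∏ (suc N) g                               ∎
  where
  open ≈-Reasoning
  suc-∸ : ∀ N r → r ℕ.< N → N ℕ.∸ r ≡ suc (N ℕ.∸ suc r)
  suc-∸ (suc N) r (s≤s r≤N) = ℕP.+-∸-assoc 1 r≤N

∏-stable : ∀ {N M} g → (∀ i → g i ≈[ i ] 𝟏) → N ≤ M → ∏ M g ≈[ N ] ∏ N g
∏-stable {N} g p N≤M with ℕP.m≤n⇒∃[o]m+o≡n N≤M
... | K , refl = go K
  where
  open ≈[]-Reasoning
  go : ∀ K → ∏ (N ℕ.+ K) g ≈[ N ] ∏ N g
  go zero rewrite ℕP.+-identityʳ N = ≈[]-refl
  go (suc K) rewrite ℕP.+-suc N K = begin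
    ∏ (N ℕ.+ K) g ∙ g (N ℕ.+ K)   ≈⟨ ∙-cong[] (go K) (≈[]-mono (ℕP.m≤m+n N K) (p (N ℕ.+ K))) ⟩
    ∏ N g ∙ 𝟏                     ≈⟨ ≈⇒≈[] (R.*-identityʳ _) ⟩
    ∏ N g                         ∎

-- Read s · q^d, a scalar times a power of q, not a square. Below, `ϕ` is a single factor of a
-- product, whereas `φ` will be a theta series.
sq : ℤ → ℕ → PowerSeries
sq s d = const s ∙ qPow d

ϕ : ℤ → ℕ → PowerSeries
ϕ s d = 𝟏 ⊕ sq s d

Euler : ℕ → ℕ → PowerSeries
Euler m N = ∏ N (λ i → ϕ -1ℤ (m ℕ.* suc i))

oneMinus-ϕ : ∀ d → oneMinusQ^ d ≈ ϕ -1ℤ d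
oneMinus-ϕ d = R.trans (mk≈ λ n → sym (trans (⊕-coeff one (⊝ qPow d) n) (cong (λ z → one n + z) (⊝-coeff (qPow d) n))))
  (R.+-cong one≈𝟏 (solve 1 (λ x → :- x := con -1ℤ :* x) R.refl (qPow d)))
  where open Solver

partialProd-∏ : ∀ m N → partialProd m N ≈ Euler m N
partialProd-∏ m zero = one≈𝟏
partialProd-∏ m (suc N) = R.trans (mk≈ λ n → sym (∙-⋆ (partialProd m N) _ n))
  (R.*-cong (partialProd-∏ m N) (oneMinus-ϕ (m ℕ.* suc N)))

ϕ-small : ∀ s {d N} → N ℕ.< d → ϕ s d ≈[ N ] 𝟏
ϕ-small s {d} {N} N<d = ≈[]-trans (⊕-cong[] ≈[]-refl (∙-congˡ[] (const s) (qPow-small N<d)))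
  (≈⇒≈[] (solve 1 (λ x → con (+ 1) :+ x :* con (+ 0) := con (+ 1)) R.refl (const s)))
  where open Solver

Euler-small : ∀ {m} → 1 ≤ m → ∀ i → ϕ -1ℤ (m ℕ.* suc i) ≈[ i ] 𝟏
Euler-small {suc m} _ i = ϕ-small -1ℤ (ℕP.m≤m+n (suc i) (m ℕ.* suc i))

-- `f m` takes each coefficient from a different partial product. At a fixed precision it is
-- replaced here by one finite product, whose factors can be regrouped.
f-Euler : ∀ {m} → 1 ≤ m → ∀ {N M} → N ≤ M → f m ≈[ N ] Euler m M
f-Euler {m} 1≤m {N} {M} N≤M = mk≈[] λ n n≤N → begin
  partialProd m n n   ≡⟨ coeff (partialProd-∏ m n) n ⟩
  Euler m n n         ≡⟨ upTo≤ (∏-stable _ (Euler-small 1≤m) (ℕP.≤-trans n≤N N≤M)) n ℕP.≤-refl ⟨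
  Euler m M n         ∎
  where open ≡-Reasoning

f-zero : ∀ m → f m 0 ≡ + 1
f-zero m = refl

f⁻¹ : ℕ → PowerSeries
f⁻¹ m = inverse (f m)

f-inverse : ∀ m → f m ∙ f⁻¹ m ≈ 𝟏
f-inverse m = inverse-correct (f m) (f-zero m)

f-cancel[] : ∀ m {N x y} → f m ∙ x ≈[ N ] f m ∙ y → x ≈[ N ] y
f-cancel[] m {N} {x} {y} p = ≈[]-trans (≈⇒≈[] (lem x)) (≈[]-trans (∙-congˡ[] (f⁻¹ m) p) (≈[]-sym (≈⇒≈[] (lem y))))
  where
  open Solver
  lem : ∀ x → x ≈ f⁻¹ m ∙ (f m ∙ x)
  lem x = R.sym (R.trans (solve 3 (λ a b x → b :* (a :* x) := (a :* b) :* x) R.refl (f m) (f⁻¹ m) x)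
    (R.trans (R.*-congʳ (f-inverse m)) (R.*-identityˡ x)))

f-cancel : ∀ m {x y} → f m ∙ x ≈ f m ∙ y → x ≈ y
f-cancel m p = ≈[]⇒≈ λ N → f-cancel[] m (≈⇒≈[] p)

open import Algebra.Properties.Semiring.Exp R.semiring using (_^_; ^-congˡ; ^-homo-*)

-- The Jacobi triple product

sumL : ∀ {a} {A : Set a} → (A → PowerSeries) → List A → PowerSeries
sumL g [] = 𝟎
sumL g (a ∷ as) = g a ⊕ sumL g as

module _ {a} {A : Set a} where

  sumL-cong[] : ∀ {N} {g h : A → PowerSeries} as → (∀ {a} → a ∈ as → g a ≈[ N ] h a) → sumL g as ≈[ N ] sumL h as
  sumL-cong[] [] p = ≈[]-refl
  sumL-cong[] (a ∷ as) p = ⊕-cong[] (p (here refl)) (sumL-cong[] as (p ∘ there))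

  sumL-cong∈ : ∀ {g h : A → PowerSeries} as → (∀ {a} → a ∈ as → g a ≈ h a) → sumL g as ≈ sumL h as
  sumL-cong∈ [] p = R.refl
  sumL-cong∈ (a ∷ as) p = R.+-cong (p (here refl)) (sumL-cong∈ as (p ∘ there))

  sumL-∙ : ∀ x (g : A → PowerSeries) as → sumL (λ a → x ∙ g a) as ≈ x ∙ sumL g as
  sumL-∙ x g [] = R.sym (R.zeroʳ x)
  sumL-∙ x g (a ∷ as) = R.trans (R.+-congˡ (sumL-∙ x g as)) (R.sym (R.distribˡ x _ _))

  sumL-map : ∀ {b} {B : Set b} (g : B → PowerSeries) (φ : A → B) as → sumL g (map φ as) ≡ sumL (g ∘ φ) as
  sumL-map g φ [] = refl
  sumL-map g φ (a ∷ as) = cong (g (φ a) ⊕_) (sumL-map g φ as)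

-- The sum over i + j = M keeps both indices, so that no truncated subtraction enters the q-binomial
-- theorem.
antidiagonal : ℕ → (ℕ → ℕ → PowerSeries) → PowerSeries
antidiagonal zero g = g 0 0
antidiagonal (suc M) g = g (suc M) 0 ⊕ antidiagonal M (λ i j → g i (suc j))

antidiagonal-front : ∀ M g → antidiagonal (suc M) g ≈ g 0 (suc M) ⊕ antidiagonal M (λ i j → g (suc i) j)
antidiagonal-front zero g = R.+-comm _ _
antidiagonal-front (suc M) g = begin
  g (2 ℕ.+ M) 0 ⊕ antidiagonal (suc M) (λ i j → g i (suc j))
    ≈⟨ R.+-congˡ (antidiagonal-front M (λ i j → g i (suc j))) ⟩
  g (2 ℕ.+ M) 0 ⊕ (g 0 (2 ℕ.+ M) ⊕ antidiagonal M (λ i j → g (suc i) (suc j)))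
    ≈⟨ solve 3 (λ a b c → a :+ (b :+ c) := b :+ (a :+ c)) R.refl _ _ _ ⟩
  g 0 (2 ℕ.+ M) ⊕ (g (2 ℕ.+ M) 0 ⊕ antidiagonal M (λ i j → g (suc i) (suc j))) ∎
  where
  open ≈-Reasoning
  open Solver

antidiagonal-cong : ∀ M {g h} → (∀ i j → g i j ≈ h i j) → antidiagonal M g ≈ antidiagonal M h
antidiagonal-cong zero p = p 0 0
antidiagonal-cong (suc M) p = R.+-cong (p (suc M) 0) (antidiagonal-cong M (λ i j → p i (suc j)))

antidiagonal-⊕ : ∀ M g h → antidiagonal M (λ i j → g i j ⊕ h i j) ≈ antidiagonal M g ⊕ antidiagonal M h
antidiagonal-⊕ zero g h = R.refl
antidiagonal-⊕ (suc M) g h = R.trans (R.+-congˡ (antidiagonal-⊕ M _ _))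
  (solve 4 (λ a b c d → (a :+ b) :+ (c :+ d) := (a :+ c) :+ (b :+ d)) R.refl _ _ _ _)
  where open Solver

antidiagonal-∙ : ∀ M x g → antidiagonal M (λ i j → x ∙ g i j) ≈ x ∙ antidiagonal M g
antidiagonal-∙ zero x g = R.refl
antidiagonal-∙ (suc M) x g = R.trans (R.+-congˡ (antidiagonal-∙ M x _)) (R.sym (R.distribˡ x _ _))

antidiagonal-sumL : ∀ M g → antidiagonal M g ≈ sumL (λ j → g (M ℕ.∸ j) j) (upTo (suc M))
antidiagonal-sumL zero g = R.sym (R.+-identityʳ _)
antidiagonal-sumL (suc M) g = R.+-congˡ (begin
  antidiagonal M (λ i j → g i (suc j))                                    ≈⟨ antidiagonal-sumL M _ ⟩
  sumL (λ j → g (M ℕ.∸ j) (suc j)) (upTo (suc M))                 ≡⟨ sumL-map (λ j → g (suc M ℕ.∸ j) j) suc (upTo (suc M)) ⟨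
  sumL (λ j → g (suc M ℕ.∸ j) j) (map suc (upTo (suc M)))         ≡⟨ cong (sumL (λ j → g (suc M ℕ.∸ j) j)) (map-applyUpTo id suc (suc M)) ⟩
  sumL (λ j → g (suc M ℕ.∸ j) j) (applyUpTo suc (suc M))          ∎)
  where open ≈-Reasoning

-- The binomial coefficient n(n-1)/2, so `tri 1` is 0.
tri : ℕ → ℕ
tri zero = 0
tri (suc n) = tri n ℕ.+ n

tri-+ : ∀ m n → tri (m ℕ.+ n) ≡ tri m ℕ.+ tri n ℕ.+ m ℕ.* n
tri-+ m zero rewrite ℕP.+-identityʳ m | ℕP.*-zeroʳ m = sym (trans (ℕP.+-identityʳ _) (ℕP.+-identityʳ _))
tri-+ m (suc n) rewrite ℕP.+-suc m n | tri-+ m n =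
  solve 4 (λ a b m n → a :+ b :+ m :* n :+ (m :+ n) := a :+ (b :+ n) :+ m :* (con 1 :+ n)) refl (tri m) (tri n) m n
  where open ℕSolver.+-*-Solver

n≤1+tri : ∀ n → n ≤ suc (tri n)
n≤1+tri zero = z≤n
n≤1+tri (suc zero) = s≤s z≤n
n≤1+tri (suc (suc n)) = s≤s (ℕP.m≤n+m (suc n) (tri (suc n)))

n*n≡2tri+n : ∀ n → n ℕ.* n ≡ 2 ℕ.* tri n ℕ.+ n
n*n≡2tri+n zero = refl
n*n≡2tri+n (suc n) = begin
  suc n ℕ.* suc n                 ≡⟨ solve 1 (λ n → (con 1 :+ n) :* (con 1 :+ n) := n :* n :+ (con 1 :+ con 2 :* n)) refl n ⟩
  n ℕ.* n ℕ.+ (1 ℕ.+ 2 ℕ.* n)     ≡⟨ cong (ℕ._+ (1 ℕ.+ 2 ℕ.* n)) (n*n≡2tri+n n) ⟩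
  2 ℕ.* tri n ℕ.+ n ℕ.+ (1 ℕ.+ 2 ℕ.* n)
    ≡⟨ solve 2 (λ t n → con 2 :* t :+ n :+ (con 1 :+ con 2 :* n) := con 2 :* (t :+ n) :+ (con 1 :+ n)) refl (tri n) n ⟩
  2 ℕ.* (tri n ℕ.+ n) ℕ.+ suc n   ∎
  where
  open ≡-Reasoning
  open ℕSolver.+-*-Solver

const-∙-const : ∀ a b → const a ∙ const b ≈ const (a * b)
const-∙-const a b = R.sym (_-Raw-AlmostCommutative⟶_.*-homo const-morphism a b)

const-cong : ∀ {a b} → a ≡ b → const a ≈ const b
const-cong refl = R.refl

sq-∙ : ∀ s t d e → sq s d ∙ sq t e ≈ sq (s * t) (d ℕ.+ e)
sq-∙ s t d e = begin
  const s ∙ qPow d ∙ (const t ∙ qPow e)    ≈⟨ solve 4 (λ a b c d → a :* b :* (c :* d) := (a :* c) :* (b :* d)) R.refl _ _ _ _ ⟩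
  (const s ∙ const t) ∙ (qPow d ∙ qPow e)  ≈⟨ R.*-cong (const-∙-const s t) (qPow-+ d e) ⟩
  sq (s * t) (d ℕ.+ e)                     ∎
  where
  open ≈-Reasoning
  open Solver

sq-cong : ∀ {s t d e} → s ≡ t → d ≡ e → sq s d ≈ sq t e
sq-cong refl refl = R.refl

qPow-sq : ∀ d → qPow d ≈ sq (+ 1) d
qPow-sq d = R.sym (R.*-identityˡ (qPow d))

sq-^ : ∀ s d j → sq s d ^ j ≈ sq (s ℤ.^ j) (d ℕ.* j)
sq-^ s d zero = R.trans (R.sym qPow-0) (R.trans (qPow-sq 0) (sq-cong {+ 1} {+ 1} refl (sym (ℕP.*-zeroʳ d))))
sq-^ s d (suc j) = R.trans (R.*-congˡ (sq-^ s d j)) (R.trans (sq-∙ s (s ℤ.^ j) d (d ℕ.* j)) (sq-cong {s * s ℤ.^ j} refl (sym (ℕP.*-suc d j))))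

-- Gaussian binomials and the finite q-binomial theorem

module Gaussian (k : ℕ) where

  -- The Gaussian binomial of i + j over j in base q^k, defined by the q-Pascal rule.
  G : ℕ → ℕ → PowerSeries
  G i zero = 𝟏
  G zero (suc j) = 𝟏
  G (suc i) (suc j) = qPow (k ℕ.* suc j) ∙ G i (suc j) ⊕ G (suc i) j

  G0 : ∀ j → G 0 j ≈ 𝟏
  G0 zero = R.refl
  G0 (suc j) = R.refl

  term : PowerSeries → PowerSeries → ℕ → ℕ → PowerSeries
  term X Y i j = G i j ∙ (qPow (k ℕ.* tri j) ∙ (X ^ j ∙ Y ^ i))

  ^-shift : ∀ X j → (X ∙ qPow k) ^ j ≈ X ^ j ∙ qPow (k ℕ.* j)
  ^-shift X zero = R.sym (R.trans (R.*-identityˡ _) (R.trans (qPow-cong (ℕP.*-zeroʳ k)) qPow-0))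
  ^-shift X (suc j) = begin
    X ∙ qPow k ∙ (X ∙ qPow k) ^ j                  ≈⟨ R.*-congˡ (^-shift X j) ⟩
    X ∙ qPow k ∙ (X ^ j ∙ qPow (k ℕ.* j))          ≈⟨ solve 4 (λ a b c d → a :* b :* (c :* d) := a :* c :* (b :* d)) R.refl _ _ _ _ ⟩
    X ∙ X ^ j ∙ (qPow k ∙ qPow (k ℕ.* j))          ≈⟨ R.*-congˡ (R.trans (qPow-+ k _) (qPow-cong (sym (ℕP.*-suc k j)))) ⟩
    X ∙ X ^ j ∙ qPow (k ℕ.* suc j)                 ∎
    where
    open ≈-Reasoning
    open Solver

  qPow-tri-suc : ∀ j → qPow (k ℕ.* tri j) ∙ qPow (k ℕ.* j) ≈ qPow (k ℕ.* tri (suc j))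
  qPow-tri-suc j = R.trans (qPow-+ (k ℕ.* tri j) (k ℕ.* j)) (qPow-cong (sym (ℕP.*-distribˡ-+ k (tri j) j)))

  -- Removing the factor with r = 0 leaves the same product with X q^k for X. The form is
  -- homogeneous in X and Y so that Y can later be a power of q, which avoids negative exponents.
  q-binomial : ∀ M X Y → ∏ M (λ r → Y ⊕ X ∙ qPow (k ℕ.* r)) ≈ antidiagonal M (term X Y)
  q-binomial zero X Y = R.sym (R.trans (R.*-identityˡ _)
    (R.trans (R.*-cong (R.trans (qPow-cong (ℕP.*-zeroʳ k)) qPow-0) (R.*-identityˡ _)) (R.*-identityˡ _)))
  q-binomial (suc M) X Y = begin
    ∏ (suc M) (λ r → Y ⊕ X ∙ qPow (k ℕ.* r))
      ≈⟨ ∏-front M _ ⟩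
    (Y ⊕ X ∙ qPow (k ℕ.* 0)) ∙ ∏ M (λ r → Y ⊕ X ∙ qPow (k ℕ.* suc r))
      ≈⟨ R.*-cong (R.+-congˡ (R.trans (R.*-congˡ (R.trans (qPow-cong (ℕP.*-zeroʳ k)) qPow-0)) (R.*-identityʳ X)))
           (∏-cong M λ r → R.+-congˡ (R.trans (R.*-congˡ (R.sym (R.trans (qPow-+ k _) (qPow-cong (sym (ℕP.*-suc k r))))))
             (R.sym (R.*-assoc _ _ _)))) ⟩
    (Y ⊕ X) ∙ ∏ M (λ r → Y ⊕ X ∙ qPow k ∙ qPow (k ℕ.* r))
      ≈⟨ R.*-congˡ (q-binomial M (X ∙ qPow k) Y) ⟩
    (Y ⊕ X) ∙ antidiagonal M t
      ≈⟨ R.distribʳ _ Y X ⟩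
    Y ∙ antidiagonal M t ⊕ X ∙ antidiagonal M t
      ≈⟨ R.+-cong (antidiagonal-∙ M Y t) (antidiagonal-∙ M X t) ⟨
    antidiagonal M (λ i j → Y ∙ t i j) ⊕ antidiagonal M (λ i j → X ∙ t i j)
      ≈⟨ R.+-cong (R.trans (antidiagonal-front M L) (R.+-identityˡ _)) (R.+-identityˡ _) ⟨
    antidiagonal (suc M) L ⊕ antidiagonal (suc M) L′
      ≈⟨ antidiagonal-⊕ (suc M) L L′ ⟨
    antidiagonal (suc M) (λ i j → L i j ⊕ L′ i j)
      ≈⟨ antidiagonal-cong (suc M) L+L′ ⟩
    antidiagonal (suc M) (term X Y) ∎
    where
    open ≈-Reasoning
    open Solver
    t = term (X ∙ qPow k) Y
    -- `L` and `L′` collect the terms that take `Y` and `X` from the removed factor. The corner (0 ,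
    -- 0) lies on no antidiagonal `suc M`; its value is chosen so that `L+L′` holds at every index.
    L L′ : ℕ → ℕ → PowerSeries
    L zero zero = term X Y 0 0
    L zero (suc j) = 𝟎
    L (suc i) j = Y ∙ t i j
    L′ i zero = 𝟎
    L′ i (suc j) = X ∙ t i j

    R-part : ∀ i j → X ∙ t i j ≈ G i j ∙ (qPow (k ℕ.* tri (suc j)) ∙ (X ^ suc j ∙ Y ^ i))
    R-part i j = begin
      X ∙ (G i j ∙ (qPow (k ℕ.* tri j) ∙ ((X ∙ qPow k) ^ j ∙ Y ^ i)))
        ≈⟨ R.*-congˡ (R.*-congˡ (R.*-congˡ (R.*-congʳ (^-shift X j)))) ⟩
      X ∙ (G i j ∙ (qPow (k ℕ.* tri j) ∙ (X ^ j ∙ qPow (k ℕ.* j) ∙ Y ^ i)))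
        ≈⟨ solve 6 (λ x g a p b y → x :* (g :* (a :* (p :* b :* y))) := g :* ((a :* b) :* (x :* p :* y))) R.refl
             X (G i j) (qPow (k ℕ.* tri j)) (X ^ j) (qPow (k ℕ.* j)) (Y ^ i) ⟩
      G i j ∙ (qPow (k ℕ.* tri j) ∙ qPow (k ℕ.* j) ∙ (X ^ suc j ∙ Y ^ i))
        ≈⟨ R.*-congˡ (R.*-congʳ (qPow-tri-suc j)) ⟩
      G i j ∙ (qPow (k ℕ.* tri (suc j)) ∙ (X ^ suc j ∙ Y ^ i)) ∎

    L+L′ : ∀ i j → L i j ⊕ L′ i j ≈ term X Y i j
    L+L′ zero zero = R.+-identityʳ _
    L+L′ zero (suc j) = R.trans (R.+-identityˡ _) (R.trans (R-part 0 j) (R.*-congʳ (G0 j)))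
    L+L′ (suc i) zero = R.trans (R.+-identityʳ _)
      (solve 4 (λ y a x p → y :* (con (+ 1) :* (a :* (con (+ 1) :* p))) := con (+ 1) :* (a :* (con (+ 1) :* (y :* p)))) R.refl
        Y (qPow (k ℕ.* 0)) X (Y ^ i))
    L+L′ (suc i) (suc j) = begin
      Y ∙ (G i (suc j) ∙ (qPow (k ℕ.* tri (suc j)) ∙ ((X ∙ qPow k) ^ suc j ∙ Y ^ i))) ⊕ X ∙ t (suc i) j
        ≈⟨ R.+-cong (R.*-congˡ (R.*-congˡ (R.*-congˡ (R.*-congʳ (^-shift X (suc j)))))) (R-part (suc i) j) ⟩
      Y ∙ (G i (suc j) ∙ (qPow (k ℕ.* tri (suc j)) ∙ (X ^ suc j ∙ qPow (k ℕ.* suc j) ∙ Y ^ i)))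
        ⊕ G (suc i) j ∙ (qPow (k ℕ.* tri (suc j)) ∙ (X ^ suc j ∙ Y ^ suc i))
        -- The bracket `b :* g :+ g′` is the q-Pascal rule.
        ≈⟨ solve 7 (λ y g a x b p g′ → y :* (g :* (a :* (x :* b :* p))) :+ g′ :* (a :* (x :* (y :* p)))
                                  := (b :* g :+ g′) :* (a :* (x :* (y :* p)))) R.refl
             Y (G i (suc j)) (qPow (k ℕ.* tri (suc j))) (X ^ suc j) (qPow (k ℕ.* suc j)) (Y ^ i) (G (suc i) j) ⟩
      term X Y (suc i) (suc j) ∎

  -- The quotient formula for Gaussian binomials with denominators cleared. With x = q^(k(i+1)) and
  -- y = q^(k(j+1)), the induction rests on y(1 - x) + (1 - y) = 1 - xy.
  G-Euler : ∀ i j → Euler k i ∙ Euler k j ∙ G i j ≈ Euler k (i ℕ.+ j)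
  G-Euler i zero rewrite ℕP.+-identityʳ i = R.trans (R.*-identityʳ _) (R.*-identityʳ _)
  G-Euler zero (suc j) = R.trans (R.*-identityʳ _) (R.*-identityˡ _)
  G-Euler (suc i) (suc j) = begin
    (Euler k i ∙ ϕ -1ℤ (k ℕ.* suc i)) ∙ (Euler k j ∙ ϕ -1ℤ (k ℕ.* suc j)) ∙ (qPow (k ℕ.* suc j) ∙ G i (suc j) ⊕ G (suc i) j)
      ≈⟨ solve 6 (λ a b x y g h →
           let u = con (+ 1) :+ con -1ℤ :* x
               v = con (+ 1) :+ con -1ℤ :* y in
           (a :* u) :* (b :* v) :* (y :* g :+ h) := y :* u :* (a :* (b :* v) :* g) :+ v :* ((a :* u) :* b :* h)) R.refl
           (Euler k i) (Euler k j) (qPow (k ℕ.* suc i)) (qPow (k ℕ.* suc j)) (G i (suc j)) (G (suc i) j) ⟩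
    qPow (k ℕ.* suc j) ∙ ϕ -1ℤ (k ℕ.* suc i) ∙ (Euler k i ∙ Euler k (suc j) ∙ G i (suc j))
      ⊕ ϕ -1ℤ (k ℕ.* suc j) ∙ (Euler k (suc i) ∙ Euler k j ∙ G (suc i) j)
      ≈⟨ R.+-cong (R.*-congˡ (G-Euler i (suc j)))
           (R.*-congˡ (R.trans (G-Euler (suc i) j) (R.reflexive (cong (Euler k) (sym (ℕP.+-suc i j)))))) ⟩
    qPow (k ℕ.* suc j) ∙ ϕ -1ℤ (k ℕ.* suc i) ∙ Euler k (i ℕ.+ suc j) ⊕ ϕ -1ℤ (k ℕ.* suc j) ∙ Euler k (i ℕ.+ suc j)
      ≈⟨ solve 3 (λ x y e → y :* (con (+ 1) :+ con -1ℤ :* x) :* e :+ (con (+ 1) :+ con -1ℤ :* y) :* e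
                           := e :* (con (+ 1) :+ con -1ℤ :* (x :* y))) R.refl
           (qPow (k ℕ.* suc i)) (qPow (k ℕ.* suc j)) (Euler k (i ℕ.+ suc j)) ⟩
    Euler k (i ℕ.+ suc j) ∙ (𝟏 ⊕ const -1ℤ ∙ (qPow (k ℕ.* suc i) ∙ qPow (k ℕ.* suc j)))
      ≈⟨ R.*-congˡ (R.+-congˡ (R.*-congˡ (R.trans (qPow-+ _ _) (qPow-cong (sym (ℕP.*-distribˡ-+ k (suc i) (suc j))))))) ⟩
    Euler k (i ℕ.+ suc j) ∙ ϕ -1ℤ (k ℕ.* suc (i ℕ.+ suc j)) ∎
    where
    open ≈-Reasoning
    open Solver

  -- As both indices grow, the Gaussian binomial tends to 1/f_k, with precision the smaller index.
  f-G : 1 ≤ k → ∀ {n i j} → n ≤ i → n ≤ j → f k ∙ G i j ≈[ n ] 𝟏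
  f-G 1≤k {n} {i} {j} n≤i n≤j = f-cancel[] k (begin
    f k ∙ (f k ∙ G i j)            ≈⟨ ≈⇒≈[] (R.sym (R.*-assoc (f k) (f k) (G i j))) ⟩
    f k ∙ f k ∙ G i j              ≈⟨ ∙-congʳ[] (G i j) (∙-cong[] (f-Euler 1≤k n≤i) (f-Euler 1≤k n≤j)) ⟩
    Euler k i ∙ Euler k j ∙ G i j  ≈⟨ ≈⇒≈[] (G-Euler i j) ⟩
    Euler k (i ℕ.+ j)              ≈⟨ f-Euler 1≤k (ℕP.≤-trans n≤i (ℕP.m≤m+n i j)) ⟨
    f k                            ≈⟨ ≈⇒≈[] (R.*-identityʳ (f k)) ⟨
    f k ∙ 𝟏                        ∎)
    where open ≈[]-Reasoning

rangeℤ : ℕ → List ℤ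
rangeℤ N = map (λ j → + j - + N) (upTo (suc (N ℕ.+ N)))

rangeℤ-unique : ∀ N → Unique (rangeℤ N)
rangeℤ-unique N = Unique.map⁺ (λ {x} {y} eq → ℤP.+-injective (+-cancelʳ-≡ (- + N) (+ x) (+ y) eq)) (Unique.upTo⁺ _)

∈-rangeℤ : ∀ {N} l → ℤ.∣ l ∣ ≤ N → l ∈ rangeℤ N
∈-rangeℤ {N} (+ p) p≤N = subst (_∈ rangeℤ N) eq (∈-map⁺ _ (∈-upTo⁺ (s≤s (ℕP.+-monoˡ-≤ N p≤N))))
  where
  eq : + (p ℕ.+ N) - + N ≡ + p
  eq = trans (cong (_- + N) (ℤP.pos-+ p N)) (trans (ℤP.+-assoc (+ p) (+ N) (- + N))
    (trans (cong (λ z → + p + z) (ℤP.+-inverseʳ (+ N))) (ℤP.+-identityʳ (+ p))))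
∈-rangeℤ {N} -[1+ p ] p<N = subst (_∈ rangeℤ N) eq (∈-map⁺ _ (∈-upTo⁺ (s≤s (ℕP.≤-trans (ℕP.m∸n≤m N (suc p)) (ℕP.m≤m+n N N)))))
  where
  eq : + (N ℕ.∸ suc p) - + N ≡ -[1+ p ]
  eq = trans (cong (_- + N) (trans (sym (ℤP.⊖-≥ p<N)) (sym (ℤP.m-n≡m⊖n N (suc p)))))
    (trans (cong (_- + N) (ℤP.+-comm (+ N) -[1+ p ])) (trans (ℤP.+-assoc -[1+ p ] (+ N) (- + N))
      (trans (cong (λ z → -[1+ p ] + z) (ℤP.+-inverseʳ (+ N))) (ℤP.+-identityʳ -[1+ p ]))))

-- The three parameters give the theta series Σ_l s^|l| q^(k l(l-1)/2 + a l), where a + b = k.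
exponent : ℕ → ℕ → ℕ → ℤ → ℕ
exponent k a b (+ p) = k ℕ.* tri p ℕ.+ a ℕ.* p
exponent k a b -[1+ p ] = k ℕ.* tri (suc p) ℕ.+ b ℕ.* suc p

-- Only finitely many l have a bounded exponent. The extra 1 cannot be dropped: for b = 0, as in ψ,
-- the index l = -1 has exponent 0.
∣l∣≤1+exponent : ∀ {k} a b → 1 ≤ k → ∀ l → ℤ.∣ l ∣ ≤ suc (exponent k a b l)
∣l∣≤1+exponent {k} a b 1≤k l = go l
  where
  bound : ∀ p c → p ≤ suc (k ℕ.* tri p ℕ.+ c)
  bound p c = ℕP.≤-trans (n≤1+tri p) (s≤s (ℕP.≤-trans
    (subst (_≤ k ℕ.* tri p) (ℕP.*-identityˡ (tri p)) (ℕP.*-monoˡ-≤ (tri p) 1≤k)) (ℕP.m≤m+n _ c)))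
  go : ∀ l → ℤ.∣ l ∣ ≤ suc (exponent k a b l)
  go (+ p) = bound p _
  go -[1+ p ] = bound (suc p) _

-- The cases l = p ≥ 0 and l = - (1 + p) for l = j - N.
data Around (N : ℕ) : ℕ → Set where
  above : ∀ p i → N ≡ i ℕ.+ p → Around N (N ℕ.+ p)
  below : ∀ p j → N ≡ j ℕ.+ suc p → Around N j

around : ∀ N j → j ≤ N ℕ.+ N → Around N j
around N j j≤2N with j ℕ.<? N
... | yes j<N with ℕP.m≤n⇒∃[o]m+o≡n j<N
...   | p , refl = below p j (sym (ℕP.+-suc j p))
around N j j≤2N | no j≮N with ℕP.m≤n⇒∃[o]m+o≡n (ℕP.≮⇒≥ j≮N)
... | p , refl = above p (N ℕ.∸ p) (sym (ℕP.m∸n+n≡m (ℕP.+-cancelˡ-≤ N p N j≤2N)))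

^-square : ∀ {s} → s * s ≡ + 1 → ∀ n → s ℤ.^ n * s ℤ.^ n ≡ + 1
^-square s*s≡1 zero = refl
^-square {s} s*s≡1 (suc n) = trans (solve 2 (λ s t → (s :* t) :* (s :* t) := (s :* s) :* (t :* t)) refl s (s ℤ.^ n))
  (cong₂ _*_ s*s≡1 (^-square {s} s*s≡1 n))
  where
  open ℤSolver.+-*-Solver

-- The q-binomial theorem with 2N factors, X = s q^a and Y = q^(kN). Centring at j = N makes the sum
-- run over l = j - N. The common factor `prefactor` is a sign times a power of q, hence
-- cancellable, and keeps all exponents natural.
module JacobiTripleProduct (k a b : ℕ) (a+b≡k : a ℕ.+ b ≡ k) (1≤k : 1 ≤ k) (s : ℤ) (s*s≡1 : s * s ≡ + 1) where
  open Gaussian k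

  e : ℤ → ℕ
  e = exponent k a b

  monomial : ℤ → PowerSeries
  monomial l = sq (s ℤ.^ ℤ.∣ l ∣) (e l)

  s^2n≡1 : ∀ n → s ℤ.^ n * s ℤ.^ n ≡ + 1
  s^2n≡1 = ^-square {s} s*s≡1

  module _ (N : ℕ) where
    private
      X = sq s a
      Y = qPow (k ℕ.* N)
      Πa = ∏ N (λ r → ϕ s (a ℕ.+ k ℕ.* r))
      Πb = ∏ N (λ r → ϕ s (b ℕ.+ k ℕ.* r))
      A′ = a ℕ.* N ℕ.+ k ℕ.* tri N
      B′ = k ℕ.* N ℕ.* N

    prefactor : PowerSeries
    prefactor = sq (s ℤ.^ N) (A′ ℕ.+ B′)

    prefactor-cancel : ∀ {x y} → prefactor ∙ x ≈ prefactor ∙ y → x ≈ y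
    prefactor-cancel {x} {y} p = qPow-cancel (A′ ℕ.+ B′) (R.trans (lem x) (R.trans (R.*-congˡ p) (R.sym (lem y))))
      where
      open Solver
      lem : ∀ z → qPow (A′ ℕ.+ B′) ∙ z ≈ const (s ℤ.^ N) ∙ (prefactor ∙ z)
      lem z = R.sym (R.trans (solve 3 (λ c q z → c :* ((c :* q) :* z) := (c :* c) :* (q :* z)) R.refl (const (s ℤ.^ N)) (qPow (A′ ℕ.+ B′)) z)
        (R.trans (R.*-congʳ (R.trans (const-∙-const _ _) (const-cong (s^2n≡1 N)))) (R.*-identityˡ _)))

    ∏X : ∀ n → ∏ n (λ r → X ∙ qPow (k ℕ.* r)) ≈ sq (s ℤ.^ n) (a ℕ.* n ℕ.+ k ℕ.* tri n)
    ∏X zero = R.trans (R.sym qPow-0) (R.trans (qPow-sq 0)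
      (sq-cong {+ 1} refl (sym (cong₂ ℕ._+_ (ℕP.*-zeroʳ a) (ℕP.*-zeroʳ k)))))
    ∏X (suc n) = begin
      ∏ n (λ r → X ∙ qPow (k ℕ.* r)) ∙ (X ∙ qPow (k ℕ.* n))
        ≈⟨ R.*-cong (∏X n) (R.trans (R.*-congˡ (qPow-sq _)) (sq-∙ s (+ 1) a (k ℕ.* n))) ⟩
      sq (s ℤ.^ n) (a ℕ.* n ℕ.+ k ℕ.* tri n) ∙ sq (s * + 1) (a ℕ.+ k ℕ.* n)
        ≈⟨ sq-∙ _ _ _ _ ⟩
      sq (s ℤ.^ n * (s * + 1)) (a ℕ.* n ℕ.+ k ℕ.* tri n ℕ.+ (a ℕ.+ k ℕ.* n))
        ≈⟨ sq-cong (trans (cong (s ℤ.^ n *_) (ℤP.*-identityʳ s)) (ℤP.*-comm (s ℤ.^ n) s))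
             (solve 4 (λ a n k t → a :* n :+ k :* t :+ (a :+ k :* n) := a :* (con 1 :+ n) :+ k :* (t :+ n)) refl a n k (tri n)) ⟩
      sq (s ℤ.^ suc n) (a ℕ.* suc n ℕ.+ k ℕ.* tri (suc n)) ∎
      where
      open ≈-Reasoning
      open ℕSolver.+-*-Solver

    ∏Y : ∀ d n → ∏ n (λ _ → qPow d) ≈ qPow (d ℕ.* n)
    ∏Y d zero = R.trans (R.sym qPow-0) (qPow-cong (sym (ℕP.*-zeroʳ d)))
    ∏Y d (suc n) = R.trans (R.*-congʳ (∏Y d n)) (R.trans (qPow-+ _ _)
      (qPow-cong (trans (ℕP.+-comm (d ℕ.* n) d) (sym (ℕP.*-suc d n)))))

    -- Because a + b = k and s² = 1, Y is X q^(km) times s q^(b+kr) whenever m + r + 1 = N; the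
    -- order of the lower half is therefore reversed.
    lower-factor : ∀ r → r ℕ.< N → Y ⊕ X ∙ qPow (k ℕ.* (N ℕ.∸ suc r)) ≈ (X ∙ qPow (k ℕ.* (N ℕ.∸ suc r))) ∙ ϕ s (b ℕ.+ k ℕ.* r)
    lower-factor r r<N = begin
      Y ⊕ x                                        ≈⟨ R.+-congʳ (R.sym xy) ⟩
      x ∙ sq s (b ℕ.+ k ℕ.* r) ⊕ x                 ≈⟨ solve 2 (λ x y → x :* y :+ x := x :* (con (+ 1) :+ y)) R.refl x (sq s (b ℕ.+ k ℕ.* r)) ⟩
      x ∙ ϕ s (b ℕ.+ k ℕ.* r)                      ∎
      where
      open ≈-Reasoning
      open Solver
      m = N ℕ.∸ suc r
      x = X ∙ qPow (k ℕ.* m)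
      exps : a ℕ.+ k ℕ.* m ℕ.+ (b ℕ.+ k ℕ.* r) ≡ k ℕ.* N
      exps = trans (ℕS.solve 5 (λ a b k m r → a ℕS.:+ k ℕS.:* m ℕS.:+ (b ℕS.:+ k ℕS.:* r) ℕS.:= (a ℕS.:+ b) ℕS.:+ k ℕS.:* (m ℕS.:+ r)) refl a b k m r)
        (trans (cong (ℕ._+ k ℕ.* (m ℕ.+ r)) a+b≡k) (trans (sym (ℕP.*-suc k (m ℕ.+ r)))
          (cong (k ℕ.*_) (trans (sym (ℕP.+-suc m r)) (ℕP.m∸n+n≡m r<N)))))
        where module ℕS = ℕSolver.+-*-Solver
      xy : x ∙ sq s (b ℕ.+ k ℕ.* r) ≈ Y
      xy = R.trans (R.*-congʳ (R.trans (R.*-congˡ (qPow-sq _)) (sq-∙ s (+ 1) a _)))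
        (R.trans (sq-∙ _ _ _ _) (R.trans (sq-cong (trans (cong (_* s) (ℤP.*-identityʳ s)) s*s≡1) exps) (R.sym (qPow-sq _))))

    upper-factor : ∀ r → Y ⊕ X ∙ qPow (k ℕ.* (N ℕ.+ r)) ≈ Y ∙ ϕ s (a ℕ.+ k ℕ.* r)
    upper-factor r = begin
      Y ⊕ const s ∙ qPow a ∙ qPow (k ℕ.* (N ℕ.+ r))
        ≈⟨ R.+-congˡ (R.*-congˡ (R.trans (qPow-cong (ℕP.*-distribˡ-+ k N r)) (R.sym (qPow-+ _ _)))) ⟩
      Y ⊕ const s ∙ qPow a ∙ (Y ∙ qPow (k ℕ.* r))
        ≈⟨ solve 4 (λ y s a b → y :+ s :* a :* (y :* b) := y :* (con (+ 1) :+ s :* (a :* b))) R.refl Y (const s) (qPow a) _ ⟩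
      Y ∙ (𝟏 ⊕ const s ∙ (qPow a ∙ qPow (k ℕ.* r)))
        ≈⟨ R.*-congˡ (R.+-congˡ (R.*-congˡ (qPow-+ _ _))) ⟩
      Y ∙ ϕ s (a ℕ.+ k ℕ.* r) ∎
      where
      open ≈-Reasoning
      open Solver

    product-side : ∏ (N ℕ.+ N) (λ r → Y ⊕ X ∙ qPow (k ℕ.* r)) ≈ prefactor ∙ (Πa ∙ Πb)
    product-side = begin
      ∏ (N ℕ.+ N) g
        ≈⟨ ∏-+ N N g ⟩
      ∏ N g ∙ ∏ N (λ r → g (N ℕ.+ r))
        ≈⟨ R.*-cong (R.trans (R.sym (∏-reverse N g)) (R.trans (∏-cong< N lower-factor)
             (R.trans (∏-∙ N _ _) (R.*-congʳ (∏-reverse N (λ r → X ∙ qPow (k ℕ.* r)))))))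
             (R.trans (∏-cong N upper-factor) (∏-∙ N _ _)) ⟩
      (∏ N (λ r → X ∙ qPow (k ℕ.* r)) ∙ Πb) ∙ (∏ N (λ _ → Y) ∙ Πa)
        ≈⟨ R.*-cong (R.*-congʳ (∏X N)) (R.*-congʳ (∏Y (k ℕ.* N) N)) ⟩
      (const (s ℤ.^ N) ∙ qPow A′ ∙ Πb) ∙ (qPow B′ ∙ Πa)
        ≈⟨ solve 5 (λ c x b y a → (c :* x :* b) :* (y :* a) := (c :* (x :* y)) :* (a :* b)) R.refl _ _ _ _ _ ⟩
      const (s ℤ.^ N) ∙ (qPow A′ ∙ qPow B′) ∙ (Πa ∙ Πb)
        ≈⟨ R.*-congʳ (R.*-congˡ (qPow-+ A′ B′)) ⟩
      prefactor ∙ (Πa ∙ Πb) ∎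
      where
      open ≈-Reasoning
      open Solver
      g = λ r → Y ⊕ X ∙ qPow (k ℕ.* r)

    monomial-split : ∀ i j l → s ℤ.^ j ≡ s ℤ.^ N * s ℤ.^ ℤ.∣ l ∣ →
      k ℕ.* tri j ℕ.+ (a ℕ.* j ℕ.+ k ℕ.* N ℕ.* i) ≡ A′ ℕ.+ B′ ℕ.+ e l →
      term X Y i j ≈ prefactor ∙ (monomial l ∙ G i j)
    monomial-split i j l sgn exps = begin
      G i j ∙ (qPow (k ℕ.* tri j) ∙ (X ^ j ∙ Y ^ i))
        ≈⟨ R.*-congˡ (R.*-cong (qPow-sq _) (R.*-cong (sq-^ s a j)
             (R.trans (^-congˡ i (qPow-sq _)) (sq-^ (+ 1) (k ℕ.* N) i)))) ⟩
      G i j ∙ (sq (+ 1) (k ℕ.* tri j) ∙ (sq (s ℤ.^ j) (a ℕ.* j) ∙ sq ((+ 1) ℤ.^ i) (k ℕ.* N ℕ.* i)))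
        ≈⟨ R.*-congˡ (R.trans (R.*-congˡ (sq-∙ _ _ _ _)) (sq-∙ _ _ _ _)) ⟩
      G i j ∙ sq (+ 1 * (s ℤ.^ j * (+ 1) ℤ.^ i)) (k ℕ.* tri j ℕ.+ (a ℕ.* j ℕ.+ k ℕ.* N ℕ.* i))
        ≈⟨ R.*-congˡ (sq-cong (trans (ℤP.*-identityˡ _) (trans (cong (s ℤ.^ j *_) (ℤP.^-zeroˡ i)) (trans (ℤP.*-identityʳ _) sgn))) exps) ⟩
      G i j ∙ sq (s ℤ.^ N * s ℤ.^ ℤ.∣ l ∣) (A′ ℕ.+ B′ ℕ.+ e l)
        ≈⟨ R.*-congˡ (sq-∙ _ _ _ _) ⟨
      G i j ∙ (prefactor ∙ monomial l)
        ≈⟨ solve 3 (λ g p m → g :* (p :* m) := p :* (m :* g)) R.refl _ _ _ ⟩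
      prefactor ∙ (monomial l ∙ G i j) ∎
      where
      open ≈-Reasoning
      open Solver

  open ℕSolver.+-*-Solver

  -- Compares the j-th term with the theta summand at l = j - N. The number m bounds both indices of
  -- its Gaussian binomial from below; the last inequality says that where m is small, the exponent
  -- `e l` is large.
  position : ∀ N j → Around N j → let i = N ℕ.+ N ℕ.∸ j ; l = + j - + N in
    (s ℤ.^ j ≡ s ℤ.^ N * s ℤ.^ ℤ.∣ l ∣) ×
    (k ℕ.* tri j ℕ.+ (a ℕ.* j ℕ.+ k ℕ.* N ℕ.* i) ≡ (a ℕ.* N ℕ.+ k ℕ.* tri N) ℕ.+ k ℕ.* N ℕ.* N ℕ.+ e l) ×
    ∃ λ m → m ≤ i × m ≤ j × N ≤ suc (e l ℕ.+ m)
  position N _ (above p i N≡i+p) = sgn , exps , i , ℕP.≤-reflexive (sym i-eq) , ℕP.≤-trans i≤N (ℕP.m≤m+n N p) , bound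
    where
    i-eq : N ℕ.+ N ℕ.∸ (N ℕ.+ p) ≡ i
    i-eq = trans (ℕP.[m+n]∸[m+o]≡n∸o N N p) (trans (cong (ℕ._∸ p) N≡i+p) (ℕP.m+n∸n≡m i p))
    l-eq : + (N ℕ.+ p) - + N ≡ + p
    l-eq = trans (ℤP.m-n≡m⊖n (N ℕ.+ p) N) (trans (ℤP.⊖-≥ (ℕP.m≤m+n N p)) (cong +_ (ℕP.m+n∸m≡n N p)))
    i≤N = ℕP.≤-trans (ℕP.m≤m+n i p) (ℕP.≤-reflexive (sym N≡i+p))
    sgn : s ℤ.^ (N ℕ.+ p) ≡ s ℤ.^ N * s ℤ.^ ℤ.∣ + (N ℕ.+ p) - + N ∣
    sgn rewrite l-eq = ℤP.^-distribˡ-+-* s N p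
    exps : k ℕ.* tri (N ℕ.+ p) ℕ.+ (a ℕ.* (N ℕ.+ p) ℕ.+ k ℕ.* N ℕ.* (N ℕ.+ N ℕ.∸ (N ℕ.+ p)))
         ≡ (a ℕ.* N ℕ.+ k ℕ.* tri N) ℕ.+ k ℕ.* N ℕ.* N ℕ.+ e (+ (N ℕ.+ p) - + N)
    exps rewrite l-eq | i-eq | tri-+ N p = trans
      (solve 7 (λ k a N p i t u → k :* (t :+ u :+ N :* p) :+ (a :* (N :+ p) :+ k :* N :* i)
                                 := (a :* N :+ k :* t) :+ k :* N :* (i :+ p) :+ (k :* u :+ a :* p)) refl k a N p i (tri N) (tri p))
      (cong (λ m → (a ℕ.* N ℕ.+ k ℕ.* tri N) ℕ.+ k ℕ.* N ℕ.* m ℕ.+ (k ℕ.* tri p ℕ.+ a ℕ.* p)) (sym N≡i+p))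
    bound : N ≤ suc (e (+ (N ℕ.+ p) - + N) ℕ.+ i)
    bound rewrite l-eq = ℕP.≤-trans (ℕP.≤-reflexive (trans N≡i+p (ℕP.+-comm i p))) (ℕP.+-monoˡ-≤ i (∣l∣≤1+exponent a b 1≤k (+ p)))
  position N j (below p j N≡j+p) = sgn , exps , j , ℕP.≤-trans j≤N (ℕP.≤-trans (ℕP.m≤m+n N (suc p)) (ℕP.≤-reflexive (sym i-eq))) , ℕP.≤-refl , bound
    where
    j≤N : j ≤ N
    j≤N = ℕP.≤-trans (ℕP.m≤m+n j (suc p)) (ℕP.≤-reflexive (sym N≡j+p))
    i-eq : N ℕ.+ N ℕ.∸ j ≡ N ℕ.+ suc p
    i-eq = trans (ℕP.+-∸-assoc N j≤N) (cong (N ℕ.+_) (trans (cong (ℕ._∸ j) N≡j+p) (ℕP.m+n∸m≡n j (suc p))))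
    l-eq : + j - + N ≡ -[1+ p ]
    l-eq = trans (ℤP.m-n≡m⊖n j N) (trans (ℤP.⊖-< (subst (j ℕ.<_) (sym N≡j+p) (ℕP.m<m+n j (s≤s z≤n))))
      (cong (λ m → - + m) (trans (cong (ℕ._∸ j) N≡j+p) (ℕP.m+n∸m≡n j (suc p)))))
    sgn : s ℤ.^ j ≡ s ℤ.^ N * s ℤ.^ ℤ.∣ + j - + N ∣
    sgn rewrite l-eq = begin
      s ℤ.^ j                                    ≡⟨ ℤP.*-identityʳ _ ⟨
      s ℤ.^ j * + 1                              ≡⟨ cong (s ℤ.^ j *_) (s^2n≡1 (suc p)) ⟨
      s ℤ.^ j * (s ℤ.^ suc p * s ℤ.^ suc p)      ≡⟨ ℤP.*-assoc (s ℤ.^ j) _ _ ⟨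
      s ℤ.^ j * s ℤ.^ suc p * s ℤ.^ suc p        ≡⟨ cong (_* s ℤ.^ suc p) (ℤP.^-distribˡ-+-* s j (suc p)) ⟨
      s ℤ.^ (j ℕ.+ suc p) * s ℤ.^ suc p          ≡⟨ cong (λ m → s ℤ.^ m * s ℤ.^ suc p) N≡j+p ⟨
      s ℤ.^ N * s ℤ.^ suc p                      ∎
      where open ≡-Reasoning
    exps : k ℕ.* tri j ℕ.+ (a ℕ.* j ℕ.+ k ℕ.* N ℕ.* (N ℕ.+ N ℕ.∸ j))
         ≡ (a ℕ.* N ℕ.+ k ℕ.* tri N) ℕ.+ k ℕ.* N ℕ.* N ℕ.+ e (+ j - + N)
    exps rewrite l-eq | i-eq = begin
      k ℕ.* tri j ℕ.+ (a ℕ.* j ℕ.+ k ℕ.* N ℕ.* (N ℕ.+ P))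
        ≡⟨ cong (λ m → k ℕ.* tri j ℕ.+ (a ℕ.* j ℕ.+ m)) (trans (ℕP.*-distribˡ-+ (k ℕ.* N) N P) (cong (λ m → k ℕ.* N ℕ.* N ℕ.+ k ℕ.* m ℕ.* P) N≡j+p)) ⟩
      k ℕ.* tri j ℕ.+ (a ℕ.* j ℕ.+ (k ℕ.* N ℕ.* N ℕ.+ k ℕ.* (j ℕ.+ P) ℕ.* P))
        ≡⟨ solve 6 (λ k t a j B p → k :* t :+ (a :* j :+ (B :+ k :* (j :+ p) :* p)) := k :* t :+ a :* j :+ B :+ k :* j :* p :+ k :* (p :* p)) refl
             k (tri j) a j (k ℕ.* N ℕ.* N) P ⟩
      k ℕ.* tri j ℕ.+ a ℕ.* j ℕ.+ k ℕ.* N ℕ.* N ℕ.+ k ℕ.* j ℕ.* P ℕ.+ k ℕ.* (P ℕ.* P)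
        ≡⟨ cong (λ m → k ℕ.* tri j ℕ.+ a ℕ.* j ℕ.+ k ℕ.* N ℕ.* N ℕ.+ k ℕ.* j ℕ.* P ℕ.+ m) (trans (cong (k ℕ.*_) (n*n≡2tri+n P))
             (trans (ℕP.*-distribˡ-+ k (2 ℕ.* tri P) P) (cong (λ c → k ℕ.* (2 ℕ.* tri P) ℕ.+ c ℕ.* P) (sym a+b≡k)))) ⟩
      k ℕ.* tri j ℕ.+ a ℕ.* j ℕ.+ k ℕ.* N ℕ.* N ℕ.+ k ℕ.* j ℕ.* P ℕ.+ (k ℕ.* (2 ℕ.* tri P) ℕ.+ (a ℕ.+ b) ℕ.* P)
        ≡⟨ solve 8 (λ k t a j B p u b → k :* t :+ a :* j :+ B :+ k :* j :* p :+ (k :* (con 2 :* u) :+ (a :+ b) :* p)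
              := (a :* (j :+ p) :+ k :* (t :+ u :+ j :* p)) :+ B :+ (k :* u :+ b :* p)) refl
             k (tri j) a j (k ℕ.* N ℕ.* N) P (tri P) b ⟩
      (a ℕ.* (j ℕ.+ P) ℕ.+ k ℕ.* (tri j ℕ.+ tri P ℕ.+ j ℕ.* P)) ℕ.+ k ℕ.* N ℕ.* N ℕ.+ (k ℕ.* tri P ℕ.+ b ℕ.* P)
        ≡⟨ cong (λ m → (a ℕ.* (j ℕ.+ P) ℕ.+ k ℕ.* m) ℕ.+ k ℕ.* N ℕ.* N ℕ.+ (k ℕ.* tri P ℕ.+ b ℕ.* P)) (tri-+ j P) ⟨
      (a ℕ.* (j ℕ.+ P) ℕ.+ k ℕ.* tri (j ℕ.+ P)) ℕ.+ k ℕ.* N ℕ.* N ℕ.+ (k ℕ.* tri P ℕ.+ b ℕ.* P)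
        ≡⟨ cong (λ m → (a ℕ.* m ℕ.+ k ℕ.* tri m) ℕ.+ k ℕ.* N ℕ.* N ℕ.+ (k ℕ.* tri P ℕ.+ b ℕ.* P)) N≡j+p ⟨
      (a ℕ.* N ℕ.+ k ℕ.* tri N) ℕ.+ k ℕ.* N ℕ.* N ℕ.+ (k ℕ.* tri P ℕ.+ b ℕ.* P) ∎
      where
      open ≡-Reasoning
      P = suc p
    bound : N ≤ suc (e (+ j - + N) ℕ.+ j)
    bound rewrite l-eq = ℕP.≤-trans (ℕP.≤-reflexive (trans N≡j+p (ℕP.+-comm j (suc p)))) (ℕP.+-monoˡ-≤ j (∣l∣≤1+exponent a b 1≤k -[1+ p ]))

  jacobi : ∀ n → f k ∙ (∏ (suc n) (λ r → ϕ s (a ℕ.+ k ℕ.* r)) ∙ ∏ (suc n) (λ r → ϕ s (b ℕ.+ k ℕ.* r)))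
               ≈[ n ] sumL monomial (rangeℤ (suc n))
  jacobi n = begin
    f k ∙ Π                                      ≈⟨ ≈⇒≈[] (R.*-congˡ finite) ⟩
    f k ∙ sumL (λ j → mon j ∙ Gj j) js           ≈⟨ ≈⇒≈[] (sumL-∙ (f k) (λ j → mon j ∙ Gj j) js) ⟨
    sumL (λ j → f k ∙ (mon j ∙ Gj j)) js         ≈⟨ sumL-cong[] js limit ⟩
    sumL mon js                                  ≡⟨ sumL-map monomial (λ j → + j - + N) js ⟨
    sumL monomial (rangeℤ N)                     ∎
    where
    -- One more than the precision, to absorb the `suc` in the last bound of `position`.
    N = suc n
    open ≈[]-Reasoning
    Π = ∏ N (λ r → ϕ s (a ℕ.+ k ℕ.* r)) ∙ ∏ N (λ r → ϕ s (b ℕ.+ k ℕ.* r))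
    js = upTo (suc (N ℕ.+ N))
    mon Gj : ℕ → PowerSeries
    mon j = monomial (+ j - + N)
    Gj j = G (N ℕ.+ N ℕ.∸ j) j
    pos : ∀ {j} → j ∈ js → Around N j
    pos {j} j∈ = around N j (ℕP.≤-pred (∈-upTo⁻ j∈))
    finite : Π ≈ sumL (λ j → mon j ∙ Gj j) js
    finite = prefactor-cancel N (R.trans (R.sym (product-side N)) (R.trans (q-binomial (N ℕ.+ N) _ _)
      (R.trans (antidiagonal-sumL (N ℕ.+ N) (term (sq s a) (qPow (k ℕ.* N)))) (R.trans (sumL-cong∈ js (λ {j} j∈ → let (sgn , exps , _) = position N j (pos j∈) in
        monomial-split N (N ℕ.+ N ℕ.∸ j) j (+ j - + N) sgn exps)) (sumL-∙ (prefactor N) _ js)))))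
    limit : ∀ {j} → j ∈ js → f k ∙ (mon j ∙ Gj j) ≈[ n ] mon j
    limit {j} j∈ = begin
      f k ∙ (mon j ∙ Gj j)                             ≈⟨ ≈⇒≈[] (S.solve 4 (λ f c q g → f S.:* (c S.:* q S.:* g) S.:= c S.:* (q S.:* (f S.:* g))) R.refl _ _ _ _) ⟩
      const sg ∙ (qPow (e l) ∙ (f k ∙ Gj j))           ≈⟨ ∙-congˡ[] (const sg) (≈[]-mono (ℕP.≤-pred bound) (qPow-cong[] (e l) (f-G 1≤k m≤i m≤j))) ⟩
      const sg ∙ (qPow (e l) ∙ 𝟏)                      ≈⟨ ≈⇒≈[] (R.*-congˡ (R.*-identityʳ _)) ⟩
      mon j ∎
      where
      module S = Solver
      l = + j - + N
      sg = s ℤ.^ ℤ.∣ l ∣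
      P = proj₂ (proj₂ (position N j (pos j∈)))
      m≤i = proj₁ (proj₂ P)
      m≤j = proj₁ (proj₂ (proj₂ P))
      bound = proj₂ (proj₂ (proj₂ P))

-- Series indexed by arbitrary sets

sumL-++ : ∀ {a} {A : Set a} (g : A → PowerSeries) as bs → sumL g (as ++ bs) ≈ sumL g as ⊕ sumL g bs
sumL-++ g [] bs = R.sym (R.+-identityˡ _)
sumL-++ g (a ∷ as) bs = R.trans (R.+-congˡ (sumL-++ g as bs)) (R.sym (R.+-assoc _ _ _))

sumL-↭ : ∀ {a} {A : Set a} (g : A → PowerSeries) {as bs} → as ↭ bs → sumL g as ≈ sumL g bs
sumL-↭ g Perm.refl = R.refl
sumL-↭ g (Perm.prep a p) = R.+-congˡ (sumL-↭ g p)
sumL-↭ g (Perm.swap a b p) = R.trans (R.+-congˡ (R.+-congˡ (sumL-↭ g p)))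
  (solve 3 (λ a b c → a :+ (b :+ c) := b :+ (a :+ c)) R.refl _ _ _)
  where open Solver
sumL-↭ g (Perm.trans p q) = R.trans (sumL-↭ g p) (sumL-↭ g q)

sumL-cartesianProduct : ∀ {a b} {A : Set a} {B : Set b} (g : A → PowerSeries) (h : B → PowerSeries) as bs →
  sumL (λ p → g (proj₁ p) ∙ h (proj₂ p)) (cartesianProduct as bs) ≈ sumL g as ∙ sumL h bs
sumL-cartesianProduct g h [] bs = R.sym (R.zeroˡ _)
sumL-cartesianProduct g h (a ∷ as) bs = begin
  sumL gh (map (a ,_) bs ++ cartesianProduct as bs)                  ≈⟨ sumL-++ gh (map (a ,_) bs) _ ⟩
  sumL gh (map (a ,_) bs) ⊕ sumL gh (cartesianProduct as bs)         ≈⟨ R.+-cong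
    (R.trans (R.reflexive (sumL-map gh (a ,_) bs)) (sumL-∙ (g a) h bs)) (sumL-cartesianProduct g h as bs) ⟩
  g a ∙ sumL h bs ⊕ sumL g as ∙ sumL h bs                            ≈⟨ R.distribʳ _ _ _ ⟨
  (g a ⊕ sumL g as) ∙ sumL h bs                                      ∎
  where
  open ≈-Reasoning
  gh = λ p → g (proj₁ p) ∙ h (proj₂ p)

module _ {A : Set} (c : A → ℤ) (e : A → ℕ) where

  mono : A → PowerSeries
  mono a = sq (c a) (e a)

  -- Elements of exponent above N may occur too, since they do not change the series at this
  -- precision; a range or a Cartesian product can thus be used without trimming.
  Covers : ℕ → List A → Set
  Covers N L = Unique L × (∀ a → e a ≤ N → a ∈ L)

  -- X = Σ_{a ∈ A} c(a) q^{e(a)}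
  Generates : PowerSeries → Set
  Generates X = ∀ N → ∃ λ L → Covers N L × X ≈[ N ] sumL mono L

  restrict : ∀ N L → sumL mono (filter (λ a → e a ℕ.≤? N) L) ≈[ N ] sumL mono L
  restrict N [] = ≈[]-refl
  restrict N (a ∷ L) with e a ℕ.≤? N
  ... | yes e≤N rewrite filter-accept (λ a → e a ℕ.≤? N) {xs = L} e≤N = ⊕-cong[] ≈[]-refl (restrict N L)
  ... | no e≰N rewrite filter-reject (λ a → e a ℕ.≤? N) {xs = L} e≰N = ≈[]-trans (restrict N L) (≈[]-trans (≈⇒≈[] (R.sym (R.+-identityˡ _)))
    (⊕-cong[] (≈[]-sym (≈[]-trans (∙-congˡ[] (const (c a)) (qPow-small (ℕP.≰⇒> e≰N))) (≈⇒≈[] (R.zeroʳ _)))) ≈[]-refl))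

  -- After removal of the exponents above N, both lists have the same elements without repetition,
  -- so they are permutations of each other.
  covers-unique : ∀ {N L L′} → Covers N L → Covers N L′ → sumL mono L ≈[ N ] sumL mono L′
  covers-unique {N} {L} {L′} (u , p) (u′ , p′) = begin
    sumL mono L                 ≈⟨ restrict N L ⟨
    sumL mono (filter P? L)     ≈⟨ ≈⇒≈[] (sumL-↭ mono (∼bag⇒↭ (unique∧set⇒bag (Unique.filter⁺ P? u) (Unique.filter⁺ P? u′)
                                      (mk⇔ (transfer L L′ p′) (transfer L′ L p))))) ⟩
    sumL mono (filter P? L′)    ≈⟨ restrict N L′ ⟩
    sumL mono L′                ∎
    where
    open ≈[]-Reasoning
    P? = λ a → e a ℕ.≤? N
    transfer : ∀ L L′ → (∀ a → e a ≤ N → a ∈ L′) → ∀ {a} → a ∈ filter P? L → a ∈ filter P? L′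
    transfer L L′ p {a} a∈ = let (_ , e≤N) = ∈-filter⁻ P? {xs = L} a∈ in ∈-filter⁺ P? (p a e≤N) e≤N

  generates-unique : ∀ {X Y} → Generates X → Generates Y → X ≈ Y
  generates-unique g h = ≈[]⇒≈ λ N → let (L , cov , p) = g N ; (L′ , cov′ , p′) = h N in
    ≈[]-trans p (≈[]-trans (covers-unique cov cov′) (≈[]-sym p′))

generates-∙ : ∀ {A B : Set} {c : A → ℤ} {e} {c′ : B → ℤ} {e′} {X Y} → Generates c e X → Generates c′ e′ Y →
  Generates (λ p → c (proj₁ p) * c′ (proj₂ p)) (λ p → e (proj₁ p) ℕ.+ e′ (proj₂ p)) (X ∙ Y)
generates-∙ {c = c} {e} {c′} {e′} g h N =
  let (L , (u , p) , x) = g N ; (L′ , (u′ , p′) , y) = h N in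
  cartesianProduct L L′ ,
  (Unique.cartesianProduct⁺ u u′ , λ (a , b) e≤N →
    ∈-cartesianProduct⁺ (p a (ℕP.≤-trans (ℕP.m≤m+n _ _) e≤N)) (p′ b (ℕP.≤-trans (ℕP.m≤n+m _ _) e≤N))) ,
  ≈[]-trans (∙-cong[] x y) (≈⇒≈[] (R.trans (R.sym (sumL-cartesianProduct (mono c e) (mono c′ e′) L L′))
    (sumL-cong∈ (cartesianProduct L L′) (λ _ → sq-∙ _ _ _ _))))

generates-sq : ∀ {A : Set} {c : A → ℤ} {e} {X} s d → Generates c e X →
  Generates (λ a → s * c a) (λ a → d ℕ.+ e a) (sq s d ∙ X)
generates-sq {c = c} {e} s d g N = let (L , (u , p) , x) = g N in
  L , (u , λ a e≤N → p a (ℕP.≤-trans (ℕP.m≤n+m _ d) e≤N)) ,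
  ≈[]-trans (∙-congˡ[] (sq s d) x) (≈⇒≈[] (R.trans (R.sym (sumL-∙ (sq s d) (mono c e) L))
    (sumL-cong∈ L (λ _ → sq-∙ _ _ _ _))))

generates-↔ : ∀ {A B : Set} {c : A → ℤ} {e} {c′ : B → ℤ} {e′} {X} (φ : A ↔ B) →
  (∀ a → c′ (Inverse.to φ a) ≡ c a) → (∀ a → e′ (Inverse.to φ a) ≡ e a) →
  Generates c e X → Generates c′ e′ X
generates-↔ {e = e} {c′} {e′} φ c≡ e≡ g N = let (L , (u , p) , x) = g N in
  map to L ,
  (Unique.map⁺ (λ {x} {y} eq → trans (sym (strictlyInverseʳ x)) (trans (cong from eq) (strictlyInverseʳ y))) u , λ b e≤N → subst (_∈ map to L) (strictlyInverseˡ b)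
    (∈-map⁺ to (p (from b) (subst (_≤ N) (trans (cong e′ (sym (strictlyInverseˡ b))) (e≡ (from b))) e≤N)))) ,
  ≈[]-trans x (≈⇒≈[] (R.trans (sumL-cong∈ L (λ {a} _ → R.sym (sq-cong (c≡ a) (e≡ a))))
    (R.reflexive (sym (sumL-map (mono c′ e′) to L)))))
  where open Inverse φ

∑Fin : ∀ d → (Fin d → PowerSeries) → PowerSeries
∑Fin zero X = 𝟎
∑Fin (suc d) X = X zero ⊕ ∑Fin d (X ∘ suc)

generates-Fin : ∀ {A : Set} d {c : Fin d → A → ℤ} {e : Fin d → A → ℕ} {X : Fin d → PowerSeries} →
  (∀ r → Generates (c r) (e r) (X r)) → Generates (uncurry c) (uncurry e) (∑Fin d X)
generates-Fin zero g N = [] , (AllPairs.[] , λ { (() , _) }) , ≈[]-refl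
generates-Fin {A} (suc d) {c} {e} g N =
  let (L , (u , p) , x) = g zero N ; (L′ , (u′ , p′) , y) = generates-Fin d (g ∘ suc) N in
  map first L ++ map rest L′ ,
  (Unique.++⁺ (Unique.map⁺ (λ { refl → refl }) u) (Unique.map⁺ (λ { refl → refl }) u′) disjoint ,
   λ { (zero , a) e≤N → ∈-++⁺ˡ (∈-map⁺ first (p a e≤N))
     ; (suc r , a) e≤N → ∈-++⁺ʳ (map first L) (∈-map⁺ rest (p′ (r , a) e≤N)) }) ,
  ≈[]-trans (⊕-cong[] x y) (≈⇒≈[] (R.trans
    (R.+-cong (R.reflexive (sym (sumL-map m first L))) (R.reflexive (sym (sumL-map m rest L′))))
    (R.sym (sumL-++ m (map first L) (map rest L′)))))
  where
  m = mono (uncurry c) (uncurry e)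
  first : A → Fin (suc d) × A
  first a = zero , a
  rest : Fin d × A → Fin (suc d) × A
  rest (r , a) = suc r , a
  disjoint : ∀ {L L′ x} → x ∈ map first L × x ∈ map rest L′ → _
  disjoint (x∈ , x∈′) with ∈-map⁻ first x∈ | ∈-map⁻ rest x∈′
  ... | _ , _ , refl | _ , _ , ()

-- The exponent is doubled so that P can be a polynomial with integer coefficients.
compare : ∀ {A B Z : Set} {c : A → ℤ} {e} {c′ : B → ℤ} {e′} {X Y} (C P : Z → ℤ) (φ : A ↔ Z) (ψ : B ↔ Z) →
  (∀ a → C (Inverse.to φ a) ≡ c a) → (∀ a → P (Inverse.to φ a) ≡ + 2 * + e a) →
  (∀ b → C (Inverse.to ψ b) ≡ c′ b) → (∀ b → P (Inverse.to ψ b) ≡ + 2 * + e′ b) →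
  Generates c e X → Generates c′ e′ Y → X ≈ Y
compare {Z = Z} {c} {e} {c′} {e′} C P φ ψ cA eA cB eB g h = generates-unique C E
  (generates-↔ φ cA (λ a → cong e (strictlyInverseʳ φ a)) g)
  (generates-↔ ψ cB (λ b → ℤP.+-injective (ℤP.*-cancelˡ-≡ (+ 2) _ _ (begin
    + 2 * + E (to ψ b)                     ≡⟨ eA (from φ (to ψ b)) ⟨
    P (to φ (from φ (to ψ b)))             ≡⟨ cong P (strictlyInverseˡ φ (to ψ b)) ⟩
    P (to ψ b)                             ≡⟨ eB b ⟩
    + 2 * + e′ b                           ∎))) h)
  where
  open Inverse
  open ≡-Reasoning
  E : Z → ℕ
  E z = e (from φ z)

-- Theta series and bijections of their index sets

module _ (k a b : ℕ) (s : ℤ) where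
  private
    c : ℤ → ℤ
    c l = s ℤ.^ ℤ.∣ l ∣
    e = exponent k a b

  -- Diagonal like `f`: the range of radius `suc n` contains every index whose exponent is at most
  -- n, by `∣l∣≤1+exponent`.
  θ : PowerSeries
  θ n = sumL (mono c e) (rangeℤ (suc n)) n

  module _ (1≤k : 1 ≤ k) where

    rangeℤ-covers : ∀ {N M} → N ≤ M → Covers c e N (rangeℤ (suc M))
    rangeℤ-covers {M = M} N≤M = rangeℤ-unique (suc M) , λ l e≤N →
      ∈-rangeℤ l (ℕP.≤-trans (∣l∣≤1+exponent a b 1≤k l) (s≤s (ℕP.≤-trans e≤N N≤M)))

    θ-range : ∀ N → θ ≈[ N ] sumL (mono c e) (rangeℤ (suc N))
    θ-range N = mk≈[] λ n n≤N →
      upTo≤ (covers-unique c e (rangeℤ-covers ℕP.≤-refl) (rangeℤ-covers n≤N)) n ℕP.≤-refl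

    θ-generates : Generates c e θ
    θ-generates N = rangeℤ (suc N) , rangeℤ-covers ℕP.≤-refl , θ-range N

    θ-product : a ℕ.+ b ≡ k → s * s ≡ + 1 → ∀ n →
      θ ≈[ n ] f k ∙ (∏ (suc n) (λ r → ϕ s (a ℕ.+ k ℕ.* r)) ∙ ∏ (suc n) (λ r → ϕ s (b ℕ.+ k ℕ.* r)))
    θ-product a+b≡k s*s≡1 n = ≈[]-trans (θ-range n) (≈[]-sym (JacobiTripleProduct.jacobi k a b a+b≡k 1≤k s s*s≡1 n))

-- Doubling clears the denominator of `tri`, and a + b = k makes the cases l ≥ 0 and l < 0 the same
-- polynomial.
2*exponent : ∀ k a b → a ℕ.+ b ≡ k → ∀ l → + 2 * + exponent k a b l ≡ + k * (l * l) + (+ a - + b) * l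
2*exponent k a b refl l = go l
  where
  open ℤSolver.+-*-Solver
  open ≡-Reasoning
  half : ∀ p c → + 2 * + ((a ℕ.+ b) ℕ.* tri p ℕ.+ c ℕ.* p) ≡ (+ a + + b) * (+ p * + p - + p) + + 2 * (+ c * + p)
  half p c = begin
    + 2 * + ((a ℕ.+ b) ℕ.* tri p ℕ.+ c ℕ.* p)
      ≡⟨ cong (+ 2 *_) (trans (ℤP.pos-+ ((a ℕ.+ b) ℕ.* tri p) (c ℕ.* p)) (cong₂ _+_ (trans (ℤP.pos-* (a ℕ.+ b) (tri p)) (cong (_* + tri p) (ℤP.pos-+ a b))) (ℤP.pos-* c p))) ⟩
    + 2 * ((+ a + + b) * + tri p + + c * + p)
      ≡⟨ solve 4 (λ k t c p → con (+ 2) :* (k :* t :+ c :* p) := k :* ((con (+ 2) :* t :+ p) :- p) :+ con (+ 2) :* (c :* p)) refl (+ a + + b) (+ tri p) (+ c) (+ p) ⟩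
    (+ a + + b) * (+ 2 * + tri p + + p - + p) + + 2 * (+ c * + p)
      ≡⟨ cong (λ z → (+ a + + b) * (z - + p) + + 2 * (+ c * + p)) square ⟨
    (+ a + + b) * (+ p * + p - + p) + + 2 * (+ c * + p) ∎
    where
    square : + p * + p ≡ + 2 * + tri p + + p
    square = trans (sym (ℤP.pos-* p p)) (trans (cong +_ (n*n≡2tri+n p))
      (trans (ℤP.pos-+ (2 ℕ.* tri p) p) (cong (_+ + p) (ℤP.pos-* 2 (tri p)))))
  go : ∀ l → + 2 * + exponent (a ℕ.+ b) a b l ≡ + (a ℕ.+ b) * (l * l) + (+ a - + b) * l
  go (+ p) = trans (half p a) (trans
    (solve 3 (λ a b p → (a :+ b) :* (p :* p :- p) :+ con (+ 2) :* (a :* p) := (a :+ b) :* (p :* p) :+ (a :- b) :* p) refl (+ a) (+ b) (+ p))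
    (cong (λ k → k * (+ p * + p) + (+ a - + b) * + p) (sym (ℤP.pos-+ a b))))
  go -[1+ p ] = trans (half (suc p) b) (trans
    (solve 3 (λ a b p → (a :+ b) :* (p :* p :- p) :+ con (+ 2) :* (b :* p) := (a :+ b) :* ((:- p) :* (:- p)) :+ (a :- b) :* (:- p)) refl (+ a) (+ b) (+ suc p))
    (cong (λ k → k * (-[1+ p ] * -[1+ p ]) + (+ a - + b) * -[1+ p ]) (sym (ℤP.pos-+ a b))))

residue : ∀ d → Fin d × ℤ → ℤ
residue d (r , t) = + d * t + + toℕ r

residue-unique : ∀ d .{{_ : ℕ.NonZero d}} (r r′ : ℕ) → r ℕ.< d → r′ ℕ.< d → ∀ t t′ → + d * t + + r ≡ + d * t′ + + r′ → t ≡ t′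
residue-unique d r r′ r<d r′<d t t′ eq = ℤP.≤-antisym (half r r′ r′<d t t′ eq) (half r′ r r<d t′ t (sym eq))
  where
  half : ∀ r r′ → r′ ℕ.< d → ∀ t t′ → + d * t + + r ≡ + d * t′ + + r′ → t ℤ.≤ t′
  half r r′ r′<d t t′ eq with t ℤP.≤? t′
  ... | yes t≤t′ = t≤t′
  ... | no t≰t′ = contradiction (sym eq) (ℤP.<⇒≢ (ℤP.<-≤-trans
    (ℤP.+-monoʳ-< (+ d * t′) (ℤ.+<+ r′<d))
    (ℤP.≤-trans (ℤP.≤-reflexive (trans (ℤP.+-comm (+ d * t′) (+ d)) (sym (ℤP.*-suc (+ d) t′))))
      (ℤP.≤-trans (ℤP.*-monoˡ-≤-nonNeg (+ d) (ℤP.i<j⇒suc[i]≤j (ℤP.≰⇒> t≰t′))) (ℤP.i≤i+j (+ d * t) (+ r))))))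

residue↔ : ∀ d .{{_ : ℕ.NonZero d}} → (Fin d × ℤ) ↔ ℤ
residue↔ d = mk↔ₛ′ (residue d) split residue-split split-residue
  where
  split : ℤ → Fin d × ℤ
  split l = Fin.fromℕ< (ℤD.n%ℕd<d l d) , l ℤ./ℕ d
  residue-split : ∀ l → residue d (split l) ≡ l
  residue-split l = trans (cong (λ r → + d * (l ℤ./ℕ d) + + r) (FinP.toℕ-fromℕ< (ℤD.n%ℕd<d l d)))
    (trans (trans (ℤP.+-comm (+ d * (l ℤ./ℕ d)) _) (cong (λ z → + (l ℤ.%ℕ d) + z) (ℤP.*-comm (+ d) (l ℤ./ℕ d))))
      (sym (ℤD.a≡a%ℕn+[a/ℕn]*n l d)))
  residue-injective : ∀ p p′ → residue d p ≡ residue d p′ → p ≡ p′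
  residue-injective (r , t) (r′ , t′) eq with residue-unique d _ _ (FinP.toℕ<n r) (FinP.toℕ<n r′) t t′ eq
  ... | refl = cong (_, t) (FinP.toℕ-injective (ℤP.+-injective (+-cancelˡ-≡ (+ d * t) (+ toℕ r) (+ toℕ r′) eq)))
  split-residue : ∀ p → split (residue d p) ≡ p
  split-residue p = residue-injective _ p (residue-split (residue d p))

ℤ² : Set
ℤ² = ℤ × ℤ

-- Splits the plane by the residue of the first coordinate and gives each class coordinates of its
-- own. After a shear, membership in a sublattice of index d is such a residue condition.
dissection : ∀ d .{{_ : ℕ.NonZero d}} → (Fin d → ℤ² ↔ ℤ²) → (Fin d × ℤ²) ↔ ℤ²
dissection d ρ = mk↔ₛ′
  (λ (r , p) → let (t , y) = to (ρ r) p in to R↔ (r , t) , y)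
  (λ (s , y) → let (r , t) = from R↔ s in r , from (ρ r) (t , y))
  (λ (s , y) → let (r , t) = from R↔ s in
    trans (cong (λ p → to R↔ (r , proj₁ p) , proj₂ p) (strictlyInverseˡ (ρ r) (t , y))) (cong (_, y) (strictlyInverseˡ R↔ s)))
  (λ (r , p) → trans (cong (λ x → proj₁ x , from (ρ (proj₁ x)) (proj₂ x , proj₂ (to (ρ r) p))) (strictlyInverseʳ R↔ (r , proj₁ (to (ρ r) p))))
    (cong (r ,_) (strictlyInverseʳ (ρ r) p)))
  where
  open Inverse
  R↔ = residue↔ d

-- Eta quotients

opaque
  fPow : ℕ → ℤ → PowerSeries
  fPow m (+ n) = f m ^ n
  fPow m -[1+ n ] = f⁻¹ m ^ suc n

  fPow-⊖ : ∀ m i j → f m ^ i ∙ f⁻¹ m ^ j ≈ fPow m (i ⊖ j)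
  fPow-⊖ m zero zero = R.*-identityˡ 𝟏
  fPow-⊖ m zero (suc j) = R.*-identityˡ _
  fPow-⊖ m (suc i) zero = R.*-identityʳ _
  fPow-⊖ m (suc i) (suc j) = begin
    f m ∙ f m ^ i ∙ (f⁻¹ m ∙ f⁻¹ m ^ j)       ≈⟨ solve 4 (λ a b c d → a :* b :* (c :* d) := (a :* c) :* (b :* d)) R.refl _ _ _ _ ⟩
    (f m ∙ f⁻¹ m) ∙ (f m ^ i ∙ f⁻¹ m ^ j)     ≈⟨ R.*-cong (f-inverse m) (fPow-⊖ m i j) ⟩
    𝟏 ∙ fPow m (i ⊖ j)                        ≈⟨ R.*-identityˡ _ ⟩
    fPow m (i ⊖ j)                            ≡⟨ cong (fPow m) (ℤP.[1+m]⊖[1+n]≡m⊖n i j) ⟨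
    fPow m (suc i ⊖ suc j)                    ∎
    where
    open ≈-Reasoning
    open Solver

  fPow-+ : ∀ m a b → fPow m a ∙ fPow m b ≈ fPow m (a + b)
  fPow-+ m (+ i) (+ j) = R.sym (^-homo-* (f m) i j)
  fPow-+ m (+ i) -[1+ j ] = fPow-⊖ m i (suc j)
  fPow-+ m -[1+ i ] (+ j) = R.trans (R.*-comm _ _) (fPow-⊖ m j (suc i))
  fPow-+ m -[1+ i ] -[1+ j ] = R.trans (R.sym (^-homo-* (f⁻¹ m) (suc i) (suc j)))
    (R.reflexive (cong (λ n → f⁻¹ m ^ suc n) (ℕP.+-suc i j)))

opaque
  unfolding fPow
  -- The eta quotient with exponents a, b, c at f_m, f_2m, f_4m. Integer exponents reduce products
  -- and quotients to arithmetic on exponent vectors, which evaluates for numerals.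
  η₃ : ℕ → ℤ → ℤ → ℤ → PowerSeries
  η₃ m a b c = fPow m a ∙ (fPow (m ℕ.+ m) b ∙ fPow (m ℕ.+ m ℕ.+ (m ℕ.+ m)) c)

  η₃-∙ : ∀ m a b c a′ b′ c′ → η₃ m a b c ∙ η₃ m a′ b′ c′ ≈ η₃ m (a + a′) (b + b′) (c + c′)
  η₃-∙ m a b c a′ b′ c′ = R.trans
    (solve 6 (λ a b c a′ b′ c′ → a :* (b :* c) :* (a′ :* (b′ :* c′)) := (a :* a′) :* ((b :* b′) :* (c :* c′))) R.refl _ _ _ _ _ _)
    (R.*-cong (fPow-+ m a a′) (R.*-cong (fPow-+ _ b b′) (fPow-+ _ c c′)))
    where open Solver

  η₃-divide : ∀ {n x} m a b c a′ b′ c′ → x ∙ η₃ m a b c ≈[ n ] η₃ m a′ b′ c′ → x ≈[ n ] η₃ m (a′ - a) (b′ - b) (c′ - c)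
  η₃-divide {n} {x} m a b c a′ b′ c′ p = begin
    x                                                  ≈⟨ ≈⇒≈[] (R.*-identityʳ x) ⟨
    x ∙ 𝟏                                              ≈⟨ ≈⇒≈[] (R.*-congˡ unit) ⟩
    x ∙ η₃ m (a - a) (b - b) (c - c)                   ≈⟨ ≈⇒≈[] (R.*-congˡ (η₃-∙ m a b c (- a) (- b) (- c))) ⟨
    x ∙ (η₃ m a b c ∙ η₃ m (- a) (- b) (- c))          ≈⟨ ≈⇒≈[] (R.*-assoc _ _ _) ⟨
    x ∙ η₃ m a b c ∙ η₃ m (- a) (- b) (- c)            ≈⟨ ∙-congʳ[] _ p ⟩
    η₃ m a′ b′ c′ ∙ η₃ m (- a) (- b) (- c)             ≈⟨ ≈⇒≈[] (η₃-∙ m a′ b′ c′ (- a) (- b) (- c)) ⟩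
    η₃ m (a′ - a) (b′ - b) (c′ - c)                    ∎
    where
    open ≈[]-Reasoning
    unit : 𝟏 ≈ η₃ m (a - a) (b - b) (c - c)
    unit rewrite ℤP.+-inverseʳ a | ℤP.+-inverseʳ b | ℤP.+-inverseʳ c =
      R.sym (R.trans (R.*-identityˡ _) (R.*-identityˡ 𝟏))

  f₁-η₃ : ∀ m → f m ≈ η₃ m (+ 1) (+ 0) (+ 0)
  f₁-η₃ m = Solver.solve 1 (λ x → x Solver.:= x Solver.:* Solver.con (+ 1) Solver.:* (Solver.con (+ 1) Solver.:* Solver.con (+ 1))) R.refl (f m)

  f₂-η₃ : ∀ m → f (m ℕ.+ m) ≈ η₃ m (+ 0) (+ 1) (+ 0)
  f₂-η₃ m = Solver.solve 1 (λ x → x Solver.:= Solver.con (+ 1) Solver.:* (x Solver.:* Solver.con (+ 1) Solver.:* Solver.con (+ 1))) R.refl (f (m ℕ.+ m))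

  f₄-η₃ : ∀ m → f (m ℕ.+ m ℕ.+ (m ℕ.+ m)) ≈ η₃ m (+ 0) (+ 0) (+ 1)
  f₄-η₃ m = Solver.solve 1 (λ x → x Solver.:= Solver.con (+ 1) Solver.:* (Solver.con (+ 1) Solver.:* (x Solver.:* Solver.con (+ 1)))) R.refl (f (m ℕ.+ m ℕ.+ (m ℕ.+ m)))

-- Theta functions as eta quotients

1≤ : ∀ {n} → 1 ≤ suc n
1≤ = s≤s z≤n

ϕ-cong : ∀ s {d e} → d ≡ e → ϕ s d ≈ ϕ s e
ϕ-cong s refl = R.refl

full odd : ℤ → ℕ → ℕ → PowerSeries
full s m N = ∏ N (λ r → ϕ s (m ℕ.* suc r))
odd s m N = ∏ N (λ r → ϕ s (m ℕ.+ (m ℕ.+ m) ℕ.* r))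

full-split : ∀ s m N → full s m (N ℕ.* 2) ≈ odd s m N ∙ full s (m ℕ.+ m) N
full-split s m N = R.trans (∏-* N 2 _) (R.trans (∏-cong N λ i →
    R.*-cong (R.trans (R.*-identityˡ _) (ϕ-cong s (S.solve 2 (λ m i → m S.:* (S.con 1 S.:+ (i S.:* S.con 2 S.:+ S.con 0)) S.:= m S.:+ (m S.:+ m) S.:* i) refl m i)))
             (ϕ-cong s (S.solve 2 (λ m i → m S.:* (S.con 1 S.:+ (i S.:* S.con 2 S.:+ S.con 1)) S.:= (m S.:+ m) S.:* (S.con 1 S.:+ i)) refl m i)))
  (∏-∙ N _ _))
  where module S = ℕSolver.+-*-Solver

full-double : ∀ m N → full (+ 1) m N ∙ Euler m N ≈ Euler (m ℕ.+ m) N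
full-double m N = R.trans (R.sym (∏-∙ N _ _)) (∏-cong N λ r → R.trans
  (solve 1 (λ x → (con (+ 1) :+ con (+ 1) :* x) :* (con (+ 1) :+ con -1ℤ :* x) := con (+ 1) :+ con -1ℤ :* (x :* x)) R.refl (qPow (m ℕ.* suc r)))
  (R.trans (R.+-congˡ (R.*-congˡ (qPow-+ _ _))) (ϕ-cong -1ℤ (sym (ℕP.*-distribʳ-+ (suc r) m m)))))
  where open Solver

1≤m+m : ∀ {m} → 1 ≤ m → 1 ≤ m ℕ.+ m
1≤m+m 1≤m = ℕP.≤-trans 1≤m (ℕP.m≤m+n _ _)

module _ {m : ℕ} (1≤m : 1 ≤ m) where

  Euler-η₃ : ∀ {n N} → n ≤ N → Euler m N ≈[ n ] η₃ m (+ 1) (+ 0) (+ 0)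
  Euler-η₃ n≤N = ≈[]-trans (≈[]-sym (f-Euler 1≤m n≤N)) (≈⇒≈[] (f₁-η₃ m))

  Euler₂-η₃ : ∀ {n N} → n ≤ N → Euler (m ℕ.+ m) N ≈[ n ] η₃ m (+ 0) (+ 1) (+ 0)
  Euler₂-η₃ n≤N = ≈[]-trans (≈[]-sym (f-Euler (1≤m+m 1≤m) n≤N)) (≈⇒≈[] (f₂-η₃ m))

  full-η₃ : ∀ {n N} → n ≤ N → full (+ 1) m N ≈[ n ] η₃ m -1ℤ (+ 1) (+ 0)
  full-η₃ {n} {N} n≤N = η₃-divide m (+ 1) (+ 0) (+ 0) (+ 0) (+ 1) (+ 0)
    (≈[]-trans (∙-congˡ[] _ (≈[]-sym (Euler-η₃ n≤N))) (≈[]-trans (≈⇒≈[] (full-double m N)) (Euler₂-η₃ n≤N)))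

  full₂-η₃ : ∀ {n N} → n ≤ N → full (+ 1) (m ℕ.+ m) N ≈[ n ] η₃ m (+ 0) -1ℤ (+ 1)
  full₂-η₃ {n} {N} n≤N = η₃-divide m (+ 0) (+ 1) (+ 0) (+ 0) (+ 0) (+ 1)
    (≈[]-trans (∙-congˡ[] _ (≈[]-sym (Euler₂-η₃ n≤N))) (≈[]-trans (≈⇒≈[] (full-double (m ℕ.+ m) N))
      (≈[]-trans (≈[]-sym (f-Euler (1≤m+m (1≤m+m 1≤m)) n≤N)) (≈⇒≈[] (f₄-η₃ m)))))

  n≤N*2 : ∀ {n N} → n ≤ N → n ≤ N ℕ.* 2
  n≤N*2 {N = N} n≤N = ℕP.≤-trans n≤N (ℕP.m≤m*n N 2)

  odd⁻-η₃ : ∀ {n N} → n ≤ N → odd -1ℤ m N ≈[ n ] η₃ m (+ 1) -1ℤ (+ 0)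
  odd⁻-η₃ {n} {N} n≤N = η₃-divide m (+ 0) (+ 1) (+ 0) (+ 1) (+ 0) (+ 0)
    (≈[]-trans (∙-congˡ[] _ (≈[]-sym (Euler₂-η₃ n≤N))) (≈[]-trans (≈⇒≈[] (R.sym (full-split -1ℤ m N))) (Euler-η₃ (n≤N*2 n≤N))))

  -- All factors divided by those of even index: f_2m / f_m over f_4m / f_2m.
  odd⁺-η₃ : ∀ {n N} → n ≤ N → odd (+ 1) m N ≈[ n ] η₃ m -1ℤ (+ 2) -1ℤ
  odd⁺-η₃ {n} {N} n≤N = η₃-divide m (+ 0) -1ℤ (+ 1) -1ℤ (+ 1) (+ 0)
    (≈[]-trans (∙-congˡ[] _ (≈[]-sym (full₂-η₃ n≤N))) (≈[]-trans (≈⇒≈[] (R.sym (full-split (+ 1) m N))) (full-η₃ (n≤N*2 n≤N))))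

-- φ(q^m) for s = 1 and φ(-q^m) for s = -1
φ : ℤ → ℕ → PowerSeries
φ s m = θ (m ℕ.+ m) m m s

-- 2 ψ(q^m), because the summands at l and - 1 - l agree
ψ₂ : ℕ → PowerSeries
ψ₂ m = θ m m 0 (+ 1)

module _ {m : ℕ} (1≤m : 1 ≤ m) where

  φ⁻-η₃ : φ -1ℤ m ≈ η₃ m (+ 2) -1ℤ (+ 0)
  φ⁻-η₃ = ≈[]⇒≈ λ n → ≈[]-trans (θ-product _ _ _ _ (1≤m+m 1≤m) refl refl n)
    (≈[]-trans (∙-cong[] (≈⇒≈[] (f₂-η₃ m)) (∙-cong[] (odd⁻-η₃ 1≤m (ℕP.n≤1+n n)) (odd⁻-η₃ 1≤m (ℕP.n≤1+n n))))
      (≈⇒≈[] (R.trans (R.*-congˡ (η₃-∙ m _ _ _ _ _ _)) (η₃-∙ m _ _ _ _ _ _))))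

  φ⁺-η₃ : φ (+ 1) m ≈ η₃ m (- + 2) (+ 5) (- + 2)
  φ⁺-η₃ = ≈[]⇒≈ λ n → ≈[]-trans (θ-product _ _ _ _ (1≤m+m 1≤m) refl refl n)
    (≈[]-trans (∙-cong[] (≈⇒≈[] (f₂-η₃ m)) (∙-cong[] (odd⁺-η₃ 1≤m (ℕP.n≤1+n n)) (odd⁺-η₃ 1≤m (ℕP.n≤1+n n))))
      (≈⇒≈[] (R.trans (R.*-congˡ (η₃-∙ m _ _ _ _ _ _)) (η₃-∙ m _ _ _ _ _ _))))

  ψ₂-η₃ : ψ₂ m ≈ const (+ 2) ∙ η₃ m -1ℤ (+ 2) (+ 0)
  ψ₂-η₃ = ≈[]⇒≈ λ n → begin
    ψ₂ m
      ≈⟨ θ-product m m 0 (+ 1) 1≤m (ℕP.+-identityʳ m) refl n ⟩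
    f m ∙ (∏ (suc n) (λ r → ϕ (+ 1) (m ℕ.+ m ℕ.* r)) ∙ ∏ (suc n) (λ r → ϕ (+ 1) (m ℕ.* r)))
      -- Since b = 0, the second product begins with 1 + q⁰ = 2.
      ≈⟨ ≈⇒≈[] (R.*-cong (f₁-η₃ m) (R.*-cong (∏-cong (suc n) λ r → ϕ-cong (+ 1) (sym (ℕP.*-suc m r)))
           (R.trans (∏-front n _) (R.*-congʳ (R.trans (ϕ-cong (+ 1) (ℕP.*-zeroʳ m)) ϕ0))))) ⟩
    η₃ m (+ 1) (+ 0) (+ 0) ∙ (full (+ 1) m (suc n) ∙ (const (+ 2) ∙ full (+ 1) m n))
      ≈⟨ ∙-congˡ[] _ (∙-cong[] (full-η₃ 1≤m (ℕP.n≤1+n n)) (∙-congˡ[] _ (full-η₃ 1≤m (ℕP.≤-refl)))) ⟩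
    η₃ m (+ 1) (+ 0) (+ 0) ∙ (η₃ m -1ℤ (+ 1) (+ 0) ∙ (const (+ 2) ∙ η₃ m -1ℤ (+ 1) (+ 0)))
      ≈⟨ ≈⇒≈[] (solve 4 (λ a b c d → a :* (b :* (c :* d)) := c :* (a :* (b :* d))) R.refl _ _ _ _) ⟩
    const (+ 2) ∙ (η₃ m (+ 1) (+ 0) (+ 0) ∙ (η₃ m -1ℤ (+ 1) (+ 0) ∙ η₃ m -1ℤ (+ 1) (+ 0)))
      ≈⟨ ≈⇒≈[] (R.*-congˡ (R.trans (R.*-congˡ (η₃-∙ m _ _ _ _ _ _)) (η₃-∙ m _ _ _ _ _ _))) ⟩
    const (+ 2) ∙ η₃ m -1ℤ (+ 2) (+ 0) ∎
    where
    open ≈[]-Reasoning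
    open Solver
    ϕ0 : ϕ (+ 1) 0 ≈ const (+ 2)
    ϕ0 = R.trans (R.+-congˡ (R.*-congˡ qPow-0)) (solve 0 (con (+ 1) :+ con (+ 1) :* con (+ 1) := con (+ 2)) R.refl)

  -- Euler's pentagonal number theorem: in the triple product the two classes prime to 3 and the
  -- factor f_3m together give all factors of f_m.
  pentagonal : θ (3 ℕ.* m) m (2 ℕ.* m) -1ℤ ≈ f m
  pentagonal = ≈[]⇒≈ λ n → let N = suc n in begin
    θ (3 ℕ.* m) m (2 ℕ.* m) -1ℤ
      ≈⟨ θ-product _ _ _ _ 1≤3m refl refl n ⟩
    f (3 ℕ.* m) ∙ (∏ N (λ r → ϕ -1ℤ (m ℕ.+ 3 ℕ.* m ℕ.* r)) ∙ ∏ N (λ r → ϕ -1ℤ (2 ℕ.* m ℕ.+ 3 ℕ.* m ℕ.* r)))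
      ≈⟨ ∙-congʳ[] _ (f-Euler 1≤3m (ℕP.n≤1+n n)) ⟩
    Euler (3 ℕ.* m) N ∙ (∏ N (λ r → ϕ -1ℤ (m ℕ.+ 3 ℕ.* m ℕ.* r)) ∙ ∏ N (λ r → ϕ -1ℤ (2 ℕ.* m ℕ.+ 3 ℕ.* m ℕ.* r)))
      ≈⟨ ≈⇒≈[] (R.trans (R.*-comm _ _) (R.trans (R.*-congʳ (R.sym (∏-∙ N _ _))) (R.sym (∏-∙ N _ _)))) ⟩
    ∏ N (λ r → ϕ -1ℤ (m ℕ.+ 3 ℕ.* m ℕ.* r) ∙ ϕ -1ℤ (2 ℕ.* m ℕ.+ 3 ℕ.* m ℕ.* r) ∙ ϕ -1ℤ (3 ℕ.* m ℕ.* suc r))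
      ≈⟨ ≈⇒≈[] (∏-cong N λ r → R.sym (R.*-cong (R.*-cong (R.trans (R.*-identityˡ _)
           (ϕ-cong -1ℤ (S.solve 2 (λ m i → m S.:* (S.con 1 S.:+ (i S.:* S.con 3 S.:+ S.con 0)) S.:= m S.:+ S.con 3 S.:* m S.:* i) refl m r)))
           (ϕ-cong -1ℤ (S.solve 2 (λ m i → m S.:* (S.con 1 S.:+ (i S.:* S.con 3 S.:+ S.con 1)) S.:= S.con 2 S.:* m S.:+ S.con 3 S.:* m S.:* i) refl m r)))
           (ϕ-cong -1ℤ (S.solve 2 (λ m i → m S.:* (S.con 1 S.:+ (i S.:* S.con 3 S.:+ S.con 2)) S.:= S.con 3 S.:* m S.:* (S.con 1 S.:+ i)) refl m r)))) ⟩
    ∏ N (λ r → ∏ 3 (λ j → ϕ -1ℤ (m ℕ.* suc (r ℕ.* 3 ℕ.+ j))))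
      ≈⟨ ≈⇒≈[] (∏-* N 3 _) ⟨
    Euler m (N ℕ.* 3)
      ≈⟨ f-Euler 1≤m (ℕP.≤-trans (ℕP.n≤1+n n) (ℕP.m≤m*n N 3)) ⟨
    f m ∎
    where
    open ≈[]-Reasoning
    module S = ℕSolver.+-*-Solver
    1≤3m : 1 ≤ 3 ℕ.* m
    1≤3m = ℕP.≤-trans 1≤m (ℕP.m≤m+n m _)

opaque
  unfolding fPow η₃

  -- f₁ᵃ f₂ᵇ f₄ᶜ f₅ᵈ f₁₀ᵉ f₂₀ʰ
  η : ℤ → ℤ → ℤ → ℤ → ℤ → ℤ → PowerSeries
  η a b c d e h = η₃ 1 a b c ∙ η₃ 5 d e h

  η-∙ : ∀ a b c d e h a′ b′ c′ d′ e′ h′ →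
    η a b c d e h ∙ η a′ b′ c′ d′ e′ h′ ≈ η (a + a′) (b + b′) (c + c′) (d + d′) (e + e′) (h + h′)
  η-∙ a b c d e h a′ b′ c′ d′ e′ h′ = R.trans
    (solve 4 (λ x y x′ y′ → (x :* y) :* (x′ :* y′) := (x :* x′) :* (y :* y′)) R.refl _ _ _ _)
    (R.*-cong (η₃-∙ 1 a b c a′ b′ c′) (η₃-∙ 5 d e h d′ e′ h′))
    where open Solver

  η-divide : ∀ {n x} a b c d e h a′ b′ c′ d′ e′ h′ → x ∙ η a b c d e h ≈[ n ] η a′ b′ c′ d′ e′ h′ →
    x ≈[ n ] η (a′ - a) (b′ - b) (c′ - c) (d′ - d) (e′ - e) (h′ - h)
  η-divide {n} {x} a b c d e h a′ b′ c′ d′ e′ h′ p = begin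
    x
      ≈⟨ ≈⇒≈[] (R.*-identityʳ x) ⟨
    x ∙ 𝟏
      ≈⟨ ≈⇒≈[] (R.*-congˡ unit) ⟩
    x ∙ η (a - a) (b - b) (c - c) (d - d) (e - e) (h - h)
      ≈⟨ ≈⇒≈[] (R.*-congˡ (η-∙ a b c d e h (- a) (- b) (- c) (- d) (- e) (- h))) ⟨
    x ∙ (η a b c d e h ∙ η (- a) (- b) (- c) (- d) (- e) (- h))
      ≈⟨ ≈⇒≈[] (R.*-assoc _ _ _) ⟨
    x ∙ η a b c d e h ∙ η (- a) (- b) (- c) (- d) (- e) (- h)
      ≈⟨ ∙-congʳ[] _ p ⟩
    η a′ b′ c′ d′ e′ h′ ∙ η (- a) (- b) (- c) (- d) (- e) (- h)
      ≈⟨ ≈⇒≈[] (η-∙ a′ b′ c′ d′ e′ h′ (- a) (- b) (- c) (- d) (- e) (- h)) ⟩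
    η (a′ - a) (b′ - b) (c′ - c) (d′ - d) (e′ - e) (h′ - h) ∎
    where
    open ≈[]-Reasoning
    unit : 𝟏 ≈ η (a - a) (b - b) (c - c) (d - d) (e - e) (h - h)
    unit rewrite ℤP.+-inverseʳ a | ℤP.+-inverseʳ b | ℤP.+-inverseʳ c | ℤP.+-inverseʳ d | ℤP.+-inverseʳ e | ℤP.+-inverseʳ h =
      solve 0 (con (+ 1) := (con (+ 1) :* (con (+ 1) :* con (+ 1))) :* (con (+ 1) :* (con (+ 1) :* con (+ 1)))) R.refl
      where open Solver

  from₁ : ∀ {N x} a b c → x ≈[ N ] η₃ 1 a b c → x ≈[ N ] η a b c (+ 0) (+ 0) (+ 0)
  from₁ a b c p = ≈[]-trans p (≈⇒≈[] (R.sym (R.trans (R.*-congˡ (R.trans (R.*-identityˡ _) (R.*-identityˡ 𝟏))) (R.*-identityʳ _))))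

  from₅ : ∀ {N x} a b c → x ≈[ N ] η₃ 5 a b c → x ≈[ N ] η (+ 0) (+ 0) (+ 0) a b c
  from₅ a b c p = ≈[]-trans p (≈⇒≈[] (R.sym (R.trans (R.*-congʳ (R.trans (R.*-identityˡ _) (R.*-identityˡ 𝟏))) (R.*-identityˡ _))))

-- f(q,q⁴) f(q²,q³)
quintic-η : θ 5 1 4 (+ 1) ∙ θ 5 2 3 (+ 1) ≈ η -1ℤ (+ 1) (+ 0) (+ 3) -1ℤ (+ 0)
quintic-η = ≈[]⇒≈ λ n → let N = suc n ; P = λ a → ∏ N (λ r → ϕ (+ 1) (a ℕ.+ 5 ℕ.* r)) in
  ≈[]-trans (∙-cong[] (θ-product 5 1 4 (+ 1) 1≤ refl refl n) (θ-product 5 2 3 (+ 1) 1≤ refl refl n))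
  (≈[]-trans (≈⇒≈[] (solve 5 (λ f a b c d → f :* (a :* d) :* (f :* (b :* c)) := f :* f :* (((a :* b) :* c) :* d)) R.refl (f 5) (P 1) (P 2) (P 3) (P 4)))
  (≈[]-trans (∙-cong[] (∙-cong[] f5 f5) (η-divide (+ 0) (+ 0) (+ 0) -1ℤ (+ 1) (+ 0) -1ℤ (+ 1) (+ 0) (+ 0) (+ 0) (+ 0)
      (≈[]-trans (∙-congˡ[] _ (≈[]-sym (from₅ _ _ _ (full-η₃ 1≤ (ℕP.n≤1+n n)))))
        (≈[]-trans (≈⇒≈[] (regroup N)) (from₁ _ _ _ (full-η₃ 1≤ (ℕP.≤-trans (ℕP.n≤1+n n) (ℕP.m≤m*n N 5)))))))
    ) (≈⇒≈[] (R.trans (R.*-congʳ (η-∙ _ _ _ _ _ _ _ _ _ _ _ _)) (η-∙ _ _ _ _ _ _ _ _ _ _ _ _)))))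
  where
  open Solver
  module S = ℕSolver.+-*-Solver
  f5 : ∀ {n} → f 5 ≈[ n ] η (+ 0) (+ 0) (+ 0) (+ 1) (+ 0) (+ 0)
  f5 = from₅ _ _ _ (≈⇒≈[] (f₁-η₃ 5))
  -- Multiples of 5 complete the classes 1, 2, 3, 4 modulo 5 to all positive integers.
  regroup : ∀ N → let P = λ a → ∏ N (λ r → ϕ (+ 1) (a ℕ.+ 5 ℕ.* r)) in
    P 1 ∙ P 2 ∙ P 3 ∙ P 4 ∙ full (+ 1) 5 N ≈ full (+ 1) 1 (N ℕ.* 5)
  regroup N = R.trans
    (R.trans (R.*-congʳ (R.trans (R.*-congʳ (R.trans (R.*-congʳ (R.sym (∏-∙ N _ _))) (R.sym (∏-∙ N _ _)))) (R.sym (∏-∙ N _ _)))) (R.sym (∏-∙ N _ _)))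
    (R.sym (R.trans (∏-* N 5 _) (∏-cong N λ i → R.*-cong (R.*-cong (R.*-cong (R.*-cong (R.trans (R.*-identityˡ _)
      (ϕ-cong (+ 1) (eq i 0 1 refl))) (ϕ-cong (+ 1) (eq i 1 2 refl))) (ϕ-cong (+ 1) (eq i 2 3 refl))) (ϕ-cong (+ 1) (eq i 3 4 refl)))
      (ϕ-cong (+ 1) (trans (eq i 4 5 refl) (sym (ℕP.*-suc 5 i)))))))
    where
    eq : ∀ i r a → suc r ≡ a → 1 ℕ.* suc (i ℕ.* 5 ℕ.+ r) ≡ a ℕ.+ 5 ℕ.* i
    eq i r _ refl = S.solve 2 (λ i r → S.con 1 S.:* (S.con 1 S.:+ (i S.:* S.con 5 S.:+ r)) S.:= (S.con 1 S.:+ r) S.:+ S.con 5 S.:* i) refl i r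

-- f(-q,-q⁹) f(-q³,-q⁷)
decic-η : θ 10 1 9 -1ℤ ∙ θ 10 3 7 -1ℤ ≈ η (+ 1) -1ℤ (+ 0) -1ℤ (+ 3) (+ 0)
decic-η = ≈[]⇒≈ λ n → let N = suc n ; P = λ a → ∏ N (λ r → ϕ -1ℤ (a ℕ.+ 10 ℕ.* r)) in
  ≈[]-trans (∙-cong[] (θ-product 10 1 9 -1ℤ 1≤ refl refl n) (θ-product 10 3 7 -1ℤ 1≤ refl refl n))
  (≈[]-trans (≈⇒≈[] (solve 5 (λ f a b c d → f :* (a :* d) :* (f :* (b :* c)) := f :* f :* (((a :* b) :* c) :* d)) R.refl (f 10) (P 1) (P 3) (P 7) (P 9)))
  (≈[]-trans (∙-cong[] (∙-cong[] f10 f10) (η-divide (+ 0) (+ 0) (+ 0) (+ 1) -1ℤ (+ 0) (+ 1) -1ℤ (+ 0) (+ 0) (+ 0) (+ 0)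
      (≈[]-trans (∙-congˡ[] _ (≈[]-sym (from₅ _ _ _ (odd⁻-η₃ 1≤ (ℕP.n≤1+n n)))))
        (≈[]-trans (≈⇒≈[] (regroup N)) (from₁ _ _ _ (odd⁻-η₃ 1≤ (ℕP.≤-trans (ℕP.n≤1+n n) (ℕP.m≤m*n N 5)))))))
    ) (≈⇒≈[] (R.trans (R.*-congʳ (η-∙ _ _ _ _ _ _ _ _ _ _ _ _)) (η-∙ _ _ _ _ _ _ _ _ _ _ _ _)))))
  where
  open Solver
  module S = ℕSolver.+-*-Solver
  f10 : ∀ {n} → f 10 ≈[ n ] η (+ 0) (+ 0) (+ 0) (+ 0) (+ 1) (+ 0)
  f10 = from₅ _ _ _ (≈⇒≈[] (f₂-η₃ 5))
  -- Odd multiples of 5 complete the classes 1, 3, 7, 9 modulo 10 to all odd numbers.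
  regroup : ∀ N → let P = λ a → ∏ N (λ r → ϕ -1ℤ (a ℕ.+ 10 ℕ.* r)) in
    P 1 ∙ P 3 ∙ P 7 ∙ P 9 ∙ odd -1ℤ 5 N ≈ odd -1ℤ 1 (N ℕ.* 5)
  regroup N = R.trans
    (R.trans (R.*-congʳ (R.trans (R.*-congʳ (R.trans (R.*-congʳ (R.sym (∏-∙ N _ _))) (R.sym (∏-∙ N _ _)))) (R.sym (∏-∙ N _ _)))) (R.sym (∏-∙ N _ _)))
    (R.sym (R.trans (∏-* N 5 _) (∏-cong N λ i → R.trans (R.*-cong (R.*-cong (R.*-cong (R.*-cong (R.trans (R.*-identityˡ _)
      (ϕ-cong -1ℤ (eq i 0 1 refl))) (ϕ-cong -1ℤ (eq i 1 3 refl))) (ϕ-cong -1ℤ (eq i 2 5 refl))) (ϕ-cong -1ℤ (eq i 3 7 refl)))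
      (ϕ-cong -1ℤ (eq i 4 9 refl)))
      (solve 5 (λ a b c d e → a :* b :* c :* d :* e := a :* b :* d :* e :* c) R.refl _ _ _ _ _))))
    where
    eq : ∀ i r a → suc (2 ℕ.* r) ≡ a → 1 ℕ.+ 2 ℕ.* (i ℕ.* 5 ℕ.+ r) ≡ a ℕ.+ 10 ℕ.* i
    eq i r _ refl = S.solve 2 (λ i r → S.con 1 S.:+ S.con 2 S.:* (i S.:* S.con 5 S.:+ r) S.:= (S.con 1 S.:+ S.con 2 S.:* r) S.:+ S.con 10 S.:* i) refl i r

-- Changes of variables in binary theta series

module ℤS = ℤSolver.+-*-Solver

1^ : ∀ n → (+ 1) ℤ.^ n ≡ + 1
1^ = ℤP.^-zeroˡ

-- As s is its own inverse, the absolute value in the exponent does no harm: `χ` is a character of ℤ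
-- and depends on the parity only.
module Character (s : ℤ) (s*s≡1 : s * s ≡ + 1) where

  χ : ℤ → ℤ
  χ l = s ℤ.^ ℤ.∣ l ∣

  χ-suc : ∀ l → χ (l + + 1) ≡ s * χ l
  χ-suc (+ p) = cong (s ℤ.^_) (ℕP.+-comm p 1)
  χ-suc -[1+ zero ] = sym (trans (cong (s *_) (ℤP.*-identityʳ s)) s*s≡1)
  χ-suc -[1+ suc p ] = sym (trans (sym (ℤP.*-assoc s s _)) (trans (cong (_* s ℤ.^ suc p) s*s≡1) (ℤP.*-identityˡ _)))

  χ-+ⁿ : ∀ l n → χ (l + + n) ≡ χ l * χ (+ n)
  χ-+ⁿ l zero = trans (cong χ (ℤP.+-identityʳ l)) (sym (ℤP.*-identityʳ (χ l)))
  χ-+ⁿ l (suc n) = begin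
    χ (l + + suc n)           ≡⟨ cong (λ k → χ (l + + k)) (ℕP.+-comm 1 n) ⟩
    χ (l + (+ n + + 1))       ≡⟨ cong χ (ℤP.+-assoc l (+ n) (+ 1)) ⟨
    χ (l + + n + + 1)         ≡⟨ χ-suc (l + + n) ⟩
    s * χ (l + + n)           ≡⟨ cong (s *_) (χ-+ⁿ l n) ⟩
    s * (χ l * χ (+ n))       ≡⟨ ℤS.solve 3 (λ s x y → s ℤS.:* (x ℤS.:* y) ℤS.:= x ℤS.:* (s ℤS.:* y)) refl s (χ l) (χ (+ n)) ⟩
    χ l * χ (+ suc n)         ∎
    where open ≡-Reasoning

  χ-+ : ∀ x y → χ (x + y) ≡ χ x * χ y
  χ-+ x (+ n) = χ-+ⁿ x n
  χ-+ x -[1+ n ] = begin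
    χ z                             ≡⟨ ℤP.*-identityʳ (χ z) ⟨
    χ z * + 1                       ≡⟨ cong (χ z *_) (^-square {s} s*s≡1 (suc n)) ⟨
    χ z * (χ (+ suc n) * χ (+ suc n)) ≡⟨ ℤP.*-assoc (χ z) _ _ ⟨
    χ z * χ (+ suc n) * χ (+ suc n) ≡⟨ cong (_* χ (+ suc n)) (χ-+ⁿ z (suc n)) ⟨
    χ (z + + suc n) * χ (+ suc n)   ≡⟨ cong (λ w → χ w * χ (+ suc n))
                                         (ℤS.solve 2 (λ x y → (x ℤS.:- y) ℤS.:+ y ℤS.:= x) refl x (+ suc n)) ⟩
    χ x * χ (+ suc n)               ∎
    where
    open ≡-Reasoning
    z = x + -[1+ n ]

  χ-even : ∀ {x} y z → x ≡ y + (z + z) → χ x ≡ χ y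
  χ-even y z refl = trans (χ-+ y (z + z)) (trans (cong (χ y *_) (trans (χ-+ z z) (^-square {s} s*s≡1 ℤ.∣ z ∣))) (ℤP.*-identityʳ (χ y)))

  χ-even+1 : ∀ {x} y z → x ≡ y + + 1 + (z + z) → χ x ≡ s * χ y
  χ-even+1 y z eq = trans (χ-even (y + + 1) z eq) (χ-suc y)

open Character (+ 1) refl public using () renaming (χ to χ⁺)
open Character -1ℤ refl public using () renaming (χ to χ⁻; χ-+ to χ⁻-+; χ-even to χ⁻-even; χ-even+1 to χ⁻-even+1)

-- The determinant δ = ±1 is its own inverse.
affine : ∀ a b e c d g δ → δ * (a * d - b * c) ≡ + 1 → ℤ² ↔ ℤ²
affine a b e c d g δ det = mk↔ₛ′
  (λ (m , n) → a * m + b * n + e , c * m + d * n + g)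
  (λ (t , y) → δ * (d * (t - e) - b * (y - g)) , δ * (a * (y - g) - c * (t - e)))
  (λ (t , y) → cong₂ _,_
    (via t (solve 9 (λ a b e c d g δ t y → a :* (δ :* (d :* (t :- e) :- b :* (y :- g))) :+ b :* (δ :* (a :* (y :- g) :- c :* (t :- e))) :+ e
       := t :+ (δ :* (a :* d :- b :* c) :- con (+ 1)) :* (t :- e)) refl a b e c d g δ t y))
    (via y (solve 9 (λ a b e c d g δ t y → c :* (δ :* (d :* (t :- e) :- b :* (y :- g))) :+ d :* (δ :* (a :* (y :- g) :- c :* (t :- e))) :+ g
       := y :+ (δ :* (a :* d :- b :* c) :- con (+ 1)) :* (y :- g)) refl a b e c d g δ t y)))
  (λ (m , n) → cong₂ _,_
    (via m (solve 9 (λ a b e c d g δ m n → δ :* (d :* (a :* m :+ b :* n :+ e :- e) :- b :* (c :* m :+ d :* n :+ g :- g))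
       := m :+ (δ :* (a :* d :- b :* c) :- con (+ 1)) :* m) refl a b e c d g δ m n))
    (via n (solve 9 (λ a b e c d g δ m n → δ :* (a :* (c :* m :+ d :* n :+ g :- g) :- c :* (a :* m :+ b :* n :+ e :- e))
       := n :+ (δ :* (a :* d :- b :* c) :- con (+ 1)) :* n) refl a b e c d g δ m n)))
  where
  open ℤS
  via : ∀ {x} y {z} → x ≡ y + (δ * (a * d - b * c) - + 1) * z → x ≡ y
  via y {z} eq rewrite det = trans eq (ℤP.+-identityʳ y)

exponent₂ : ∀ {k a b k′ a′ b′} → a ℕ.+ b ≡ k → a′ ℕ.+ b′ ≡ k′ → ∀ d x y →
  + 2 * + (d ℕ.+ (exponent k a b x ℕ.+ exponent k′ a′ b′ y))
    ≡ + 2 * + d + ((+ k * (x * x) + (+ a - + b) * x) + (+ k′ * (y * y) + (+ a′ - + b′) * y))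
exponent₂ {k} {a} {b} {k′} {a′} {b′} p p′ d x y = begin
  + 2 * (+ d + (+ e + + e′))         ≡⟨ trans (ℤP.*-distribˡ-+ (+ 2) (+ d) (+ e + + e′)) (cong (_+_ (+ 2 * + d)) (ℤP.*-distribˡ-+ (+ 2) (+ e) (+ e′))) ⟩
  + 2 * + d + (+ 2 * + e + + 2 * + e′) ≡⟨ cong₂ (λ u v → + 2 * + d + (u + v)) (2*exponent k a b p x) (2*exponent k′ a′ b′ p′ y) ⟩
  _ ∎
  where
  open ≡-Reasoning
  e = exponent k a b x
  e′ = exponent k′ a′ b′ y

exponent₁ : ∀ {k a b} → a ℕ.+ b ≡ k → ∀ d x → + 2 * + (d ℕ.+ exponent k a b x) ≡ + 2 * + d + (+ k * (x * x) + (+ a - + b) * x)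
exponent₁ {k} {a} {b} p d x = trans (ℤP.*-distribˡ-+ (+ 2) (+ d) (+ exponent k a b x)) (cong (_+_ (+ 2 * + d)) (2*exponent k a b p x))

θ-generates₂ : ∀ {k a b s k′ a′ b′ s′} → 1 ≤ k → 1 ≤ k′ →
  Generates {ℤ²} (λ (x , y) → s ℤ.^ ℤ.∣ x ∣ * s′ ℤ.^ ℤ.∣ y ∣) (λ (x , y) → 0 ℕ.+ (exponent k a b x ℕ.+ exponent k′ a′ b′ y))
    (θ k a b s ∙ θ k′ a′ b′ s′)
θ-generates₂ {k} {a} {b} {s} {k′} {a′} {b′} {s′} 1≤k 1≤k′ = generates-∙ (θ-generates k a b s 1≤k) (θ-generates k′ a′ b′ s′ 1≤k′)

χ⁺-χ⁺ : ∀ x y → + 1 ≡ (+ 1) ℤ.^ ℤ.∣ x ∣ * (+ 1) ℤ.^ ℤ.∣ y ∣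
χ⁺-χ⁺ x y = sym (cong₂ _*_ (1^ ℤ.∣ x ∣) (1^ ℤ.∣ y ∣))

module _ {m : ℕ} (1≤m : 1 ≤ m) where
  private
    M = + m
    1≤2m = 1≤m+m 1≤m
    1≤4m = 1≤m+m 1≤2m
    1≤8m = 1≤m+m 1≤4m
    m₄ = m ℕ.+ m ℕ.+ (m ℕ.+ m)
  open ℤS

  -- Even l give φ(q^(4m)). For l = 2t + 1 one has m l² = m + 4m t(t+1), and the sum over all
  -- integers t is twice ψ(q^(8m)).
  φ-dissection : ∀ s → s * s ≡ + 1 → φ s m ≈ φ (+ 1) m₄ ⊕ sq s m ∙ ψ₂ (m₄ ℕ.+ m₄)
  φ-dissection s s*s≡1 = R.trans
    (compare χ (λ l → (+ 2 * M) * (l * l)) (↔-id ℤ) (residue↔ 2)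
      (λ l → refl) (λ l → trans (solve 2 (λ M l → con (+ 2) :* M :* (l :* l) := (M :+ M) :* (l :* l) :+ (M :- M) :* l) refl M l) (sym (2*exponent (m ℕ.+ m) m m refl l)))
      (λ { (zero , t) → trans (χ-even (+ 0) t (solve 1 (λ t → con (+ 2) :* t :+ con (+ 0) := con (+ 0) :+ (t :+ t)) refl t)) (sym (1^ ℤ.∣ t ∣))
         ; (suc zero , t) → trans (χ-even+1 (+ 0) t (solve 1 (λ t → con (+ 2) :* t :+ con (+ 1) := con (+ 0) :+ con (+ 1) :+ (t :+ t)) refl t)) (cong (s *_) (sym (1^ ℤ.∣ t ∣))) })
      (λ { (zero , t) → trans (solve 2 (λ M t → con (+ 2) :* M :* ((con (+ 2) :* t :+ con (+ 0)) :* (con (+ 2) :* t :+ con (+ 0)))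
                := let M₄ = M :+ M :+ (M :+ M) in (M₄ :+ M₄) :* (t :* t) :+ (M₄ :- M₄) :* t) refl M t) (sym (2*exponent (m₄ ℕ.+ m₄) m₄ m₄ refl t))
         ; (suc zero , t) → trans (solve 2 (λ M t → con (+ 2) :* M :* ((con (+ 2) :* t :+ con (+ 1)) :* (con (+ 2) :* t :+ con (+ 1)))
                := let M₄ = M :+ M :+ (M :+ M) in con (+ 2) :* M :+ ((M₄ :+ M₄) :* (t :* t) :+ (M₄ :+ M₄ :- con (+ 0)) :* t)) refl M t)
                (sym (exponent₁ (ℕP.+-identityʳ (m₄ ℕ.+ m₄)) m t)) })
      (θ-generates (m ℕ.+ m) m m s 1≤2m)
      (generates-Fin 2 {c} {e} {X} λ { zero → θ-generates (m₄ ℕ.+ m₄) m₄ m₄ (+ 1) 1≤8m ; (suc zero) → generates-sq s m (θ-generates (m₄ ℕ.+ m₄) (m₄ ℕ.+ m₄) 0 (+ 1) 1≤8m) }))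
    (R.+-congˡ (R.+-identityʳ _))
    where
    open Character s s*s≡1
    c : Fin 2 → ℤ → ℤ
    c zero t = (+ 1) ℤ.^ ℤ.∣ t ∣
    c (suc zero) t = s * (+ 1) ℤ.^ ℤ.∣ t ∣
    e : Fin 2 → ℤ → ℕ
    e zero t = exponent (m₄ ℕ.+ m₄) m₄ m₄ t
    e (suc zero) t = m ℕ.+ exponent (m₄ ℕ.+ m₄) (m₄ ℕ.+ m₄) 0 t
    X : Fin 2 → PowerSeries
    X zero = φ (+ 1) m₄
    X (suc zero) = sq s m ∙ ψ₂ (m₄ ℕ.+ m₄)

module _ {m : ℕ} (1≤m : 1 ≤ m) where
  private
    M = + m
    1≤2m = 1≤m+m 1≤m
    1≤4m = 1≤m+m 1≤2m
    m₂ = m ℕ.+ m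
    m₄ = m₂ ℕ.+ m₂

  -- Rotation by 45°, (x , y) ↦ (x + y , x - y).
  φ²-dissection : φ -1ℤ m ∙ φ -1ℤ m ≈ φ (+ 1) m₂ ∙ φ (+ 1) m₂ ⊕ sq -1ℤ m ∙ (ψ₂ m₄ ∙ ψ₂ m₄)
  φ²-dissection = R.trans
    (compare (λ (S , x) → χ⁻ S) (λ (S , x) → + 2 * M * (x * x + (S - x) * (S - x)))
      (affine (+ 1) (+ 1) (+ 0) (+ 1) (+ 0) (+ 0) -1ℤ refl)
      (dissection 2 ρ)
      (λ (x , y) → trans (χ⁻-even (x + y) (+ 0) (solve 2 (λ x y → con (+ 1) :* x :+ con (+ 1) :* y :+ con (+ 0) := x :+ y :+ (con (+ 0) :+ con (+ 0))) refl x y)) (χ⁻-+ x y))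
      (λ (x , y) → trans (solve 3 (λ M x y →
          let S = con (+ 1) :* x :+ con (+ 1) :* y :+ con (+ 0)
              X = con (+ 1) :* x :+ con (+ 0) :* y :+ con (+ 0) in
          con (+ 2) :* M :* (X :* X :+ (S :- X) :* (S :- X))
          := con (+ 0) :+ (((M :+ M) :* (x :* x) :+ (M :- M) :* x) :+ ((M :+ M) :* (y :* y) :+ (M :- M) :* y))) refl M x y)
        (sym (exponent₂ {m₂} {m} {m} refl refl 0 x y)))
      (λ { (zero , u , v) → trans (χ⁻-even (+ 0) u (solve 2 (λ u v → con (+ 2) :* (con (+ 1) :* u :+ con (+ 0) :* v :+ con (+ 0)) :+ con (+ 0) := con (+ 0) :+ (u :+ u)) refl u v)) (χ⁺-χ⁺ u v)
         ; (suc zero , u , v) → trans (χ⁻-even+1 (+ 0) u (solve 2 (λ u v → con (+ 2) :* (con (+ 1) :* u :+ con (+ 0) :* v :+ con (+ 0)) :+ con (+ 1) := con (+ 0) :+ con (+ 1) :+ (u :+ u)) refl u v)) (cong (-1ℤ *_) (χ⁺-χ⁺ u v)) })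
      (λ { (zero , u , v) → trans (solve 3 (λ M u v →
              let S = con (+ 2) :* (con (+ 1) :* u :+ con (+ 0) :* v :+ con (+ 0)) :+ con (+ 0)
                  X = con (+ 1) :* u :+ con (+ 1) :* v :+ con (+ 0)
                  M₂ = M :+ M in
              con (+ 2) :* M :* (X :* X :+ (S :- X) :* (S :- X))
              := con (+ 0) :+ (((M₂ :+ M₂) :* (u :* u) :+ (M₂ :- M₂) :* u) :+ ((M₂ :+ M₂) :* (v :* v) :+ (M₂ :- M₂) :* v))) refl M u v)
            (sym (exponent₂ {m₄} {m₂} {m₂} refl refl 0 u v))
         ; (suc zero , u , v) → trans (solve 3 (λ M u v →
              let S = con (+ 2) :* (con (+ 1) :* u :+ con (+ 0) :* v :+ con (+ 0)) :+ con (+ 1)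
                  X = con (+ 1) :* u :+ con (+ 1) :* v :+ con (+ 1)
                  M₄ = (M :+ M) :+ (M :+ M) in
              con (+ 2) :* M :* (X :* X :+ (S :- X) :* (S :- X))
              := con (+ 2) :* M :+ ((M₄ :* (u :* u) :+ (M₄ :- con (+ 0)) :* u) :+ (M₄ :* (v :* v) :+ (M₄ :- con (+ 0)) :* v))) refl M u v)
            (sym (exponent₂ {m₄} {m₄} {0} {m₄} {m₄} {0} (ℕP.+-identityʳ m₄) (ℕP.+-identityʳ m₄) m u v)) })
      (θ-generates₂ {m₂} {m} {m} { -1ℤ} {m₂} {m} {m} { -1ℤ} 1≤2m 1≤2m)
      (generates-Fin 2 {c} {e} {X} λ
        { zero → θ-generates₂ {m₄} {m₂} {m₂} {+ 1} {m₄} {m₂} {m₂} {+ 1} 1≤4m 1≤4m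
        ; (suc zero) → generates-sq -1ℤ m (θ-generates₂ {m₄} {m₄} {0} {+ 1} {m₄} {m₄} {0} {+ 1} 1≤4m 1≤4m) }))
    (R.+-congˡ (R.+-identityʳ _))
    where
    open ℤS
    ρ : Fin 2 → ℤ² ↔ ℤ²
    -- Here S = x + y. For S = 2u put x = u + v; for S = 2u + 1 put x = u + v + 1.
    ρ zero = affine (+ 1) (+ 0) (+ 0) (+ 1) (+ 1) (+ 0) (+ 1) refl
    ρ (suc zero) = affine (+ 1) (+ 0) (+ 0) (+ 1) (+ 1) (+ 1) (+ 1) refl
    c : Fin 2 → ℤ² → ℤ
    c zero (u , v) = χ⁺ u * χ⁺ v
    c (suc zero) (u , v) = -1ℤ * (χ⁺ u * χ⁺ v)
    e : Fin 2 → ℤ² → ℕ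
    e zero (u , v) = 0 ℕ.+ (exponent m₄ m₂ m₂ u ℕ.+ exponent m₄ m₂ m₂ v)
    e (suc zero) (u , v) = m ℕ.+ (0 ℕ.+ (exponent m₄ m₄ 0 u ℕ.+ exponent m₄ m₄ 0 v))
    X : Fin 2 → PowerSeries
    X zero = φ (+ 1) m₂ ∙ φ (+ 1) m₂
    X (suc zero) = sq -1ℤ m ∙ (ψ₂ m₄ ∙ ψ₂ m₄)

lin : ∀ {k} → ℤ → ℤ → ℤ → ℤS.Polynomial k → ℤS.Polynomial k → ℤS.Polynomial k
lin a b e m n = con a :* m :+ con b :* n :+ con e
  where open ℤS

-- The product contains 1 - q⁰; in the sum, l and -1-l have equal exponents and opposite signs.
alternating-vanishes : ∀ {k} → 1 ≤ k → θ k k 0 -1ℤ ≈ 𝟎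
alternating-vanishes {k} 1≤k = ≈[]⇒≈ λ n → ≈[]-trans (θ-product k k 0 -1ℤ 1≤k (ℕP.+-identityʳ k) refl n)
  (≈⇒≈[] (R.trans (R.*-congˡ (R.*-congˡ (R.trans (∏-front n _) (R.*-congʳ ϕ0))))
    (solve 3 (λ a b c → a :* (b :* (con (+ 0) :* c)) := con (+ 0)) R.refl _ _ _)))
  where
  open Solver
  ϕ0 : ϕ -1ℤ (0 ℕ.+ k ℕ.* 0) ≈ 𝟎
  ϕ0 = R.trans (ϕ-cong -1ℤ (ℕP.*-zeroʳ k)) (R.trans (R.+-congˡ (R.*-congˡ qPow-0))
    (solve 0 (con (+ 1) :+ con -1ℤ :* con (+ 1) := con (+ 0)) R.refl))

-- In terms of X = 2x + 1 and Y = 2y + 1, the points with X + iY divisible by 2 + i contribute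
-- qψ(q⁵)², and multiplication by i permutes the four other residue classes.
ψ₂²-dissection : ψ₂ 1 ∙ ψ₂ 1 ≈ sq (+ 1) 1 ∙ (ψ₂ 5 ∙ ψ₂ 5) ⊕ const (+ 4) ∙ (θ 5 1 4 (+ 1) ∙ θ 5 2 3 (+ 1))
ψ₂²-dissection = R.trans
  (compare (λ _ → + 1) (λ (S , y) → let x = S - + 3 * y in x * x + x + (y * y + y))
    -- Modulo 2 + i one has i ≡ -2 ≡ 3, so S = x + 3y is the class of x + iy modulo 5.
    (affine (+ 1) (+ 3) (+ 0) (+ 0) (+ 1) (+ 0) (+ 1) refl)
    (dissection 5 ρ)
    (λ (x , y) → χ⁺-χ⁺ x y)
    (λ (x , y) → trans (solve 2 (λ x y → P̂ (lin (+ 1) (+ 3) (+ 0) x y) (lin (+ 0) (+ 1) (+ 0) x y)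
        := con (+ 0) :+ ((con (+ 1) :* (x :* x) :+ con (+ 1) :* x) :+ (con (+ 1) :* (y :* y) :+ con (+ 1) :* y))) refl x y)
      (sym (exponent₂ {1} {1} {0} {1} {1} {0} refl refl 0 x y)))
    c-match
    (λ { (zero , m , n) → trans (solve 2 (λ m n → P̂ (con (+ 5) :* (lin (- + 1) (- + 1) (+ 0) m n) :+ con (+ 0)) (lin (- + 1) (- + 2) (+ 0) m n) := off m n) refl m n)
         (sym (exponent₂ {5} {1} {4} {5} {2} {3} refl refl 0 m n))
     ; ((suc zero) , m , n) → trans (solve 2 (λ m n → P̂ (con (+ 5) :* (lin (+ 1) (+ 1) (- + 1) m n) :+ con (+ 1)) (lin (+ 1) (+ 2) (- + 1) m n) := off m n) refl m n)
         (sym (exponent₂ {5} {1} {4} {5} {2} {3} refl refl 0 m n))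
     ; ((suc (suc zero)) , m , n) → trans (solve 2 (λ m n → P̂ (con (+ 5) :* (lin (+ 1) (- + 1) (- + 1) m n) :+ con (+ 2)) (lin (+ 2) (- + 1) (- + 1) m n) := off m n) refl m n)
         (sym (exponent₂ {5} {1} {4} {5} {2} {3} refl refl 0 m n))
     ; ((suc (suc (suc zero))) , m , n) → trans (solve 2 (λ m n → P̂ (con (+ 5) :* (lin (+ 1) (+ 1) (+ 0) m n) :+ con (+ 3)) (lin (+ 1) (+ 2) (+ 1) m n) := diag m n) refl m n)
         (sym (exponent₂ {5} {5} {0} {5} {5} {0} refl refl 1 m n))
     ; ((suc (suc (suc (suc zero)))) , m , n) → trans (solve 2 (λ m n → P̂ (con (+ 5) :* (lin (- + 1) (+ 1) (- + 1) m n) :+ con (+ 4)) (lin (- + 2) (+ 1) (+ 0) m n) := off m n) refl m n)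
         (sym (exponent₂ {5} {1} {4} {5} {2} {3} refl refl 0 m n)) })
    (θ-generates₂ {1} {1} {0} {+ 1} {1} {1} {0} {+ 1} 1≤ 1≤)
    (generates-Fin 5 {c} {e} {X} gen))
  (collect
    (θ 5 1 4 (+ 1) ∙ θ 5 2 3 (+ 1)) (sq (+ 1) 1 ∙ (ψ₂ 5 ∙ ψ₂ 5)))
  where
  collect : ∀ p d → p ⊕ (p ⊕ (p ⊕ (d ⊕ (p ⊕ 𝟎)))) ≈ d ⊕ const (+ 4) ∙ p
  collect = solve 2 (λ p d → p :+ (p :+ (p :+ (d :+ (p :+ con (+ 0))))) := d :+ con (+ 4) :* p) R.refl
    where open Solver
  open ℤS
  P̂ : ∀ {k} → Polynomial k → Polynomial k → Polynomial k
  P̂ S y = let x = S :- con (+ 3) :* y in x :* x :+ x :+ (y :* y :+ y)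
  diag off : ∀ {k} → Polynomial k → Polynomial k → Polynomial k
  diag m n = con (+ 2) :* con (+ 1) :+ ((con (+ 5) :* (m :* m) :+ con (+ 5) :* m) :+ (con (+ 5) :* (n :* n) :+ con (+ 5) :* n))
  off m n = con (+ 0) :+ ((con (+ 5) :* (m :* m) :+ con (- + 3) :* m) :+ (con (+ 5) :* (n :* n) :+ con (- + 1) :* n))
  ρ : Fin 5 → ℤ² ↔ ℤ²
  -- In each class x + iy is a unit times (2 + i)(m + in) plus a constant, which turns x² + y² into
  -- 5(m² + n²) plus linear terms. Unit and constant are chosen so that the four other classes all
  -- get the linear part -3m - n.
  ρ zero = affine (- + 1) (- + 1) (+ 0) (- + 1) (- + 2) (+ 0) (+ 1) refl
  ρ (suc zero) = affine (+ 1) (+ 1) (- + 1) (+ 1) (+ 2) (- + 1) (+ 1) refl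
  ρ (suc (suc zero)) = affine (+ 1) (- + 1) (- + 1) (+ 2) (- + 1) (- + 1) (+ 1) refl
  ρ (suc (suc (suc zero))) = affine (+ 1) (+ 1) (+ 0) (+ 1) (+ 2) (+ 1) (+ 1) refl
  ρ (suc (suc (suc (suc zero)))) = affine (- + 1) (+ 1) (- + 1) (- + 2) (+ 1) (+ 0) (+ 1) refl
  -- X + 3Y = 2(S + 2), so 2 + i divides X + iY exactly when S ≡ 3 modulo 5.
  diagonal : Fin 5 → Bool
  diagonal (suc (suc (suc zero))) = true
  diagonal _ = false
  c : Fin 5 → ℤ² → ℤ
  c r (m , n) = if diagonal r then + 1 * (χ⁺ m * χ⁺ n) else χ⁺ m * χ⁺ n
  e : Fin 5 → ℤ² → ℕ
  e r (m , n) = if diagonal r then 1 ℕ.+ (0 ℕ.+ (exponent 5 5 0 m ℕ.+ exponent 5 5 0 n)) else 0 ℕ.+ (exponent 5 1 4 m ℕ.+ exponent 5 2 3 n)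
  X : Fin 5 → PowerSeries
  X r = if diagonal r then sq (+ 1) 1 ∙ (ψ₂ 5 ∙ ψ₂ 5) else θ 5 1 4 (+ 1) ∙ θ 5 2 3 (+ 1)
  c-match : ∀ p → + 1 ≡ uncurry c p
  c-match (r , m , n) with diagonal r
  ... | true = trans (χ⁺-χ⁺ m n) (sym (ℤP.*-identityˡ _))
  ... | false = χ⁺-χ⁺ m n
  gen : ∀ r → Generates (c r) (e r) (X r)
  gen r with diagonal r
  ... | true = generates-sq (+ 1) 1 (θ-generates₂ {5} {5} {0} {+ 1} {5} {5} {0} {+ 1} 1≤ 1≤)
  ... | false = θ-generates₂ {5} {1} {4} {+ 1} {5} {2} {3} {+ 1} 1≤ 1≤

-- The same for x + iy: the multiples of 2 + i contribute φ(-q⁵)².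
φ²-quintic : φ -1ℤ 1 ∙ φ -1ℤ 1 ≈ φ -1ℤ 5 ∙ φ -1ℤ 5 ⊕ const (+ 4) ∙ (sq -1ℤ 1 ∙ (θ 10 1 9 -1ℤ ∙ θ 10 3 7 -1ℤ))
φ²-quintic = R.trans
  (compare (λ (S , y) → χ⁻ S) (λ (S , y) → let x = S - + 3 * y in + 2 * (x * x + y * y))
    (affine (+ 1) (+ 3) (+ 0) (+ 0) (+ 1) (+ 0) (+ 1) refl)
    (dissection 5 ρ)
    (λ (x , y) → trans (χ⁻-even (x + y) y (solve 2 (λ x y → lin (+ 1) (+ 3) (+ 0) x y := x :+ y :+ (y :+ y)) refl x y)) (χ⁻-+ x y))
    (λ (x , y) → trans (solve 2 (λ x y → P̂ (lin (+ 1) (+ 3) (+ 0) x y) (lin (+ 0) (+ 1) (+ 0) x y)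
        := con (+ 0) :+ ((con (+ 2) :* (x :* x) :+ con (+ 0) :* x) :+ (con (+ 2) :* (y :* y) :+ con (+ 0) :* y))) refl x y)
      (sym (exponent₂ {2} {1} {1} {2} {1} {1} refl refl 0 x y)))
    (λ { (zero , m , n) → trans (χ⁻-even (m + n) ((+ 2) * m + (+ 2) * n + (+ 0)) (solve 2 (λ m n → con (+ 5) :* (lin (+ 1) (+ 1) (+ 0) m n) :+ con (+ 0) := m :+ n :+ ((lin (+ 2) (+ 2) (+ 0) m n) :+ (lin (+ 2) (+ 2) (+ 0) m n))) refl m n)) (χ⁻-+ m n)
       ; ((suc zero) , m , n) → trans (χ⁻-even+1 (m + n) ((- + 3) * m + (+ 2) * n + (+ 0)) (solve 2 (λ m n → con (+ 5) :* (lin (- + 1) (+ 1) (+ 0) m n) :+ con (+ 1) := m :+ n :+ con (+ 1) :+ ((lin (- + 3) (+ 2) (+ 0) m n) :+ (lin (- + 3) (+ 2) (+ 0) m n))) refl m n)) (cong (-1ℤ *_) (χ⁻-+ m n))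
       ; ((suc (suc zero)) , m , n) → trans (χ⁻-even+1 (m + n) ((+ 2) * m + (+ 2) * n + (- + 2)) (solve 2 (λ m n → con (+ 5) :* (lin (+ 1) (+ 1) (- + 1) m n) :+ con (+ 2) := m :+ n :+ con (+ 1) :+ ((lin (+ 2) (+ 2) (- + 2) m n) :+ (lin (+ 2) (+ 2) (- + 2) m n))) refl m n)) (cong (-1ℤ *_) (χ⁻-+ m n))
       ; ((suc (suc (suc zero))) , m , n) → trans (χ⁻-even+1 (m + n) ((- + 3) * m + (- + 3) * n + (+ 1)) (solve 2 (λ m n → con (+ 5) :* (lin (- + 1) (- + 1) (+ 0) m n) :+ con (+ 3) := m :+ n :+ con (+ 1) :+ ((lin (- + 3) (- + 3) (+ 1) m n) :+ (lin (- + 3) (- + 3) (+ 1) m n))) refl m n)) (cong (-1ℤ *_) (χ⁻-+ m n))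
       ; ((suc (suc (suc (suc zero)))) , m , n) → trans (χ⁻-even+1 (m + n) ((+ 2) * m + (- + 3) * n + (- + 1)) (solve 2 (λ m n → con (+ 5) :* (lin (+ 1) (- + 1) (- + 1) m n) :+ con (+ 4) := m :+ n :+ con (+ 1) :+ ((lin (+ 2) (- + 3) (- + 1) m n) :+ (lin (+ 2) (- + 3) (- + 1) m n))) refl m n)) (cong (-1ℤ *_) (χ⁻-+ m n)) })
    (λ { (zero , m , n) → trans (solve 2 (λ m n → P̂ (con (+ 5) :* (lin (+ 1) (+ 1) (+ 0) m n) :+ con (+ 0)) (lin (+ 1) (+ 2) (+ 0) m n) := diag m n) refl m n)
         (sym (exponent₂ {10} {5} {5} {10} {5} {5} refl refl 0 m n))
     ; ((suc zero) , m , n) → trans (solve 2 (λ m n → P̂ (con (+ 5) :* (lin (- + 1) (+ 1) (+ 0) m n) :+ con (+ 1)) (lin (- + 1) (+ 2) (+ 0) m n) := off m n) refl m n)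
         (sym (exponent₂ {10} {1} {9} {10} {3} {7} refl refl 1 m n))
     ; ((suc (suc zero)) , m , n) → trans (solve 2 (λ m n → P̂ (con (+ 5) :* (lin (+ 1) (+ 1) (- + 1) m n) :+ con (+ 2)) (lin (+ 2) (+ 1) (- + 1) m n) := off m n) refl m n)
         (sym (exponent₂ {10} {1} {9} {10} {3} {7} refl refl 1 m n))
     ; ((suc (suc (suc zero))) , m , n) → trans (solve 2 (λ m n → P̂ (con (+ 5) :* (lin (- + 1) (- + 1) (+ 0) m n) :+ con (+ 3)) (lin (- + 2) (- + 1) (+ 1) m n) := off m n) refl m n)
         (sym (exponent₂ {10} {1} {9} {10} {3} {7} refl refl 1 m n))
     ; ((suc (suc (suc (suc zero)))) , m , n) → trans (solve 2 (λ m n → P̂ (con (+ 5) :* (lin (+ 1) (- + 1) (- + 1) m n) :+ con (+ 4)) (lin (+ 1) (- + 2) (+ 0) m n) := off m n) refl m n)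
         (sym (exponent₂ {10} {1} {9} {10} {3} {7} refl refl 1 m n)) })
    (θ-generates₂ {2} {1} {1} { -1ℤ} {2} {1} {1} { -1ℤ} 1≤ 1≤)
    (generates-Fin 5 {c} {e} {X} gen))
  (collect
    (sq -1ℤ 1 ∙ (θ 10 1 9 -1ℤ ∙ θ 10 3 7 -1ℤ)) (φ -1ℤ 5 ∙ φ -1ℤ 5))
  where
  collect : ∀ p d → d ⊕ (p ⊕ (p ⊕ (p ⊕ (p ⊕ 𝟎)))) ≈ d ⊕ const (+ 4) ∙ p
  collect = solve 2 (λ p d → d :+ (p :+ (p :+ (p :+ (p :+ con (+ 0))))) := d :+ con (+ 4) :* p) R.refl
    where open Solver
  open ℤS
  P̂ : ∀ {k} → Polynomial k → Polynomial k → Polynomial k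
  P̂ S y = let x = S :- con (+ 3) :* y in con (+ 2) :* (x :* x :+ y :* y)
  diag off : ∀ {k} → Polynomial k → Polynomial k → Polynomial k
  diag m n = con (+ 0) :+ ((con (+ 10) :* (m :* m) :+ con (+ 0) :* m) :+ (con (+ 10) :* (n :* n) :+ con (+ 0) :* n))
  off m n = con (+ 2) :* con (+ 1) :+ ((con (+ 10) :* (m :* m) :+ con (- + 8) :* m) :+ (con (+ 10) :* (n :* n) :+ con (- + 4) :* n))
  ρ : Fin 5 → ℤ² ↔ ℤ²
  -- Again the columns are orthogonal vectors of norm 5 in x and y. Determinant -1 means m - in in
  -- place of m + in; it gives the four nonzero classes the common linear part -8m - 4n.
  ρ zero = affine (+ 1) (+ 1) (+ 0) (+ 1) (+ 2) (+ 0) (+ 1) refl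
  ρ (suc zero) = affine (- + 1) (+ 1) (+ 0) (- + 1) (+ 2) (+ 0) (- + 1) refl
  ρ (suc (suc zero)) = affine (+ 1) (+ 1) (- + 1) (+ 2) (+ 1) (- + 1) (- + 1) refl
  ρ (suc (suc (suc zero))) = affine (- + 1) (- + 1) (+ 0) (- + 2) (- + 1) (+ 1) (- + 1) refl
  ρ (suc (suc (suc (suc zero)))) = affine (+ 1) (- + 1) (- + 1) (+ 1) (- + 2) (+ 0) (- + 1) refl
  c : Fin 5 → ℤ² → ℤ
  c zero (m , n) = χ⁻ m * χ⁻ n
  c (suc _) (m , n) = -1ℤ * (χ⁻ m * χ⁻ n)
  e : Fin 5 → ℤ² → ℕ
  e zero (m , n) = 0 ℕ.+ (exponent 10 5 5 m ℕ.+ exponent 10 5 5 n)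
  e (suc _) (m , n) = 1 ℕ.+ (0 ℕ.+ (exponent 10 1 9 m ℕ.+ exponent 10 3 7 n))
  X : Fin 5 → PowerSeries
  X zero = φ -1ℤ 5 ∙ φ -1ℤ 5
  X (suc _) = sq -1ℤ 1 ∙ (θ 10 1 9 -1ℤ ∙ θ 10 3 7 -1ℤ)
  gen : ∀ r → Generates (c r) (e r) (X r)
  gen zero = θ-generates₂ {10} {5} {5} { -1ℤ} {10} {5} {5} { -1ℤ} 1≤ 1≤
  gen (suc _) = generates-sq -1ℤ 1 (θ-generates₂ {10} {1} {9} { -1ℤ} {10} {3} {7} { -1ℤ} 1≤ 1≤)

-- With u = 2w + 1 - v both sides enumerate 4N + 1 = u² + 5v². In ℤ[√-5], multiplying u + v√-5 by 1 + √-5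
-- gives s + t√-5 with t = 2w + 1 and s ≡ t mod 6, and the class t ≡ 3 mod 6 cancels.
f₁f₅-dissection : φ (+ 1) 5 ∙ ψ₂ 2 ⊕ sq -1ℤ 1 ∙ (φ (+ 1) 1 ∙ ψ₂ 10) ≈ const (+ 2) ∙ (f 1 ∙ f 5)
f₁f₅-dissection = begin
  φ (+ 1) 5 ∙ ψ₂ 2 ⊕ sq -1ℤ 1 ∙ (φ (+ 1) 1 ∙ ψ₂ 10)
    ≈⟨ R.+-congˡ (R.+-identityʳ _) ⟨
  ∑Fin 2 X
    -- The polynomial is (u² + 5v² - 1)/2. The first side splits by v modulo 2, which accounts for
    -- its sign; the second splits by w modulo 3, where t ≡ 3 mod 6 is the class w ≡ 1.
    ≈⟨ compare (λ (v , w) → χ⁻ v) (λ (v , w) → + 2 * (w * w) + + 2 * w - + 2 * (v * w) + (+ 3 * (v * v) - v))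
         (dissection 2 ρ) (affine (+ 0) (+ 1) (+ 0) (+ 1) (+ 0) (+ 0) -1ℤ refl ↔-∘ dissection 3 ρ′)
         (λ { (zero , x , y) → trans (χ⁻-even (+ 0) x (solve 2 (λ x y → con (+ 2) :* lin (+ 1) (+ 0) (+ 0) x y :+ con (+ 0) := con (+ 0) :+ (x :+ x)) refl x y)) (χ⁺-χ⁺ x y)
            ; (suc zero , x , y) → trans (χ⁻-even+1 (+ 0) y (solve 2 (λ x y → con (+ 2) :* lin (+ 0) (+ 1) (+ 0) x y :+ con (+ 1) := con (+ 0) :+ con (+ 1) :+ (y :+ y)) refl x y)) (cong (-1ℤ *_) (χ⁺-χ⁺ x y)) })
         (λ { (zero , x , y) → trans (solve 2 (λ x y → P̂ (con (+ 2) :* lin (+ 1) (+ 0) (+ 0) x y :+ con (+ 0)) (lin (+ 1) (+ 1) (+ 0) x y)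
                := con (+ 0) :+ ((con (+ 10) :* (x :* x) :+ con (+ 0) :* x) :+ (con (+ 2) :* (y :* y) :+ con (+ 2) :* y))) refl x y)
              (sym (exponent₂ {10} {5} {5} {2} {2} {0} refl refl 0 x y))
            ; (suc zero , x , y) → trans (solve 2 (λ x y → P̂ (con (+ 2) :* lin (+ 0) (+ 1) (+ 0) x y :+ con (+ 1)) (lin (+ 1) (+ 1) (+ 0) x y)
                := con (+ 2) :* con (+ 1) :+ ((con (+ 2) :* (x :* x) :+ con (+ 0) :* x) :+ (con (+ 10) :* (y :* y) :+ con (+ 10) :* y))) refl x y)
              (sym (exponent₂ {2} {1} {1} {10} {10} {0} refl refl 1 x y)) })
         (λ { (zero , m , n) → trans (χ⁻-even (m + n) (- n) (solve 2 (λ m n → swapped (lin (+ 0) (- + 1) (+ 0) m n) (lin (+ 1) (- + 1) (+ 0) m n) (+ 0) := m :+ n :+ ((:- n) :+ (:- n))) refl m n)) (χ⁻-+ m n)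
            ; (suc zero , m , n) → trans (χ⁻-even (m + n) (- m) (solve 2 (λ m n → swapped (lin (+ 0) (+ 1) (+ 0) m n) (lin (- + 1) (+ 1) (+ 0) m n) (+ 1) := m :+ n :+ ((:- m) :+ (:- m))) refl m n)) (trans (χ⁻-+ m n) (sym (ℤP.*-identityˡ _)))
            ; (suc (suc zero) , m , n) → trans (χ⁻-even (m + n) (- m) (solve 2 (λ m n → swapped (lin (+ 0) (+ 1) (- + 1) m n) (lin (- + 1) (+ 1) (+ 0) m n) (+ 2) := m :+ n :+ ((:- m) :+ (:- m))) refl m n)) (χ⁻-+ m n) })
         (λ { (zero , m , n) → trans (solve 2 (λ m n → P̂′ (lin (+ 0) (- + 1) (+ 0) m n) (lin (+ 1) (- + 1) (+ 0) m n) (+ 0) := pent m n) refl m n)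
              (sym (exponent₂ {3} {1} {2} {15} {5} {10} refl refl 0 m n))
            ; (suc zero , m , n) → trans (solve 2 (λ m n → P̂′ (lin (+ 0) (+ 1) (+ 0) m n) (lin (- + 1) (+ 1) (+ 0) m n) (+ 1)
                := con (+ 2) :* con (+ 2) :+ ((con (+ 3) :* (m :* m) :+ con (+ 3) :* m) :+ (con (+ 15) :* (n :* n) :+ con (+ 15) :* n))) refl m n)
              (sym (exponent₂ {3} {3} {0} {15} {15} {0} refl refl 2 m n))
            ; (suc (suc zero) , m , n) → trans (solve 2 (λ m n → P̂′ (lin (+ 0) (+ 1) (- + 1) m n) (lin (- + 1) (+ 1) (+ 0) m n) (+ 2) := pent m n) refl m n)
              (sym (exponent₂ {3} {1} {2} {15} {5} {10} refl refl 0 m n)) })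
         (generates-Fin 2 {c} {e} {X} λ
           { zero → θ-generates₂ {10} {5} {5} {+ 1} {2} {2} {0} {+ 1} 1≤ 1≤
           ; (suc zero) → generates-sq -1ℤ 1 (θ-generates₂ {2} {1} {1} {+ 1} {10} {10} {0} {+ 1} 1≤ 1≤) })
         (generates-Fin 3 {c′} {e′} {X′} λ
           { zero → θ-generates₂ {3} {1} {2} { -1ℤ} {15} {5} {10} { -1ℤ} 1≤ 1≤
           ; (suc zero) → generates-sq (+ 1) 2 (θ-generates₂ {3} {3} {0} { -1ℤ} {15} {15} {0} { -1ℤ} 1≤ 1≤)
           ; (suc (suc zero)) → θ-generates₂ {3} {1} {2} { -1ℤ} {15} {5} {10} { -1ℤ} 1≤ 1≤ }) ⟩
  ∑Fin 3 X′
    ≈⟨ R.+-cong ff (R.+-cong (R.*-congˡ (R.*-congʳ (alternating-vanishes 1≤))) (R.+-congʳ ff)) ⟩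
  f 1 ∙ f 5 ⊕ (sq (+ 1) 2 ∙ (𝟎 ∙ θ 15 15 0 -1ℤ) ⊕ (f 1 ∙ f 5 ⊕ 𝟎))
    ≈⟨ collect (f 1 ∙ f 5) _ _ ⟩
  const (+ 2) ∙ (f 1 ∙ f 5) ∎
  where
  collect : ∀ x s t → x ⊕ (s ∙ (𝟎 ∙ t) ⊕ (x ⊕ 𝟎)) ≈ const (+ 2) ∙ x
  collect = solve 3 (λ x s t → x :+ (s :* (con (+ 0) :* t) :+ (x :+ con (+ 0))) := con (+ 2) :* x) R.refl
    where open Solver
  open ≈-Reasoning
  open ℤS
  ff : θ 3 1 2 -1ℤ ∙ θ 15 5 10 -1ℤ ≈ f 1 ∙ f 5
  ff = R.*-cong (pentagonal {1} 1≤) (pentagonal {5} 1≤)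
  P̂ : ∀ {k} → Polynomial k → Polynomial k → Polynomial k
  P̂ v w = con (+ 2) :* (w :* w) :+ con (+ 2) :* w :- con (+ 2) :* (v :* w) :+ (con (+ 3) :* (v :* v) :- v)
  swapped : ∀ {k} → Polynomial k → Polynomial k → ℤ → Polynomial k
  swapped t y r = lin (+ 0) (+ 1) (+ 0) (con (+ 3) :* t :+ con r) y
  P̂′ : ∀ {k} → Polynomial k → Polynomial k → ℤ → Polynomial k
  P̂′ t y r = P̂ (swapped t y r) (lin (+ 1) (+ 0) (+ 0) (con (+ 3) :* t :+ con r) y)
  pent : ∀ {k} → Polynomial k → Polynomial k → Polynomial k
  pent m n = con (+ 0) :+ ((con (+ 3) :* (m :* m) :+ con (- + 1) :* m) :+ (con (+ 15) :* (n :* n) :+ con (- + 5) :* n))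
  ρ : Fin 2 → ℤ² ↔ ℤ²
  ρ zero = affine (+ 1) (+ 0) (+ 0) (+ 1) (+ 1) (+ 0) (+ 1) refl
  ρ (suc zero) = affine (+ 0) (+ 1) (+ 0) (+ 1) (+ 1) (+ 0) -1ℤ refl
  c : Fin 2 → ℤ² → ℤ
  c zero (x , y) = χ⁺ x * χ⁺ y
  c (suc zero) (x , y) = -1ℤ * (χ⁺ x * χ⁺ y)
  e : Fin 2 → ℤ² → ℕ
  e zero (x , y) = 0 ℕ.+ (exponent 10 5 5 x ℕ.+ exponent 2 2 0 y)
  e (suc zero) (x , y) = 1 ℕ.+ (0 ℕ.+ (exponent 2 1 1 x ℕ.+ exponent 10 10 0 y))
  X : Fin 2 → PowerSeries
  X zero = φ (+ 1) 5 ∙ ψ₂ 2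
  X (suc zero) = sq -1ℤ 1 ∙ (φ (+ 1) 1 ∙ ψ₂ 10)
  ρ′ : Fin 3 → ℤ² ↔ ℤ²
  ρ′ zero = affine (+ 0) (- + 1) (+ 0) (+ 1) (- + 1) (+ 0) (+ 1) refl
  ρ′ (suc zero) = affine (+ 0) (+ 1) (+ 0) (- + 1) (+ 1) (+ 0) (+ 1) refl
  ρ′ (suc (suc zero)) = affine (+ 0) (+ 1) (- + 1) (- + 1) (+ 1) (+ 0) (+ 1) refl
  c′ : Fin 3 → ℤ² → ℤ
  c′ (suc zero) (m , n) = + 1 * (χ⁻ m * χ⁻ n)
  c′ zero (m , n) = χ⁻ m * χ⁻ n
  c′ (suc (suc zero)) (m , n) = χ⁻ m * χ⁻ n
  e′ : Fin 3 → ℤ² → ℕ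
  e′ (suc zero) (m , n) = 2 ℕ.+ (0 ℕ.+ (exponent 3 3 0 m ℕ.+ exponent 15 15 0 n))
  e′ zero (m , n) = 0 ℕ.+ (exponent 3 1 2 m ℕ.+ exponent 15 5 10 n)
  e′ (suc (suc zero)) (m , n) = 0 ℕ.+ (exponent 3 1 2 m ℕ.+ exponent 15 5 10 n)
  X′ : Fin 3 → PowerSeries
  X′ (suc zero) = sq (+ 1) 2 ∙ (θ 3 3 0 -1ℤ ∙ θ 15 15 0 -1ℤ)
  X′ zero = θ 3 1 2 -1ℤ ∙ θ 15 5 10 -1ℤ
  X′ (suc (suc zero)) = θ 3 1 2 -1ℤ ∙ θ 15 5 10 -1ℤ

-- Two-dissection

U V : PowerSeries → PowerSeries
U x n = x (n ℕ.+ n)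
V x zero = x 0
V x (suc zero) = + 0
V x (suc (suc n)) = V (tail x) n

U-cong : ∀ {x y} → x ≈ y → U x ≈ U y
U-cong p = mk≈ λ n → coeff p (n ℕ.+ n)

U-⊕ : ∀ x y → U (x ⊕ y) ≈ U x ⊕ U y
U-⊕ x y = mk≈ λ n → trans (⊕-coeff x y (n ℕ.+ n)) (sym (⊕-coeff (U x) (U y) n))

U-const : ∀ c x → U (const c ∙ x) ≈ const c ∙ U x
U-const c x = mk≈ λ n → trans (const-∙ c x (n ℕ.+ n)) (sym (const-∙ c (U x) n))

V-cong[] : ∀ {N x y} → x ≈[ N ] y → V x ≈[ N ] V y
V-cong[] {x = x} {y} p = mk≈[] λ n n≤N → go n (λ i i≤n → upTo≤ p i (ℕP.≤-trans i≤n n≤N))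
  where
  go : ∀ {x y} n → (∀ i → i ≤ n → x i ≡ y i) → V x n ≡ V y n
  go zero p = p 0 z≤n
  go (suc zero) p = refl
  go (suc (suc n)) p = go n (λ i i≤n → p (suc i) (s≤s (ℕP.m≤n⇒m≤1+n i≤n)))

V-cong : ∀ {x y} → x ≈ y → V x ≈ V y
V-cong p = ≈[]⇒≈ λ N → V-cong[] (≈⇒≈[] p)

-- The shape is that of `∙-suc`, so the recursion for a product can be pushed through `V`.
V-linear : ∀ c x y n → V (λ i → c * x i + y i) n ≡ c * V x n + V y n
V-linear c x y zero = refl
V-linear c x y (suc zero) = sym (trans (ℤP.+-identityʳ _) (ℤP.*-zeroʳ c))
V-linear c x y (suc (suc n)) = V-linear c (tail x) (tail y) n

V-⊕ : ∀ x y → V (x ⊕ y) ≈ V x ⊕ V y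
V-⊕ x y = R.trans (V-cong (mk≈ λ n → trans (⊕-coeff x y n) (cong (_+ y n) (sym (ℤP.*-identityˡ (x n))))))
  (mk≈ λ n → trans (V-linear (+ 1) x y n) (trans (cong (_+ V y n) (ℤP.*-identityˡ (V x n))) (sym (⊕-coeff (V x) (V y) n))))

V-0 : ∀ n → V (λ _ → + 0) n ≡ + 0
V-0 zero = refl
V-0 (suc zero) = refl
V-0 (suc (suc n)) = V-0 n

V-∙ : ∀ x y → V (x ∙ y) ≈ V x ∙ V y
V-∙ x y = mk≈ λ n → go n x y
  where
  open ≡-Reasoning
  go : ∀ n x y → V (x ∙ y) n ≡ (V x ∙ V y) n
  go zero x y = trans (∙-zero x y) (sym (∙-zero (V x) (V y)))
  go (suc zero) x y = sym (begin
    (V x ∙ V y) 1                             ≡⟨ ∙-suc (V x) (V y) 0 ⟩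
    x 0 * + 0 + (tail (V x) ∙ V y) 0          ≡⟨ cong₂ _+_ (ℤP.*-zeroʳ (x 0)) (∙-zero (tail (V x)) (V y)) ⟩
    + 0                                       ∎)
  go (suc (suc n)) x y = begin
    V (tail (x ∙ y)) n
      ≡⟨ coeff (V-cong (mk≈ (∙-suc x y))) n ⟩
    V (λ i → x 0 * tail y i + (tail x ∙ y) i) n
      ≡⟨ V-linear (x 0) (tail y) (tail x ∙ y) n ⟩
    x 0 * V (tail y) n + V (tail x ∙ y) n
      ≡⟨ cong (_+_ (x 0 * V (tail y) n)) (go n (tail x) y) ⟩
    x 0 * V (tail y) n + (V (tail x) ∙ V y) n
      ≡⟨ cong (_+_ (x 0 * V (tail y) n)) (trans (∙-suc (tail (V x)) (V y) n) (ℤP.+-identityˡ _)) ⟨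
    x 0 * V (tail y) n + (tail (V x) ∙ V y) (suc n)
      ≡⟨ ∙-suc (V x) (V y) (suc n) ⟨
    (V x ∙ V y) (suc (suc n)) ∎

V-const : ∀ c → V (const c) ≈ const c
V-const c = mk≈ λ n → trans (coeff (V-cong (mk≈ (const-coeff c))) n) (trans (go n) (sym (const-coeff c n)))
  where
  go : ∀ n → V (λ i → c * one i) n ≡ c * one n
  go zero = refl
  go (suc zero) = sym (ℤP.*-zeroʳ c)
  go (suc (suc n)) = trans (coeff (V-cong (mk≈ λ _ → ℤP.*-zeroʳ c)) n) (trans (V-0 n) (sym (ℤP.*-zeroʳ c)))

V-qPow : ∀ d → V (qPow d) ≈ qPow (d ℕ.+ d)
V-qPow zero = R.trans (V-cong qPow-0) (R.trans (V-const (+ 1)) (R.sym qPow-0))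
V-qPow (suc d) rewrite ℕP.+-suc d d = mk≈ λ
  { zero → refl
  ; (suc zero) → refl
  ; (suc (suc n)) → trans (coeff (V-cong (mk≈ (qPow-suc d))) n) (trans (coeff (V-qPow d) n)
      (sym (trans (qPow-suc (suc (d ℕ.+ d)) (suc n)) (qPow-suc (d ℕ.+ d) n)))) }

V-sq : ∀ s d → V (sq s d) ≈ sq s (d ℕ.+ d)
V-sq s d = R.trans (V-∙ (const s) (qPow d)) (R.*-cong (V-const s) (V-qPow d))

-- Series in q² are scalars for `U`. This reduces `U-F` and `U-G` to the relations for a and b.
U-V-∙ : ∀ x y → U (V x ∙ y) ≈ x ∙ U y
U-V-∙ x y = mk≈ λ n → go n x y
  where
  open ≡-Reasoning
  go : ∀ n x y → (V x ∙ y) (n ℕ.+ n) ≡ (x ∙ U y) n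
  go zero x y = trans (∙-zero (V x) y) (sym (∙-zero x (U y)))
  go (suc n) x y rewrite ℕP.+-suc n n = begin
    (V x ∙ y) (2 ℕ.+ (n ℕ.+ n))
      ≡⟨ ∙-suc (V x) y (suc (n ℕ.+ n)) ⟩
    x 0 * y (2 ℕ.+ (n ℕ.+ n)) + (tail (V x) ∙ y) (suc (n ℕ.+ n))
      ≡⟨ cong (_+_ (x 0 * y (2 ℕ.+ (n ℕ.+ n)))) (trans (∙-suc (tail (V x)) y (n ℕ.+ n)) (ℤP.+-identityˡ _)) ⟩
    x 0 * y (2 ℕ.+ (n ℕ.+ n)) + (V (tail x) ∙ y) (n ℕ.+ n)
      ≡⟨ cong₂ _+_ (cong (λ m → x 0 * y (suc m)) (sym (ℕP.+-suc n n))) (go n (tail x) y) ⟩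
    x 0 * U y (suc n) + (tail x ∙ U y) n
      ≡⟨ ∙-suc x (U y) n ⟨
    (x ∙ U y) (suc n) ∎

U-V : ∀ x → U (V x) ≈ x
U-V x = mk≈ λ n → go n x
  where
  go : ∀ n x → V x (n ℕ.+ n) ≡ x n
  go zero x = refl
  go (suc n) x rewrite ℕP.+-suc n n = go n (tail x)

-- Disposes of even parts that need not be known explicitly.
U-q-V : ∀ x → U (qPow 1 ∙ V x) ≈ 𝟎
U-q-V x = mk≈ λ n → trans (go n x) (sym (𝟎-coeff n))
  where
  odd-zero : ∀ n x → V x (suc (n ℕ.+ n)) ≡ + 0
  odd-zero zero x = refl
  odd-zero (suc n) x rewrite ℕP.+-suc n n = odd-zero n (tail x)
  go : ∀ n x → (qPow 1 ∙ V x) (n ℕ.+ n) ≡ + 0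
  go zero x = qPow-∙-zero 0 (V x)
  go (suc n) x rewrite ℕP.+-suc n n = trans (qPow-∙-+ 1 (V x) (suc (n ℕ.+ n))) (odd-zero n x)

generates-V : ∀ {A : Set} {c : A → ℤ} {e} {X} → Generates c e X → Generates c (λ a → e a ℕ.+ e a) (V X)
generates-V {c = c} {e} g N = let (L , (u , p) , x) = g N in
  L , (u , λ a e≤N → p a (ℕP.≤-trans (ℕP.m≤m+n (e a) (e a)) e≤N)) ,
  ≈[]-trans (V-cong[] x) (≈⇒≈[] (V-sumL L))
  where
  V-sumL : ∀ L → V (sumL (mono c e) L) ≈ sumL (mono c (λ a → e a ℕ.+ e a)) L
  V-sumL [] = V-const (+ 0)
  V-sumL (a ∷ L) = R.trans (V-⊕ _ _) (R.+-cong (V-sq (c a) (e a)) (V-sumL L))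

-- Same index set, doubled exponents. It expresses theta series in higher powers of q by iterating
-- `V`, without eta quotients beyond f₂₀.
V-θ : ∀ k a b s → 1 ≤ k → V (θ k a b s) ≈ θ (k ℕ.+ k) (a ℕ.+ a) (b ℕ.+ b) s
V-θ k a b s 1≤k = generates-unique _ _ (generates-V (θ-generates k a b s 1≤k))
  (generates-↔ (↔-id ℤ) (λ _ → refl) double (θ-generates (k ℕ.+ k) (a ℕ.+ a) (b ℕ.+ b) s (1≤m+m 1≤k)))
  where
  open ℕSolver.+-*-Solver
  double : ∀ l → exponent k a b l ℕ.+ exponent k a b l ≡ exponent (k ℕ.+ k) (a ℕ.+ a) (b ℕ.+ b) l
  double (+ p) = solve 4 (λ k t a p → k :* t :+ a :* p :+ (k :* t :+ a :* p) := (k :+ k) :* t :+ (a :+ a) :* p) refl k (tri p) a p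
  double -[1+ p ] = solve 4 (λ k t a p → k :* t :+ a :* p :+ (k :* t :+ a :* p) := (k :+ k) :* t :+ (a :+ a) :* p) refl k (tri (suc p)) b (suc p)

V-∏ : ∀ N g → V (∏ N g) ≈ ∏ N (λ i → V (g i))
V-∏ zero g = V-const (+ 1)
V-∏ (suc N) g = R.trans (V-∙ _ _) (R.*-congʳ (V-∏ N g))

V-f : ∀ {m} → 1 ≤ m → V (f m) ≈ f (m ℕ.+ m)
V-f {m} 1≤m = ≈[]⇒≈ λ N → ≈[]-trans (V-cong[] (f-Euler 1≤m ℕP.≤-refl)) (≈[]-trans
  (≈⇒≈[] (R.trans (V-∏ N _) (∏-cong N λ i → R.trans (V-⊕ 𝟏 (sq -1ℤ (m ℕ.* suc i)))
    (R.+-cong (V-const (+ 1)) (R.trans (V-sq -1ℤ (m ℕ.* suc i)) (sq-cong { -1ℤ} refl (sym (ℕP.*-distribʳ-+ (suc i) m m))))))))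
  (≈[]-sym (f-Euler (1≤m+m 1≤m) ℕP.≤-refl)))

V-f⁻¹ : ∀ {m} → 1 ≤ m → V (f⁻¹ m) ≈ f⁻¹ (m ℕ.+ m)
V-f⁻¹ {m} 1≤m = f-cancel (m ℕ.+ m) (R.trans (R.*-congʳ (R.sym (V-f 1≤m))) (R.trans (R.sym (V-∙ (f m) (f⁻¹ m)))
  (R.trans (V-cong (f-inverse m)) (R.trans (V-const (+ 1)) (R.sym (f-inverse (m ℕ.+ m)))))))

V-^ : ∀ x n → V (x ^ n) ≈ V x ^ n
V-^ x zero = V-const (+ 1)
V-^ x (suc n) = R.trans (V-∙ x (x ^ n)) (R.*-congˡ (V-^ x n))

opaque
  unfolding fPow η₃ η

  V-fPow : ∀ {m} → 1 ≤ m → ∀ a → V (fPow m a) ≈ fPow (m ℕ.+ m) a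
  V-fPow {m} 1≤m (+ n) = R.trans (V-^ (f m) n) (^-congˡ n (V-f 1≤m))
  V-fPow {m} 1≤m -[1+ n ] = R.trans (V-^ (f⁻¹ m) (suc n)) (^-congˡ (suc n) (V-f⁻¹ 1≤m))

  V-η₃ : ∀ {m} → 1 ≤ m → ∀ a b → V (η₃ m a b (+ 0)) ≈ η₃ m (+ 0) a b
  V-η₃ {m} 1≤m a b = R.trans (V-∙ _ _) (R.trans (R.*-cong (V-fPow 1≤m a) (R.trans (V-∙ _ _) (R.*-cong (V-fPow (1≤m+m 1≤m) b) (V-const (+ 1)))))
    (solve 2 (λ x y → x :* (y :* con (+ 1)) := con (+ 1) :* (x :* y)) R.refl _ _))
    where open Solver

  -- The exponents move one place. The last ones have to be 0, because `η` has no place for f₈ and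
  -- f₄₀.
  V-η : ∀ a b d e → V (η a b (+ 0) d e (+ 0)) ≈ η (+ 0) a b (+ 0) d e
  V-η a b d e = R.trans (V-∙ _ _) (R.*-cong (V-η₃ (s≤s z≤n) a b) (V-η₃ (s≤s z≤n) d e))

  η-^ : ∀ i j k l → f 1 ^ i ∙ f 2 ^ j ∙ f 5 ^ k ∙ f 10 ^ l ≈ η (+ i) (+ j) (+ 0) (+ k) (+ l) (+ 0)
  η-^ i j k l = solve 4 (λ a b c d → a :* b :* c :* d := (a :* (b :* con (+ 1))) :* (c :* (d :* con (+ 1)))) R.refl
    (f 1 ^ i) (f 2 ^ j) (f 5 ^ k) (f 10 ^ l)
    where open Solver

  η₃₁-η : ∀ a b c → η₃ 1 a b c ≈ η a b c (+ 0) (+ 0) (+ 0)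
  η₃₁-η a b c = ≈[]⇒≈ λ N → from₁ a b c ≈[]-refl

  η₃₅-η : ∀ a b c → η₃ 5 a b c ≈ η (+ 0) (+ 0) (+ 0) a b c
  η₃₅-η a b c = ≈[]⇒≈ λ N → from₅ a b c ≈[]-refl

-- The action of `U` on a, b and ab

const-cancel : ∀ {x y} c .{{_ : ℤ.NonZero c}} → const c ∙ x ≈ const c ∙ y → x ≈ y
const-cancel {x} {y} c p = mk≈ λ n → ℤP.*-cancelˡ-≡ c (x n) (y n)
  (trans (sym (const-∙ c x n)) (trans (coeff p n) (const-∙ c y n)))

-- A = φ(q), A′ = φ(q⁵), B = ψ(q²), B′ = ψ(q¹⁰)
q A A′ B B′ : PowerSeries
q = qPow 1
A = η (- + 2) (+ 5) (- + 2) (+ 0) (+ 0) (+ 0)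
A′ = η (+ 0) (+ 0) (+ 0) (- + 2) (+ 5) (- + 2)
B = η (+ 0) -1ℤ (+ 2) (+ 0) (+ 0) (+ 0)
B′ = η (+ 0) (+ 0) (+ 0) (+ 0) -1ℤ (+ 2)

φ⁺₁ : φ (+ 1) 1 ≈ A
φ⁺₁ = R.trans (φ⁺-η₃ 1≤) (η₃₁-η _ _ _)

φ⁺₅ : φ (+ 1) 5 ≈ A′
φ⁺₅ = R.trans (φ⁺-η₃ 1≤) (η₃₅-η _ _ _)

φ⁻₁ : φ -1ℤ 1 ≈ η (+ 2) -1ℤ (+ 0) (+ 0) (+ 0) (+ 0)
φ⁻₁ = R.trans (φ⁻-η₃ 1≤) (η₃₁-η _ _ _)

φ⁻₅ : φ -1ℤ 5 ≈ η (+ 0) (+ 0) (+ 0) (+ 2) -1ℤ (+ 0)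
φ⁻₅ = R.trans (φ⁻-η₃ 1≤) (η₃₅-η _ _ _)

ψ₂₁ : ψ₂ 1 ≈ const (+ 2) ∙ η -1ℤ (+ 2) (+ 0) (+ 0) (+ 0) (+ 0)
ψ₂₁ = R.trans (ψ₂-η₃ 1≤) (R.*-congˡ (η₃₁-η _ _ _))

ψ₂₅ : ψ₂ 5 ≈ const (+ 2) ∙ η (+ 0) (+ 0) (+ 0) -1ℤ (+ 2) (+ 0)
ψ₂₅ = R.trans (ψ₂-η₃ 1≤) (R.*-congˡ (η₃₅-η _ _ _))

V-2 : ∀ x → V (const (+ 2) ∙ x) ≈ const (+ 2) ∙ V x
V-2 x = R.trans (V-∙ (const (+ 2)) x) (R.*-congʳ (V-const (+ 2)))

ψ₂₂ : ψ₂ 2 ≈ const (+ 2) ∙ B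
ψ₂₂ = R.trans (R.sym (V-θ 1 1 0 (+ 1) 1≤)) (R.trans (V-cong ψ₂₁) (R.trans (V-2 _) (R.*-congˡ (V-η -1ℤ (+ 2) (+ 0) (+ 0)))))

ψ₂₁₀ : ψ₂ 10 ≈ const (+ 2) ∙ B′
ψ₂₁₀ = R.trans (R.sym (V-θ 5 5 0 (+ 1) 1≤)) (R.trans (V-cong ψ₂₅) (R.trans (V-2 _) (R.*-congˡ (V-η (+ 0) (+ 0) -1ℤ (+ 2)))))

ψ₂₄ : ψ₂ 4 ≈ const (+ 2) ∙ V B
ψ₂₄ = R.trans (R.sym (V-θ 2 2 0 (+ 1) 1≤)) (R.trans (V-cong ψ₂₂) (V-2 B))

ψ₂₂₀ : ψ₂ 20 ≈ const (+ 2) ∙ V B′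
ψ₂₂₀ = R.trans (R.sym (V-θ 10 10 0 (+ 1) 1≤)) (R.trans (V-cong ψ₂₁₀) (V-2 B′))

ψ₂₈ : ψ₂ 8 ≈ const (+ 2) ∙ V (V B)
ψ₂₈ = R.trans (R.sym (V-θ 4 4 0 (+ 1) 1≤)) (R.trans (V-cong ψ₂₄) (V-2 (V B)))

ψ₂₄₀ : ψ₂ 40 ≈ const (+ 2) ∙ V (V B′)
ψ₂₄₀ = R.trans (R.sym (V-θ 20 20 0 (+ 1) 1≤)) (R.trans (V-cong ψ₂₂₀) (V-2 (V B′)))

φ⁺₂ : φ (+ 1) 2 ≈ V A
φ⁺₂ = R.trans (R.sym (V-θ 2 1 1 (+ 1) 1≤)) (V-cong φ⁺₁)

φ⁺₁₀ : φ (+ 1) 10 ≈ V A′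
φ⁺₁₀ = R.trans (R.sym (V-θ 10 5 5 (+ 1) 1≤)) (V-cong φ⁺₅)

φ⁺₄ : φ (+ 1) 4 ≈ V (V A)
φ⁺₄ = R.trans (R.sym (V-θ 4 2 2 (+ 1) 1≤)) (V-cong φ⁺₂)

φ⁺₂₀ : φ (+ 1) 20 ≈ V (V A′)
φ⁺₂₀ = R.trans (R.sym (V-θ 20 10 10 (+ 1) 1≤)) (V-cong φ⁺₁₀)

η∙ : ∀ {a b c d e h a′ b′ c′ d′ e′ h′} →
  η a b c d e h ∙ η a′ b′ c′ d′ e′ h′ ≈ η (a + a′) (b + b′) (c + c′) (d + d′) (e + e′) (h + h′)
η∙ = η-∙ _ _ _ _ _ _ _ _ _ _ _ _

qPow-5 : qPow 5 ≈ q ∙ (qPow 2 ∙ qPow 2)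
qPow-5 = R.sym (R.trans (R.*-congˡ (qPow-+ 2 2)) (qPow-+ 1 4))

-- T = f₁ f₅; in the notation at the top a = q X and b = Y.
T Z₁ Z₂ X Y : PowerSeries
T = η (+ 1) (+ 0) (+ 0) (+ 1) (+ 0) (+ 0)
Z₁ = η (- + 2) (+ 3) (+ 0) (+ 2) (+ 1) (+ 0)
Z₂ = η (+ 2) (+ 1) (+ 0) (- + 2) (+ 3) (+ 0)
X = η -1ℤ (+ 0) (+ 0) (+ 5) (+ 0) (+ 0)
Y = η (+ 5) (+ 0) (+ 0) -1ℤ (+ 0) (+ 0)

-- The factor 2 of `ψ₂` on one side matches the two equal residue classes on the other.
T-dissection : A′ ∙ B ⊕ ⊝ (q ∙ (A ∙ B′)) ≈ T
T-dissection = const-cancel (+ 2) (begin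
  const (+ 2) ∙ (A′ ∙ B ⊕ ⊝ (q ∙ (A ∙ B′)))
    ≈⟨ solve 5 (λ q a a′ b b′ → con (+ 2) :* (a′ :* b :- q :* (a :* b′)) := a′ :* (con (+ 2) :* b) :+ con -1ℤ :* q :* (a :* (con (+ 2) :* b′))) R.refl q A A′ B B′ ⟩
  A′ ∙ (const (+ 2) ∙ B) ⊕ sq -1ℤ 1 ∙ (A ∙ (const (+ 2) ∙ B′))
    ≈⟨ R.+-cong (R.*-cong φ⁺₅ ψ₂₂) (R.*-congˡ (R.*-cong φ⁺₁ ψ₂₁₀)) ⟨
  φ (+ 1) 5 ∙ ψ₂ 2 ⊕ sq -1ℤ 1 ∙ (φ (+ 1) 1 ∙ ψ₂ 10)
    ≈⟨ f₁f₅-dissection ⟩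
  const (+ 2) ∙ (f 1 ∙ f 5)
    ≈⟨ R.*-congˡ (R.trans (R.*-cong (R.trans (f₁-η₃ 1) (η₃₁-η _ _ _)) (R.trans (f₁-η₃ 5) (η₃₅-η _ _ _))) η∙) ⟩
  const (+ 2) ∙ T ∎)
  where
  open ≈-Reasoning
  open Solver

-- Dissect both factors. The cross terms form `T-dissection` with q⁴ for q, the opposite signs at q
-- and q⁵ supplying its minus sign. The even part `E` is later removed by `U-q-V`.
φφ-dissection : ∀ s → s * s ≡ + 1 → ∃ λ E → φ s 1 ∙ φ (- s) 5 ≈ V E ⊕ const (+ 2 * s) ∙ (q ∙ V (V T))
φφ-dissection s s*s≡1 = E , (begin
  φ s 1 ∙ φ (- s) 5
    ≈⟨ R.*-cong (R.trans (φ-dissection 1≤ s s*s≡1) (R.+-cong φ⁺₄ (R.*-congˡ ψ₂₈)))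
         (R.trans (φ-dissection 1≤ (- s) -s*-s≡1) (R.+-cong φ⁺₂₀ (R.*-cong (R.*-cong neg qPow-5) ψ₂₄₀))) ⟩
  (a ⊕ const s ∙ q ∙ (const (+ 2) ∙ b)) ∙ (a′ ⊕ ⊝ const s ∙ (q ∙ (Q ∙ Q)) ∙ (const (+ 2) ∙ b′))
    ≈⟨ solve 7 (λ a a′ b b′ s q Q →
         (a :+ s :* q :* (con (+ 2) :* b)) :* (a′ :+ (:- s) :* (q :* (Q :* Q)) :* (con (+ 2) :* b′))
         := a :* a′ :+ con (- + 4) :* (s :* s) :* ((q :* q) :* (Q :* Q) :* (b :* b′)) :+ (con (+ 2) :* s) :* (q :* (a′ :* b :- Q :* Q :* (a :* b′))))
         R.refl a a′ b b′ (const s) q Q ⟩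
  a ∙ a′ ⊕ const (- + 4) ∙ (const s ∙ const s) ∙ ((q ∙ q) ∙ (Q ∙ Q) ∙ (b ∙ b′)) ⊕ (const (+ 2) ∙ const s) ∙ (q ∙ (a′ ∙ b ⊕ ⊝ (Q ∙ Q ∙ (a ∙ b′))))
    ≈⟨ R.+-cong (R.+-congˡ (R.*-cong (R.trans (R.*-congˡ (R.trans (const-∙-const s s) (const-cong s*s≡1))) (R.*-identityʳ _))
         (R.*-congʳ (R.*-congʳ (qPow-+ 1 1))))) (R.*-cong (const-∙-const (+ 2) s) (R.*-congˡ VVT)) ⟩
  a ∙ a′ ⊕ const (- + 4) ∙ (Q ∙ (Q ∙ Q) ∙ (b ∙ b′)) ⊕ const (+ 2 * s) ∙ (q ∙ V (V T))
    ≈⟨ R.+-congʳ VE ⟨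
  V E ⊕ const (+ 2 * s) ∙ (q ∙ V (V T)) ∎)
  where
  open ≈-Reasoning
  open Solver
  a = V (V A)
  a′ = V (V A′)
  b = V (V B)
  b′ = V (V B′)
  Q = qPow 2
  E = V A ∙ V A′ ⊕ const (- + 4) ∙ (q ∙ Q ∙ (V B ∙ V B′))
  -s*-s≡1 : - s * - s ≡ + 1
  -s*-s≡1 = trans (ℤS.solve 1 (λ s → (ℤS.:- s) ℤS.:* (ℤS.:- s) ℤS.:= s ℤS.:* s) refl s) s*s≡1
  neg : const (- s) ≈ ⊝ const s
  neg = R.trans (R.sym (R.trans (const-∙-const -1ℤ s) (const-cong (ℤP.-1*i≡-i s)))) (solve 1 (λ x → con -1ℤ :* x := :- x) R.refl (const s))
  VE : V E ≈ a ∙ a′ ⊕ const (- + 4) ∙ (Q ∙ (Q ∙ Q) ∙ (b ∙ b′))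
  VE = R.trans (V-⊕ _ _) (R.+-cong (V-∙ _ _) (R.trans (V-∙ _ _) (R.*-cong (V-const _)
    (R.trans (V-∙ _ _) (R.*-cong (R.trans (V-∙ _ _) (R.*-cong (V-qPow 1) (R.trans (V-qPow 2) (R.sym (qPow-+ 2 2))))) (V-∙ _ _))))))
  V-⊝ : ∀ x → V (⊝ x) ≈ ⊝ V x
  V-⊝ x = R.trans (V-cong (solve 1 (λ x → :- x := con -1ℤ :* x) R.refl x)) (R.trans (V-∙ _ _)
    (R.trans (R.*-congʳ (V-const -1ℤ)) (solve 1 (λ x → con -1ℤ :* x := :- x) R.refl (V x))))
  VVT : a′ ∙ b ⊕ ⊝ (Q ∙ Q ∙ (a ∙ b′)) ≈ V (V T)
  VVT = R.sym (R.trans (V-cong (V-cong (R.sym T-dissection))) (R.trans (V-cong (R.trans (V-⊕ _ _) (R.+-cong (V-∙ _ _) (V-⊝ _))))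
    (R.trans (V-⊕ _ _) (R.+-cong (V-∙ _ _) (R.trans (V-⊝ _) (R.-‿cong (R.trans (V-cong (V-∙ _ _))
      (R.trans (V-∙ _ _) (R.*-cong (R.trans (V-cong (V-qPow 1)) (R.trans (V-qPow 2) (R.sym (qPow-+ 2 2)))) (R.trans (V-cong (V-∙ _ _)) (V-∙ _ _)))))))))))

U-q-φφ : ∀ s → s * s ≡ + 1 → ∀ W → U (q ∙ (V W ∙ (φ s 1 ∙ φ (- s) 5))) ≈ const (+ 2 * s) ∙ (q ∙ (W ∙ V T))
U-q-φφ s s*s≡1 W = let (E , φφ) = φφ-dissection s s*s≡1 in begin
  U (q ∙ (V W ∙ (φ s 1 ∙ φ (- s) 5)))
    ≈⟨ U-cong (R.*-congˡ (R.*-congˡ φφ)) ⟩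
  U (q ∙ (V W ∙ (V E ⊕ c ∙ (q ∙ V (V T)))))
    ≈⟨ U-cong (solve 5 (λ q w e c t → q :* (w :* (e :+ c :* (q :* t))) := w :* (q :* e) :+ c :* ((q :* q) :* (w :* t))) R.refl _ _ _ _ _) ⟩
  U (V W ∙ (q ∙ V E) ⊕ c ∙ ((q ∙ q) ∙ (V W ∙ V (V T))))
    ≈⟨ U-⊕ _ _ ⟩
  U (V W ∙ (q ∙ V E)) ⊕ U (c ∙ ((q ∙ q) ∙ (V W ∙ V (V T))))
    ≈⟨ R.+-cong (R.trans (U-V-∙ W _) (R.*-congˡ (U-q-V E))) (R.trans (U-const (+ 2 * s) _) (R.*-congˡ
         (R.trans (U-cong (R.trans (R.*-cong (R.trans (qPow-+ 1 1) (R.sym (V-qPow 1))) (R.sym (V-∙ W (V T)))) (R.sym (V-∙ q (W ∙ V T))))) (U-V _)))) ⟩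
  W ∙ 𝟎 ⊕ c ∙ (q ∙ (W ∙ V T))
    ≈⟨ solve 2 (λ w z → w :* con (+ 0) :+ z := z) R.refl W _ ⟩
  c ∙ (q ∙ (W ∙ V T)) ∎
  where
  open ≈-Reasoning
  open Solver
  c = const (+ 2 * s)

VT : V T ≈ η (+ 0) (+ 1) (+ 0) (+ 0) (+ 1) (+ 0)
VT = V-η (+ 1) (+ 0) (+ 1) (+ 0)

-- `Z₁` is W(q²) φ(q) φ(-q⁵) with W = f₂² f₅² / f₁², and W f₂ f₁₀ is `Z₁` again.
U-qZ₁ : U (q ∙ Z₁) ≈ const (+ 2) ∙ (q ∙ Z₁)
U-qZ₁ = R.trans (U-cong (R.*-congˡ (R.sym (R.trans (R.*-cong (V-η (- + 2) (+ 2) (+ 2) (+ 0)) (R.trans (R.*-cong φ⁺₁ φ⁻₅) η∙)) η∙))))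
  (R.trans (U-q-φφ (+ 1) refl _) (R.*-congˡ (R.*-congˡ (R.trans (R.*-congˡ VT) η∙))))

-- The same with the signs exchanged and W = f₁² f₁₀² / f₅².
U-qZ₂ : U (q ∙ Z₂) ≈ const (- + 2) ∙ (q ∙ Z₂)
U-qZ₂ = R.trans (U-cong (R.*-congˡ (R.sym (R.trans (R.*-cong (V-η (+ 2) (+ 0) (- + 2) (+ 2)) (R.trans (R.*-cong φ⁻₁ φ⁺₅) η∙)) η∙))))
  (R.trans (U-q-φφ -1ℤ refl _) (R.*-congˡ (R.*-congˡ (R.trans (R.*-congˡ VT) η∙))))

ψ²-quintic : η (- + 2) (+ 4) (+ 0) (+ 0) (+ 0) (+ 0) ≈
  q ∙ η (+ 0) (+ 0) (+ 0) (- + 2) (+ 4) (+ 0) ⊕ η -1ℤ (+ 1) (+ 0) (+ 3) -1ℤ (+ 0)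
ψ²-quintic = const-cancel (+ 4) (begin
  const (+ 4) ∙ η (- + 2) (+ 4) (+ 0) (+ 0) (+ 0) (+ 0)
    ≈⟨ R.*-congˡ η∙ ⟨
  const (+ 4) ∙ (p ∙ p)
    ≈⟨ solve 1 (λ p → con (+ 4) :* (p :* p) := (con (+ 2) :* p) :* (con (+ 2) :* p)) R.refl p ⟩
  (const (+ 2) ∙ p) ∙ (const (+ 2) ∙ p)
    ≈⟨ R.*-cong ψ₂₁ ψ₂₁ ⟨
  ψ₂ 1 ∙ ψ₂ 1
    ≈⟨ ψ₂²-dissection ⟩
  sq (+ 1) 1 ∙ (ψ₂ 5 ∙ ψ₂ 5) ⊕ const (+ 4) ∙ (θ 5 1 4 (+ 1) ∙ θ 5 2 3 (+ 1))
    ≈⟨ R.+-cong (R.*-congˡ (R.*-cong ψ₂₅ ψ₂₅)) (R.*-congˡ quintic-η) ⟩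
  sq (+ 1) 1 ∙ ((const (+ 2) ∙ r) ∙ (const (+ 2) ∙ r)) ⊕ const (+ 4) ∙ η -1ℤ (+ 1) (+ 0) (+ 3) -1ℤ (+ 0)
    ≈⟨ solve 3 (λ q r z → con (+ 1) :* q :* ((con (+ 2) :* r) :* (con (+ 2) :* r)) :+ con (+ 4) :* z := con (+ 4) :* (q :* (r :* r) :+ z)) R.refl q r _ ⟩
  const (+ 4) ∙ (q ∙ (r ∙ r) ⊕ η -1ℤ (+ 1) (+ 0) (+ 3) -1ℤ (+ 0))
    ≈⟨ R.*-congˡ (R.+-congʳ (R.*-congˡ η∙)) ⟩
  const (+ 4) ∙ (q ∙ η (+ 0) (+ 0) (+ 0) (- + 2) (+ 4) (+ 0) ⊕ η -1ℤ (+ 1) (+ 0) (+ 3) -1ℤ (+ 0)) ∎)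
  where
  open ≈-Reasoning
  open Solver
  p = η -1ℤ (+ 2) (+ 0) (+ 0) (+ 0) (+ 0)
  r = η (+ 0) (+ 0) (+ 0) -1ℤ (+ 2) (+ 0)

-- The exponents remain sums, which evaluate as soon as the multiplier is given by numerals.
ψ²-quintic-∙ : ∀ a b d e → η (- + 2 + a) (+ 4 + b) (+ 0) (+ 0 + d) (+ 0 + e) (+ 0) ≈
  q ∙ η (+ 0 + a) (+ 0 + b) (+ 0) (- + 2 + d) (+ 4 + e) (+ 0) ⊕ η (-1ℤ + a) (+ 1 + b) (+ 0) (+ 3 + d) (-1ℤ + e) (+ 0)
ψ²-quintic-∙ a b d e = R.trans (R.sym η∙) (R.trans (R.*-congʳ ψ²-quintic) (R.trans (R.distribʳ w _ _)
  (R.+-cong (R.trans (R.*-assoc q _ w) (R.*-congˡ η∙)) η∙)))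
  where w = η a b (+ 0) d e (+ 0)

VX : V X ≈ η (+ 0) -1ℤ (+ 0) (+ 0) (+ 5) (+ 0)
VX = V-η -1ℤ (+ 0) (+ 5) (+ 0)

VY : V Y ≈ η (+ 0) (+ 5) (+ 0) (+ 0) -1ℤ (+ 0)
VY = V-η (+ 5) (+ 0) -1ℤ (+ 0)

-- The multiplier f₅² f₁₀ / f₂ is the one that turns the two terms on the right of `ψ²-quintic` into
-- f₁₀⁵/f₂ and f₅⁵/f₁.
Z₁-X : Z₁ ≈ q ∙ V X ⊕ X
Z₁-X = R.trans (ψ²-quintic-∙ (+ 0) -1ℤ (+ 2) (+ 1)) (R.+-congʳ (R.*-congˡ (R.sym VX)))

-- From a = q Z₁ - a(q²) follows U a = 2 q Z₁ - a; then q Z₁ is replaced by a + a(q²).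
U-qX : U (q ∙ X) ≈ q ∙ X ⊕ const (+ 2) ∙ (qPow 2 ∙ V X)
U-qX = begin
  U (q ∙ X)
    ≈⟨ U-cong (R.trans (solve 3 (λ q x v → q :* x := q :* (q :* v :+ x) :+ con -1ℤ :* ((q :* q) :* v)) R.refl q X (V X))
         (R.+-cong (R.*-congˡ (R.sym Z₁-X)) (R.*-congˡ (R.trans (R.*-congʳ (R.trans (qPow-+ 1 1) (R.sym (V-qPow 1)))) (R.sym (V-∙ q X)))))) ⟩
  U (q ∙ Z₁ ⊕ const -1ℤ ∙ V (q ∙ X))
    ≈⟨ R.trans (U-⊕ _ _) (R.+-cong U-qZ₁ (R.trans (U-const -1ℤ _) (R.*-congˡ (U-V _)))) ⟩
  const (+ 2) ∙ (q ∙ Z₁) ⊕ const -1ℤ ∙ (q ∙ X)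
    ≈⟨ R.+-congʳ (R.*-congˡ (R.*-congˡ Z₁-X)) ⟩
  const (+ 2) ∙ (q ∙ (q ∙ V X ⊕ X)) ⊕ const -1ℤ ∙ (q ∙ X)
    ≈⟨ solve 3 (λ q x v → con (+ 2) :* (q :* (q :* v :+ x)) :+ con -1ℤ :* (q :* x) := q :* x :+ con (+ 2) :* ((q :* q) :* v)) R.refl q X (V X) ⟩
  q ∙ X ⊕ const (+ 2) ∙ ((q ∙ q) ∙ V X)
    ≈⟨ R.+-congˡ (R.*-congˡ (R.*-congʳ (qPow-+ 1 1))) ⟩
  q ∙ X ⊕ const (+ 2) ∙ (qPow 2 ∙ V X) ∎
  where
  open ≈-Reasoning
  open Solver

-- The coefficient -5 is -4 - 1: the -4 is in `φ²-quintic`, and the -1 arises when φ(-q⁵)² is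
-- rewritten by `ψ²-quintic` times f₁ f₅ / (f₂ f₁₀).
φ²-quintic-η : η (+ 4) (- + 2) (+ 0) (+ 0) (+ 0) (+ 0) ≈
  η -1ℤ (+ 3) (+ 0) (+ 1) -1ℤ (+ 0) ⊕ const (- + 5) ∙ (q ∙ η (+ 1) -1ℤ (+ 0) -1ℤ (+ 3) (+ 0))
φ²-quintic-η = begin
  η (+ 4) (- + 2) (+ 0) (+ 0) (+ 0) (+ 0)
    ≈⟨ η∙ ⟨
  η (+ 2) -1ℤ (+ 0) (+ 0) (+ 0) (+ 0) ∙ η (+ 2) -1ℤ (+ 0) (+ 0) (+ 0) (+ 0)
    ≈⟨ R.*-cong φ⁻₁ φ⁻₁ ⟨
  φ -1ℤ 1 ∙ φ -1ℤ 1
    ≈⟨ φ²-quintic ⟩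
  φ -1ℤ 5 ∙ φ -1ℤ 5 ⊕ const (+ 4) ∙ (sq -1ℤ 1 ∙ (θ 10 1 9 -1ℤ ∙ θ 10 3 7 -1ℤ))
    ≈⟨ R.+-cong (R.trans (R.*-cong φ⁻₅ φ⁻₅) η∙) (R.*-congˡ (R.*-congˡ decic-η)) ⟩
  η (+ 0) (+ 0) (+ 0) (+ 4) (- + 2) (+ 0) ⊕ const (+ 4) ∙ (const -1ℤ ∙ q ∙ w)
    ≈⟨ solve 3 (λ x q w → x :+ con (+ 4) :* (con -1ℤ :* q :* w) := (q :* w :+ x) :+ con (- + 5) :* (q :* w)) R.refl _ q w ⟩
  (q ∙ w ⊕ η (+ 0) (+ 0) (+ 0) (+ 4) (- + 2) (+ 0)) ⊕ const (- + 5) ∙ (q ∙ w)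
    ≈⟨ R.+-congʳ (ψ²-quintic-∙ (+ 1) -1ℤ (+ 1) -1ℤ) ⟨
  η -1ℤ (+ 3) (+ 0) (+ 1) -1ℤ (+ 0) ⊕ const (- + 5) ∙ (q ∙ w) ∎
  where
  open ≈-Reasoning
  open Solver
  w = η (+ 1) -1ℤ (+ 0) -1ℤ (+ 3) (+ 0)

-- `φ²-quintic-η` times f₁ f₂² / f₅, which makes its first term f₂⁵/f₁₀.
Y-Z₂ : Y ≈ V Y ⊕ const (- + 5) ∙ (q ∙ Z₂)
Y-Z₂ = begin
  Y                     ≈⟨ η∙ ⟨
  η (+ 4) (- + 2) (+ 0) (+ 0) (+ 0) (+ 0) ∙ w   ≈⟨ R.*-congʳ φ²-quintic-η ⟩
  (η -1ℤ (+ 3) (+ 0) (+ 1) -1ℤ (+ 0) ⊕ const (- + 5) ∙ (q ∙ η (+ 1) -1ℤ (+ 0) -1ℤ (+ 3) (+ 0))) ∙ w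
    ≈⟨ solve 4 (λ x q y w → (x :+ con (- + 5) :* (q :* y)) :* w := x :* w :+ con (- + 5) :* (q :* (y :* w))) R.refl _ q _ w ⟩
  η -1ℤ (+ 3) (+ 0) (+ 1) -1ℤ (+ 0) ∙ w ⊕ const (- + 5) ∙ (q ∙ (η (+ 1) -1ℤ (+ 0) -1ℤ (+ 3) (+ 0) ∙ w))
    ≈⟨ R.+-cong (R.trans η∙ (R.sym VY)) (R.*-congˡ (R.*-congˡ η∙)) ⟩
  V Y ⊕ const (- + 5) ∙ (q ∙ Z₂) ∎
  where
  open ≈-Reasoning
  open Solver
  w = η (+ 1) (+ 2) (+ 0) -1ℤ (+ 0) (+ 0)

-- U b = b + 10 q Z₂ by the eigenvalue -2, and 10 q Z₂ = 2 b(q²) - 2 b.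
U-Y : U Y ≈ ⊝ Y ⊕ const (+ 2) ∙ V Y
U-Y = begin
  U Y
    ≈⟨ U-cong Y-Z₂ ⟩
  U (V Y ⊕ const (- + 5) ∙ (q ∙ Z₂))
    ≈⟨ R.trans (U-⊕ _ _) (R.+-cong (U-V Y) (R.trans (U-const (- + 5) _) (R.*-congˡ U-qZ₂))) ⟩
  Y ⊕ const (- + 5) ∙ (const (- + 2) ∙ (q ∙ Z₂))
    ≈⟨ solve 3 (λ y v z → y :+ con (- + 5) :* (con (- + 2) :* z) := (y :- con (+ 2) :* (v :+ con (- + 5) :* z)) :+ con (+ 2) :* v) R.refl Y (V Y) (q ∙ Z₂) ⟩
  (Y ⊕ ⊝ (const (+ 2) ∙ (V Y ⊕ const (- + 5) ∙ (q ∙ Z₂)))) ⊕ const (+ 2) ∙ V Y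
    ≈⟨ R.+-congʳ (R.+-congˡ (R.-‿cong (R.*-congˡ (R.sym Y-Z₂)))) ⟩
  (Y ⊕ ⊝ (const (+ 2) ∙ Y)) ⊕ const (+ 2) ∙ V Y
    ≈⟨ R.+-congʳ (solve 1 (λ y → y :- con (+ 2) :* y := :- y) R.refl Y) ⟩
  ⊝ Y ⊕ const (+ 2) ∙ V Y ∎
  where
  open ≈-Reasoning
  open Solver

φ⁻₁² : φ -1ℤ 1 ∙ φ -1ℤ 1 ≈ V (A ∙ A) ⊕ const (- + 4) ∙ (q ∙ V (B ∙ B))
φ⁻₁² = R.trans (φ²-dissection 1≤) (R.trans (R.+-cong (R.trans (R.*-cong φ⁺₂ φ⁺₂) (R.sym (V-∙ A A)))
  (R.*-congˡ (R.*-cong ψ₂₄ ψ₂₄))) (R.+-congˡ (R.trans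
    (solve 2 (λ q b → con -1ℤ :* q :* (con (+ 2) :* b :* (con (+ 2) :* b)) := con (- + 4) :* (q :* (b :* b))) R.refl q (V B))
    (R.*-congˡ (R.*-congˡ (R.sym (V-∙ B B)))))))
  where open Solver

φ⁻₅² : φ -1ℤ 5 ∙ φ -1ℤ 5 ≈ V (A′ ∙ A′) ⊕ const (- + 4) ∙ (q ∙ (V (q ∙ q) ∙ V (B′ ∙ B′)))
φ⁻₅² = R.trans (φ²-dissection 1≤) (R.trans (R.+-cong (R.trans (R.*-cong φ⁺₁₀ φ⁺₁₀) (R.sym (V-∙ A′ A′)))
  (R.*-cong (R.*-congˡ (R.trans qPow-5 (R.*-congˡ (R.sym (R.trans (V-∙ q q) (R.*-cong (V-qPow 1) (V-qPow 1))))))) (R.*-cong ψ₂₂₀ ψ₂₂₀))) (R.+-congˡ (R.trans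
    (solve 3 (λ q Q b → con -1ℤ :* (q :* Q) :* (con (+ 2) :* b :* (con (+ 2) :* b)) := con (- + 4) :* (q :* (Q :* (b :* b)))) R.refl q _ (V B′))
    (R.*-congˡ (R.*-congˡ (R.*-congˡ (R.sym (V-∙ B′ B′))))))))
  where open Solver

Z : PowerSeries
Z = η (+ 4) (+ 0) (+ 0) (+ 4) (+ 0) (+ 0)

-- f₁⁴ f₅⁴ is f₂² f₁₀² times φ(-q)² φ(-q⁵)², and the odd part of the latter is -4q `O`(q²).
-- Completing the square in `O` gives T² + 2q P by `T-dissection`: with W = f₁² f₅², the product W
-- T² returns Z and W P is Z(q²).
U-qZ : U (q ∙ Z) ≈ const (- + 4) ∙ (q ∙ Z) ⊕ const (- + 8) ∙ V (q ∙ Z)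
U-qZ = begin
  U (q ∙ Z)
    ≈⟨ U-cong (R.*-congˡ Z-φ) ⟩
  U (q ∙ (V W ∙ ((V (A ∙ A) ⊕ const (- + 4) ∙ (q ∙ V (B ∙ B))) ∙ (V (A′ ∙ A′) ⊕ const (- + 4) ∙ (q ∙ (V (q ∙ q) ∙ V (B′ ∙ B′)))))))
    ≈⟨ U-cong (solve 7 (λ q w a b a′ Q b′ → q :* (w :* ((a :+ con (- + 4) :* (q :* b)) :* (a′ :+ con (- + 4) :* (q :* (Q :* b′)))))
          := w :* (q :* (a :* a′ :+ con (+ 16) :* ((q :* q) :* (Q :* (b :* b′))))) :+ con (- + 4) :* ((q :* q) :* (w :* (b :* a′ :+ Q :* (a :* b′))))) R.refl
         q (V W) (V (A ∙ A)) (V (B ∙ B)) (V (A′ ∙ A′)) (V (q ∙ q)) (V (B′ ∙ B′))) ⟩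
  U (V W ∙ (q ∙ (V (A ∙ A) ∙ V (A′ ∙ A′) ⊕ const (+ 16) ∙ ((q ∙ q) ∙ (V (q ∙ q) ∙ (V (B ∙ B) ∙ V (B′ ∙ B′))))))
     ⊕ const (- + 4) ∙ ((q ∙ q) ∙ (V W ∙ (V (B ∙ B) ∙ V (A′ ∙ A′) ⊕ V (q ∙ q) ∙ (V (A ∙ A) ∙ V (B′ ∙ B′))))))
    ≈⟨ U-cong (R.+-cong (R.*-congˡ (R.*-congˡ even)) (R.*-congˡ odd-part)) ⟩
  U (V W ∙ (q ∙ V E) ⊕ const (- + 4) ∙ V (q ∙ (W ∙ O)))
    ≈⟨ R.trans (U-⊕ _ _) (R.+-cong (R.trans (U-V-∙ W _) (R.*-congˡ (U-q-V E))) (R.trans (U-const (- + 4) _) (R.*-congˡ (U-V _)))) ⟩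
  W ∙ 𝟎 ⊕ const (- + 4) ∙ (q ∙ (W ∙ O))
    ≈⟨ R.+-congˡ (R.*-congˡ (R.*-congˡ (R.*-congˡ O-η))) ⟩
  W ∙ 𝟎 ⊕ const (- + 4) ∙ (q ∙ (W ∙ (T ∙ T ⊕ const (+ 2) ∙ (q ∙ P))))
    ≈⟨ solve 4 (λ w q t p → w :* con (+ 0) :+ con (- + 4) :* (q :* (w :* (t :+ con (+ 2) :* (q :* p))))
          := con (- + 4) :* (q :* (w :* t)) :+ con (- + 8) :* ((q :* q) :* (w :* p))) R.refl W q (T ∙ T) P ⟩
  const (- + 4) ∙ (q ∙ (W ∙ (T ∙ T))) ⊕ const (- + 8) ∙ ((q ∙ q) ∙ (W ∙ P))
    ≈⟨ R.+-cong (R.*-congˡ (R.*-congˡ (R.trans (R.*-congˡ η∙) η∙))) (R.*-congˡ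
         (R.trans (R.*-cong qq-V (R.trans η∙ (R.sym (V-η (+ 4) (+ 0) (+ 4) (+ 0))))) (R.sym (V-∙ q Z)))) ⟩
  const (- + 4) ∙ (q ∙ Z) ⊕ const (- + 8) ∙ V (q ∙ Z) ∎
  where
  open ≈-Reasoning
  open Solver
  W P E O : PowerSeries
  W = η (+ 2) (+ 0) (+ 0) (+ 2) (+ 0) (+ 0)
  P = η (- + 2) (+ 4) (+ 0) (- + 2) (+ 4) (+ 0)
  E = (A ∙ A) ∙ (A′ ∙ A′) ⊕ const (+ 16) ∙ (q ∙ ((q ∙ q) ∙ ((B ∙ B) ∙ (B′ ∙ B′))))
  O = (B ∙ B) ∙ (A′ ∙ A′) ⊕ (q ∙ q) ∙ ((A ∙ A) ∙ (B′ ∙ B′))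
  qq-V : q ∙ q ≈ V q
  qq-V = R.trans (qPow-+ 1 1) (R.sym (V-qPow 1))
  Z-φ : Z ≈ V W ∙ ((V (A ∙ A) ⊕ const (- + 4) ∙ (q ∙ V (B ∙ B))) ∙ (V (A′ ∙ A′) ⊕ const (- + 4) ∙ (q ∙ (V (q ∙ q) ∙ V (B′ ∙ B′)))))
  Z-φ = R.sym (R.trans (R.*-cong (V-η (+ 2) (+ 0) (+ 2) (+ 0)) (R.*-cong (R.trans (R.sym φ⁻₁²) (R.trans (R.*-cong φ⁻₁ φ⁻₁) η∙))
    (R.trans (R.sym φ⁻₅²) (R.trans (R.*-cong φ⁻₅ φ⁻₅) η∙)))) (R.trans (R.*-congˡ η∙) η∙))
  even : V (A ∙ A) ∙ V (A′ ∙ A′) ⊕ const (+ 16) ∙ ((q ∙ q) ∙ (V (q ∙ q) ∙ (V (B ∙ B) ∙ V (B′ ∙ B′)))) ≈ V E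
  even = R.sym (R.trans (V-⊕ _ _) (R.+-cong (V-∙ _ _) (R.trans (V-∙ _ _) (R.*-cong (V-const _) (R.trans (V-∙ _ _) (R.*-cong (R.sym qq-V)
    (R.trans (V-∙ _ _) (R.*-congˡ (V-∙ _ _)))))))))
  odd-part : (q ∙ q) ∙ (V W ∙ (V (B ∙ B) ∙ V (A′ ∙ A′) ⊕ V (q ∙ q) ∙ (V (A ∙ A) ∙ V (B′ ∙ B′)))) ≈ V (q ∙ (W ∙ O))
  odd-part = R.sym (R.trans (V-∙ _ _) (R.*-cong (R.sym qq-V) (R.trans (V-∙ _ _) (R.*-congˡ (R.trans (V-⊕ _ _)
    (R.+-cong (V-∙ _ _) (R.trans (V-∙ _ _) (R.*-congˡ (V-∙ _ _)))))))))
  O-η : O ≈ T ∙ T ⊕ const (+ 2) ∙ (q ∙ P)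
  O-η = R.trans (solve 5 (λ q a b a′ b′ → (b :* b) :* (a′ :* a′) :+ (q :* q) :* ((a :* a) :* (b′ :* b′))
      := (a′ :* b :- q :* (a :* b′)) :* (a′ :* b :- q :* (a :* b′)) :+ con (+ 2) :* (q :* ((a :* b) :* (a′ :* b′)))) R.refl q A B A′ B′)
    (R.+-cong (R.*-cong T-dissection T-dissection) (R.*-congˡ (R.*-congˡ (R.trans (R.*-cong η∙ η∙) η∙))))

-- Iterating U

-- The innermost `U` is split off, so that a relation for `U x` can be substituted under `U^ k`.
U^ : ℕ → PowerSeries → PowerSeries
U^ zero x = x
U^ (suc k) x = U^ k (U x)

U^-coeff : ∀ k x n → U^ k x n ≡ x (2 ℕ.^ k ℕ.* n)
U^-coeff zero x n = cong x (sym (ℕP.+-identityʳ n))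
U^-coeff (suc k) x n = trans (U^-coeff k (U x) n)
  (cong x (solve 2 (λ p n → p :* n :+ p :* n := con 2 :* p :* n) refl (2 ℕ.^ k) n))
  where open ℕSolver.+-*-Solver

U^-cong : ∀ k {x y} → x ≈ y → U^ k x ≈ U^ k y
U^-cong zero p = p
U^-cong (suc k) p = U^-cong k (U-cong p)

U^-linear : ∀ k a b x y → U^ k (const a ∙ x ⊕ const b ∙ y) ≈ const a ∙ U^ k x ⊕ const b ∙ U^ k y
U^-linear zero a b x y = R.refl
U^-linear (suc k) a b x y = R.trans
  (U^-cong k (R.trans (U-⊕ _ _) (R.+-cong (U-const a x) (U-const b y)))) (U^-linear k a b (U x) (U y))

infix 4 _∣ₛ_
_∣ₛ_ : ℤ → PowerSeries → Set
c ∣ₛ x = ∃ λ y → x ≈ const c ∙ y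

∣ₛ-linear : ∀ {k x y} a b → + (2 ℕ.^ k) ∣ₛ x → + (2 ℕ.^ k) ∣ₛ y →
  + (2 ℕ.^ suc k) ∣ₛ (const (+ 2 * a) ∙ x ⊕ const (+ 2 * b) ∙ y)
∣ₛ-linear {k} {x} {y} a b (x′ , p) (y′ , r) = const a ∙ x′ ⊕ const b ∙ y′ , (begin
  const (+ 2 * a) ∙ x ⊕ const (+ 2 * b) ∙ y
    ≈⟨ R.+-cong (R.*-cong (R.sym (const-∙-const (+ 2) a)) p) (R.*-cong (R.sym (const-∙-const (+ 2) b)) r) ⟩
  const (+ 2) ∙ const a ∙ (const c ∙ x′) ⊕ const (+ 2) ∙ const b ∙ (const c ∙ y′)
    ≈⟨ solve 6 (λ t a b c x y → t :* a :* (c :* x) :+ t :* b :* (c :* y) := (t :* c) :* (a :* x :+ b :* y)) R.refl (const (+ 2)) (const a) (const b) (const c) x′ y′ ⟩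
  (const (+ 2) ∙ const c) ∙ (const a ∙ x′ ⊕ const b ∙ y′)
    ≈⟨ R.*-congʳ (R.trans (const-∙-const (+ 2) c) (const-cong (sym (ℤP.pos-* 2 (2 ℕ.^ k))))) ⟩
  const (+ (2 ℕ.^ suc k)) ∙ (const a ∙ x′ ⊕ const b ∙ y′) ∎)
  where
  open ≈-Reasoning
  open Solver
  c = + (2 ℕ.^ k)

∣ₛ-coeff : ∀ {c x} → c ∣ₛ x → ∀ n → c ∣ x n
∣ₛ-coeff {c} {x} (y , p) n = subst (c ∣_) (sym (trans (coeff p n) (const-∙ c y n)))
  (subst (ℤ.∣ c ∣ ℕD.∣_) (sym (ℤP.abs-* c (y n))) (ℕD.m∣m*n ℤ.∣ y n ∣))

∣ₛ-≈ : ∀ {c x y} → x ≈ y → c ∣ₛ y → c ∣ₛ x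
∣ₛ-≈ x≈y (z , p) = z , R.trans x≈y p

H₀ F₀ G₀ : PowerSeries
H₀ = q ∙ Z
F₀ = q ∙ (X ∙ V Y)
G₀ = qPow 2 ∙ (V X ∙ Y)

X∙Y : X ∙ Y ≈ Z
X∙Y = η∙

U-F : U F₀ ≈ const (+ 1) ∙ H₀ ⊕ const (+ 2) ∙ G₀
U-F = begin
  U (q ∙ (X ∙ V Y))
    ≈⟨ U-cong (solve 3 (λ q x y → q :* (x :* y) := y :* (q :* x)) R.refl q X (V Y)) ⟩
  U (V Y ∙ (q ∙ X))
    ≈⟨ R.trans (U-V-∙ Y (q ∙ X)) (R.*-congˡ U-qX) ⟩
  Y ∙ (q ∙ X ⊕ const (+ 2) ∙ (qPow 2 ∙ V X))
    ≈⟨ solve 5 (λ y q x Q v → y :* (q :* x :+ con (+ 2) :* (Q :* v)) := con (+ 1) :* (q :* (x :* y)) :+ con (+ 2) :* (Q :* (v :* y))) R.refl Y q X (qPow 2) (V X) ⟩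
  const (+ 1) ∙ (q ∙ (X ∙ Y)) ⊕ const (+ 2) ∙ G₀
    ≈⟨ R.+-congʳ (R.*-congˡ (R.*-congˡ X∙Y)) ⟩
  const (+ 1) ∙ H₀ ⊕ const (+ 2) ∙ G₀ ∎
  where
  open ≈-Reasoning
  open Solver

U-G : U G₀ ≈ const -1ℤ ∙ H₀ ⊕ const (+ 2) ∙ F₀
U-G = begin
  U (qPow 2 ∙ (V X ∙ Y))
    ≈⟨ U-cong (R.trans (R.sym (R.*-assoc _ _ _)) (R.*-congʳ (R.sym (R.trans (V-∙ q X) (R.*-congʳ (V-qPow 1)))))) ⟩
  U (V (q ∙ X) ∙ Y)
    ≈⟨ R.trans (U-V-∙ (q ∙ X) Y) (R.*-congˡ U-Y) ⟩
  q ∙ X ∙ (⊝ Y ⊕ const (+ 2) ∙ V Y)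
    ≈⟨ solve 4 (λ q x y v → q :* x :* (:- y :+ con (+ 2) :* v) := con -1ℤ :* (q :* (x :* y)) :+ con (+ 2) :* (q :* (x :* v))) R.refl q X Y (V Y) ⟩
  const -1ℤ ∙ (q ∙ (X ∙ Y)) ⊕ const (+ 2) ∙ F₀
    ≈⟨ R.+-congʳ (R.*-congˡ (R.*-congˡ X∙Y)) ⟩
  const -1ℤ ∙ H₀ ⊕ const (+ 2) ∙ F₀ ∎
  where
  open ≈-Reasoning
  open Solver

-- U preserves the lattice spanned by H and 2 H(q²) and is divisible by 2 on it.
U^-H : ∀ k → + (2 ℕ.^ k) ∣ₛ U^ k H₀ × + (2 ℕ.^ k) ∣ₛ U^ k (const (+ 2) ∙ V H₀)
U^-H zero = (_ , R.sym (R.*-identityˡ _)) , (_ , R.sym (R.*-identityˡ _))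
U^-H (suc k) = let (h , h′) = U^-H k in
  ∣ₛ-≈ (R.trans (U^-cong k (R.trans U-qZ (solve 2 (λ h v → con (- + 4) :* h :+ con (- + 8) :* v := con (- + 4) :* h :+ con (- + 4) :* (con (+ 2) :* v)) R.refl H₀ (V H₀))))
    (U^-linear k (- + 4) (- + 4) H₀ (const (+ 2) ∙ V H₀))) (∣ₛ-linear {k} (- + 2) (- + 2) h h′) ,
  ∣ₛ-≈ (R.trans (U^-cong k (R.trans (U-const (+ 2) (V H₀)) (R.trans (R.*-congˡ (U-V H₀))
      (solve 1 (λ h → con (+ 2) :* h := con (+ 2) :* h :+ con (+ 0) :* h) R.refl H₀))))
    (U^-linear k (+ 2) (+ 0) H₀ H₀)) (∣ₛ-linear {k} (+ 1) (+ 0) h h)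
  where open Solver

-- The first `U` yields H with coefficient ±1, which costs one power of 2. After that, H gains a
-- factor 2 from each further `U`, and the other summand is twice the induction hypothesis for the
-- partner series.
U^-FG : ∀ k → + (2 ℕ.^ k) ∣ₛ U^ (suc k) F₀ × + (2 ℕ.^ k) ∣ₛ U^ (suc k) G₀
U^-FG zero = (_ , R.sym (R.*-identityˡ _)) , (_ , R.sym (R.*-identityˡ _))
U^-FG (suc k) = let (f′ , g′) = U^-FG k in step F₀ G₀ (+ 1) U-F g′ , step G₀ F₀ -1ℤ U-G f′
  where
  open Solver
  step : ∀ x y a → U x ≈ const a ∙ H₀ ⊕ const (+ 2) ∙ y → + (2 ℕ.^ k) ∣ₛ U^ (suc k) y → + (2 ℕ.^ suc k) ∣ₛ U^ (suc (suc k)) x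
  step x y a p (z , r) = let (h , hp) = proj₁ (U^-H (suc k)) in const a ∙ h ⊕ z , (begin
    U^ (suc k) (U x)
      ≈⟨ R.trans (U^-cong (suc k) p) (U^-linear (suc k) a (+ 2) H₀ y) ⟩
    const a ∙ U^ (suc k) H₀ ⊕ const (+ 2) ∙ U^ (suc k) y
      ≈⟨ R.+-cong (R.*-congˡ hp) (R.*-congˡ r) ⟩
    const a ∙ (const (+ (2 ℕ.^ suc k)) ∙ h) ⊕ const (+ 2) ∙ (const (+ (2 ℕ.^ k)) ∙ z)
      ≈⟨ R.+-congˡ (R.trans (R.sym (R.*-assoc _ _ _)) (R.*-congʳ (R.trans (const-∙-const _ _) (const-cong (sym (ℤP.pos-* 2 (2 ℕ.^ k))))))) ⟩
    const a ∙ (const (+ (2 ℕ.^ suc k)) ∙ h) ⊕ const (+ (2 ℕ.^ suc k)) ∙ z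
      ≈⟨ solve 4 (λ a c h z → a :* (c :* h) :+ c :* z := c :* (a :* h :+ z)) R.refl (const a) (const (+ (2 ℕ.^ suc k))) h z ⟩
    const (+ (2 ℕ.^ suc k)) ∙ (const a ∙ h ⊕ z) ∎)
    where open ≈-Reasoning

-- From the defining equations to F and G, and index arithmetic

^⋆-^ : ∀ x n → x ^⋆ n ≈ x ^ n
^⋆-^ x zero = one≈𝟏
^⋆-^ x (suc n) = R.trans (mk≈ λ i → sym (∙-⋆ x (x ^⋆ n) i)) (R.*-congˡ (^⋆-^ x n))

⋆-∙ : ∀ {x x′ y y′} → x ≈ x′ → y ≈ y′ → x ⋆ y ≈ x′ ∙ y′
⋆-∙ {x} {y = y} p r = R.trans (mk≈ λ n → sym (∙-⋆ x y n)) (R.*-cong p r)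

M-η : ∀ M → M ⋆ (f 1 ⋆ f 10) ≈ (f 2 ^⋆ 5) ⋆ (f 5 ^⋆ 5) → M ≈ X ∙ V Y
M-η M p = R.trans (≈[]⇒≈ λ N → η-divide (+ 1) (+ 0) (+ 0) (+ 0) (+ 1) (+ 0) (+ 0) (+ 5) (+ 0) (+ 5) (+ 0) (+ 0) (≈⇒≈[] (begin
    M ∙ η (+ 1) (+ 0) (+ 0) (+ 0) (+ 1) (+ 0)   ≈⟨ R.*-congˡ (R.sym (η-^ 1 0 0 1)) ⟩
    M ∙ (f 1 ^ 1 ∙ 𝟏 ∙ 𝟏 ∙ f 10 ^ 1)            ≈⟨ R.*-congˡ (solve 2 (λ a b → a :^ 1 :* con (+ 1) :* con (+ 1) :* b :^ 1 := a :* b) R.refl (f 1) (f 10)) ⟩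
    M ∙ (f 1 ∙ f 10)                            ≈⟨ ⋆-∙ R.refl (⋆-∙ R.refl R.refl) ⟨
    M ⋆ (f 1 ⋆ f 10)                            ≈⟨ p ⟩
    (f 2 ^⋆ 5) ⋆ (f 5 ^⋆ 5)                     ≈⟨ ⋆-∙ (^⋆-^ (f 2) 5) (^⋆-^ (f 5) 5) ⟩
    f 2 ^ 5 ∙ f 5 ^ 5                           ≈⟨ solve 2 (λ a b → a :* b := con (+ 1) :* a :* b :* con (+ 1)) R.refl (f 2 ^ 5) (f 5 ^ 5) ⟩
    𝟏 ∙ f 2 ^ 5 ∙ f 5 ^ 5 ∙ 𝟏                   ≈⟨ η-^ 0 5 5 0 ⟩
    η (+ 0) (+ 5) (+ 0) (+ 5) (+ 0) (+ 0) ∎)))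
  (R.sym (R.trans (R.*-congˡ VY) η∙))
  where
  open ≈-Reasoning
  open Solver

T-η : ∀ T → T ⋆ (f 2 ⋆ f 5) ≈ (f 1 ^⋆ 5) ⋆ (f 10 ^⋆ 5) → T ≈ V X ∙ Y
T-η T p = R.trans (≈[]⇒≈ λ N → η-divide (+ 0) (+ 1) (+ 0) (+ 1) (+ 0) (+ 0) (+ 5) (+ 0) (+ 0) (+ 0) (+ 5) (+ 0) (≈⇒≈[] (begin
    T ∙ η (+ 0) (+ 1) (+ 0) (+ 1) (+ 0) (+ 0)   ≈⟨ R.*-congˡ (R.sym (η-^ 0 1 1 0)) ⟩
    T ∙ (𝟏 ∙ f 2 ^ 1 ∙ f 5 ^ 1 ∙ 𝟏)             ≈⟨ R.*-congˡ (solve 2 (λ a b → con (+ 1) :* a :^ 1 :* b :^ 1 :* con (+ 1) := a :* b) R.refl (f 2) (f 5)) ⟩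
    T ∙ (f 2 ∙ f 5)                             ≈⟨ ⋆-∙ R.refl (⋆-∙ R.refl R.refl) ⟨
    T ⋆ (f 2 ⋆ f 5)                             ≈⟨ p ⟩
    (f 1 ^⋆ 5) ⋆ (f 10 ^⋆ 5)                    ≈⟨ ⋆-∙ (^⋆-^ (f 1) 5) (^⋆-^ (f 10) 5) ⟩
    f 1 ^ 5 ∙ f 10 ^ 5                          ≈⟨ solve 2 (λ a b → a :* b := a :* con (+ 1) :* con (+ 1) :* b) R.refl (f 1 ^ 5) (f 10 ^ 5) ⟩
    f 1 ^ 5 ∙ 𝟏 ∙ 𝟏 ∙ f 10 ^ 5                  ≈⟨ η-^ 5 0 0 5 ⟩
    η (+ 5) (+ 0) (+ 0) (+ 0) (+ 5) (+ 0) ∎)))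
  (R.sym (R.trans (R.*-congʳ VX) η∙))
  where
  open ≈-Reasoning
  open Solver

shifted-coeff : ∀ d k {x y} → x ≈ y → ∀ i j → d ℕ.+ i ≡ 2 ℕ.^ k ℕ.* j → U^ k (qPow d ∙ y) j ≡ x i
shifted-coeff d k {x} {y} p i j eq = begin
  U^ k (qPow d ∙ y) j                  ≡⟨ U^-coeff k (qPow d ∙ y) j ⟩
  (qPow d ∙ y) (2 ℕ.^ k ℕ.* j)         ≡⟨ cong (qPow d ∙ y) eq ⟨
  (qPow d ∙ y) (d ℕ.+ i)               ≡⟨ qPow-∙-+ d y i ⟩
  y i                                  ≡⟨ coeff p i ⟨
  x i                                  ∎
  where open ≡-Reasoning

-- The shift by d, which is 1 for F and 2 for G, turns both progressions into the multiples 2^k (n +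
-- 2), the positions that `U^ k` extracts.
index : ∀ k n → -[1+ 0 ] ℤ.≤ n → ∃ λ j → ∀ d i → + i ≡ + (2 ℕ.^ k) * n + + (2 ℕ.^ (k ℕ.+ 1)) - + d → d ℕ.+ i ≡ 2 ℕ.^ k ℕ.* j
index k n -1≤n = j , λ d i eq → ℤP.+-injective (begin
  + d + + i                                          ≡⟨ cong (_+_ (+ d)) eq ⟩
  + d + (P * n + + (2 ℕ.^ (k ℕ.+ 1)) - + d)          ≡⟨ cong (λ z → + d + (P * n + z - + d))
                                                          (trans (cong +_ (ℕP.^-distribˡ-+-* 2 k 1)) (ℤP.pos-* (2 ℕ.^ k) 2)) ⟩
  + d + (P * n + P * + 2 - + d)                      ≡⟨ solve 3 (λ d p n → d :+ (p :* n :+ p :* con (+ 2) :- d) := p :* (n :+ con (+ 2))) refl (+ d) P n ⟩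
  P * (n + + 2)                                      ≡⟨ cong (P *_) (ℤP.0≤i⇒+∣i∣≡i 0≤n+2) ⟨
  P * + j                                            ≡⟨ ℤP.pos-* (2 ℕ.^ k) j ⟨
  + (2 ℕ.^ k ℕ.* j)                                  ∎)
  where
  open ≡-Reasoning
  open ℤS
  P = + (2 ℕ.^ k)
  -- The bound n ≥ -1 makes n + 2 nonnegative, so the absolute value is n + 2 itself.
  j = ℤ.∣ n + + 2 ∣
  0≤n+2 : + 0 ℤ.≤ n + + 2
  0≤n+2 = ℤP.≤-trans (ℤ.+≤+ z≤n) (ℤP.+-monoˡ-≤ (+ 2) -1≤n)

theorem1p1 : (M Tstar : PowerSeries)
    → (∀ i → (M ⋆ (f 1 ⋆ f 10)) i ≡ ((f 2 ^⋆ 5) ⋆ (f 5 ^⋆ 5)) i)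
    → (∀ i → (Tstar ⋆ (f 2 ⋆ f 5)) i ≡ ((f 1 ^⋆ 5) ⋆ (f 10 ^⋆ 5)) i)
    → (k : ℕ) → 1 ≤ k → (n : ℤ) → -[1+ 0 ] ℤ.≤ n
    → (∀ (i : ℕ) → + i ≡ (+ (2 ℕ.^ k)) * n + + (2 ℕ.^ (k ℕ.+ 1)) - + 1
    → (+ (2 ℕ.^ (k ℕ.∸ 1))) ∣ M i)
    × (∀ (i : ℕ) → + i ≡ (+ (2 ℕ.^ k)) * n + + (2 ℕ.^ (k ℕ.+ 1)) - + 2
    → (+ (2 ℕ.^ (k ℕ.∸ 1))) ∣ Tstar i)
theorem1p1 M Tstar hM hT (suc k) _ n -1≤n = let (j , idx) = index (suc k) n -1≤n in
  (λ i eq → subst (+ (2 ℕ.^ k) ∣_) (shifted-coeff 1 (suc k) (M-η M (mk≈ hM)) i j (idx 1 i eq)) (∣ₛ-coeff (proj₁ (U^-FG k)) j)) ,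
  (λ i eq → subst (+ (2 ℕ.^ k) ∣_) (shifted-coeff 2 (suc k) (T-η Tstar (mk≈ hT)) i j (idx 2 i eq)) (∣ₛ-coeff (proj₂ (U^-FG k)) j))
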